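{- The functions $$\sum_{n\ge0}\frac{(4n)!}{(2n)!\,n!^2}z^n\quad\text{and}\quad\sum_{n\ge0}\Big(\sum_{k=0}^n\binom{n}{k}^6\Big)z^n$$ are algebraically independent over $\mathbb Q(z)$. -}

module Defs where

open import Data.Nat using (ℕ; zero; suc; _∸_; NonZero)
  renaming (_*_ to _*ℕ_; _^_ to _^ℕ_)
open import Data.Nat.Properties using (_!≢0; m*n≢0)
open import Data.Nat.Combinatorics using (_C_)
open import Data.Nat.Base using (_!)
open import Data.Integer using (+_)
open import Data.Rational using (ℚ; _/_; _+_; _*_; 0ℚ; 1ℚ)
open import Relation.Nullary using (yes; no)
open import Data.Nat using (_≟_; _<_)
open import Relation.Binary.PropositionalEquality using (_≡_)

PowerSeries : Set
PowerSeries = ℕ → ℚ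

sumBelow : ℕ → (ℕ → ℚ) → ℚ
sumBelow zero    f = 0ℚ
sumBelow (suc n) f = sumBelow n f + f n

_⊛_ : PowerSeries → PowerSeries → PowerSeries
(a ⊛ b) n = sumBelow (suc n) (λ k → a k * b (n ∸ k))

oneS : PowerSeries
oneS zero    = 1ℚ
oneS (suc _) = 0ℚ

zpow : ℕ → PowerSeries
zpow i n with n ≟ i
... | yes _ = 1ℚ
... | no  _ = 0ℚ

_^S_ : PowerSeries → ℕ → PowerSeries
f ^S zero  = oneS
f ^S suc j = f ⊛ (f ^S j)

-- A polynomial P(z, X, Y) ∈ ℚ[z][X,Y], given by a bound d and coefficients
-- c i j k of z^i X^j Y^k (only 0 ≤ i, j, k < d are used).
-- Evaluation P(z, f, g) as a power series, coefficient by coefficient.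
evalPoly : (d : ℕ) → (ℕ → ℕ → ℕ → ℚ) → PowerSeries → PowerSeries → PowerSeries
evalPoly d c f g n =
  sumBelow d λ i → sumBelow d λ j → sumBelow d λ k →
    c i j k * ((zpow i ⊛ ((f ^S j) ⊛ (g ^S k))) n)

-- Two power series f, g are algebraically independent over ℚ(z):
-- every polynomial P ∈ ℚ[z][X,Y] with P(z,f,g) = 0 is the zero polynomial.
-- (Clearing denominators, this is equivalent to independence over ℚ(z).)
AlgIndep : PowerSeries → PowerSeries → Set
AlgIndep f g =
  (d : ℕ) (c : ℕ → ℕ → ℕ → ℚ) →
  (∀ n → evalPoly d c f g n ≡ 0ℚ) →
  ∀ i j k → i < d → j < d → k < d → c i j k ≡ 0ℚ

seriesA : PowerSeries
seriesA n = (+ ((4 *ℕ n) !)) / ((2 *ℕ n) ! *ℕ (n ! *ℕ n !))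
  where
  instance
    i1 : NonZero (n !)
    i1 = n !≢0
    i2 : NonZero ((2 *ℕ n) !)
    i2 = (2 *ℕ n) !≢0
    i3 : NonZero (n ! *ℕ n !)
    i3 = m*n≢0 (n !) (n !)
    i4 : NonZero ((2 *ℕ n) ! *ℕ (n ! *ℕ n !))
    i4 = m*n≢0 ((2 *ℕ n) !) (n ! *ℕ n !)

seriesB : PowerSeries
seriesB n = sumBelow (suc n) (λ k → (+ ((n C k) ^ℕ 6)) / 1)

{-# OPTIONS --safe #-}

-- Modulo a prime p = 12t + 5 both coefficient sequences satisfy a Lucas congruence, so that
-- f = A · f(zᵖ) and g = B · g(zᵖ), where A and B are the truncations of f and g below degree p.
-- The products fʲgᵏ therefore solve u = a · u(zᵖ) with a = AʲBᵏ.  By a Kummer-type argument a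
-- polynomial relation of small degree between them yields polynomials x, y of small degree with
-- y a x(zᵖ) = x a′ y(zᵖ) for two of these multipliers a ≠ a′.  Since deg A = 3t + 1 = (p - 1)/4 and
-- deg B = 10t + 3, comparing degrees shows that B occurs with the same exponent in a and a′; then
-- differentiation, which kills x(zᵖ) and y(zᵖ), gives a first order differential equation for A
-- with coefficients of small degree, in conflict with the hypergeometric recurrence for f.
-- A relation over ℚ can be made integral and reduced modulo arbitrarily large primes p ≡ 5 mod 12.

module Submission where

open import Defs

open import Algebra.Bundles using (CommutativeRing; CommutativeMonoid)
import Algebra.Properties.CommutativeSemigroup as CommutativeSemigroupProperties
import Algebra.Properties.CommutativeSemiring.Exp as Exp
import Algebra.Properties.Ring as RingProperties
import Algebra.Properties.Semiring.Mult as Mult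
import Algebra.Solver.Ring.NaturalCoefficients.Default as SemiringSolver
open import Data.Empty using (⊥; ⊥-elim)
open import Data.Integer using (ℤ; +_; ∣_∣)
import Data.Integer as Int
import Data.Integer.Divisibility.Signed as ℤ∣
import Data.Integer.Properties as ℤₚ
import Data.Integer.Tactic.RingSolver as ℤ-Solver
open import Data.List using (List; _∷_)
open import Data.List.Relation.Unary.All using (All; _∷_)
open import Data.Nat as ℕ using (ℕ; zero; suc; _∸_; _≤_; _<_; z≤n; s≤s; NonZero)
open import Data.Nat.Base using (_!)
open import Data.Nat.Combinatorics
  using (_C_; nCk≡n!/k![n-k]!; k![n∸k]!∣n!; k>n⇒nCk≡0; nCn≡1; nCk+nC[k+1]≡[n+1]C[k+1]; [n-k]*[n-k-1]!≡[n-k]!)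
open import Data.Nat.Divisibility
  using (_∣_; divides; >⇒∤; ∣m+n∣m⇒∣n; ∣m⇒∣m*n; ∣n⇒∣m*n; m∣m*n; ∣1⇒≡1; ∣-refl; ∣-trans; ∣⇒≤; _∣?_)
open import Data.Nat.DivMod
  using ( _/_; _%_; m≡m%n+[m/n]*n; m%n<n; m*n/n≡m; m/n*n≡m; m*n%n≡0; [m+kn]%n≡m%n; m<n⇒m%n≡m; m<n⇒m/n≡0
        ; m<n*o⇒m/o<n; +-distrib-/-∣ʳ; %-distribˡ-* )
open import Data.Nat.ListAction using (product)
open import Data.Nat.Primality using (Prime; prime⇒nonZero; euclidsLemma; prime⇒irreducible; ¬prime[1])
open import Data.Nat.Primality.Factorisation using (factorise; PrimeFactorisation)
import Data.Nat.Properties as ℕₚ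
open import Data.Nat.Tactic.RingSolver using (solve-∀)
open import Data.Product using (∃; _×_; _,_; proj₁; proj₂)
open import Data.Rational using (ℚ; 0ℚ; ↥_; ↧ₙ_)
import Data.Rational as Rat
import Data.Rational.Properties as ℚₚ
open import Data.Rational.Unnormalised using (mkℚᵘ; *≡*)
import Data.Rational.Unnormalised.Properties as ℚᵘₚ
open import Data.Sum using (_⊎_; inj₁; inj₂)
open import Function using (_∘_)
open import Level using (0ℓ)
open import Relation.Binary.Definitions using (tri<; tri≈; tri>)
open import Relation.Binary.PropositionalEquality as ≡ using (_≡_; _≢_)
import Relation.Binary.Reasoning.Setoid as SetoidReasoning
open import Relation.Nullary using (¬_; Dec; yes; no)

-- The residue of `p` modulo 12 decides how the work is divided. Since `p ≡ 1` modulo 4, the degree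
-- `α` of `A` is exactly `(p - 1)/4`, so `A⁴` has the degree of a `(p - 1)`-st power and degrees
-- alone cannot separate powers of `A`; a differential equation has to do that. Since `p ≡ 2` modulo
-- 3, the degree `β` of `B` satisfies `3β = 10α - 1`, and this `-1` carries the whole degree
-- comparison. For `p ≡ 1` modulo 12 the degree of `B` would be `5(p - 1)/6`, and degrees could not
-- even separate `B⁶` from 1. The price is that the exact value of `β` is harder to reach: the
-- polynomial whose sum over 𝔽ₚ decides whether the coefficient of index `β` vanishes has degree
-- `p + 1`, so not its leading coefficient but the one of `x^(p-1)`, two places lower, must be shown
-- to be nonzero. The degree bounds on all auxiliary polynomials depend only on the given relation,
-- whereas `α` grows with `p`; this is why a single sufficiently large prime is enough.

-- Finite sums over a commutative ring.

module Sums (R : CommutativeRing 0ℓ 0ℓ) where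
  open CommutativeRing R
  open CommutativeSemigroupProperties (CommutativeMonoid.commutativeSemigroup +-commutativeMonoid)
    using () renaming (interchange to +-interchange)
  open SetoidReasoning setoid

  ∑ : ℕ → (ℕ → Carrier) → Carrier
  ∑ zero    f = 0#
  ∑ (suc n) f = ∑ n f + f n

  ∑-cong : ∀ n {f g} → (∀ k → k < n → f k ≈ g k) → ∑ n f ≈ ∑ n g
  ∑-cong zero    e = refl
  ∑-cong (suc n) e =
    +-cong (∑-cong n (λ k k<n → e k (ℕₚ.m<n⇒m<1+n k<n))) (e n (ℕₚ.n<1+n n))

  ∑-zero : ∀ n {f} → (∀ k → k < n → f k ≈ 0#) → ∑ n f ≈ 0#
  ∑-zero zero    e = refl
  ∑-zero (suc n) e =
    trans (+-cong (∑-zero n (λ k k<n → e k (ℕₚ.m<n⇒m<1+n k<n))) (e n (ℕₚ.n<1+n n)))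
          (+-identityˡ 0#)

  ∑-+ : ∀ n f g → ∑ n (λ k → f k + g k) ≈ ∑ n f + ∑ n g
  ∑-+ zero    f g = sym (+-identityˡ 0#)
  ∑-+ (suc n) f g = trans (+-congʳ (∑-+ n f g)) (+-interchange _ _ _ _)

  ∑-*ˡ : ∀ n c f → ∑ n (λ k → c * f k) ≈ c * ∑ n f
  ∑-*ˡ zero    c f = sym (zeroʳ c)
  ∑-*ˡ (suc n) c f = trans (+-congʳ (∑-*ˡ n c f)) (sym (distribˡ c _ _))

  ∑-*ʳ : ∀ n c f → ∑ n (λ k → f k * c) ≈ ∑ n f * c
  ∑-*ʳ n c f = trans (∑-cong n (λ k _ → *-comm (f k) c)) (trans (∑-*ˡ n c f) (*-comm c _))

  ∑-swap : ∀ m n (f : ℕ → ℕ → Carrier) → ∑ m (λ i → ∑ n (f i)) ≈ ∑ n (λ j → ∑ m (λ i → f i j))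
  ∑-swap zero    n f = sym (∑-zero n (λ _ _ → refl))
  ∑-swap (suc m) n f =
    trans (+-congʳ (∑-swap m n f)) (sym (∑-+ n (λ j → ∑ m (λ i → f i j)) (f m)))

  ∑-append : ∀ m n f → ∑ (m ℕ.+ n) f ≈ ∑ m f + ∑ n (λ k → f (m ℕ.+ k))
  ∑-append m zero    f = trans (reflexive (≡.cong (λ l → ∑ l f) (ℕₚ.+-identityʳ m))) (sym (+-identityʳ _))
  ∑-append m (suc n) f = begin
    ∑ (m ℕ.+ suc n) f                                     ≡⟨ ≡.cong (λ l → ∑ l f) (ℕₚ.+-suc m n) ⟩
    ∑ (m ℕ.+ n) f + f (m ℕ.+ n)                           ≈⟨ +-congʳ (∑-append m n f) ⟩
    (∑ m f + ∑ n (λ k → f (m ℕ.+ k))) + f (m ℕ.+ n)       ≈⟨ +-assoc _ _ _ ⟩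
    ∑ m f + ∑ (suc n) (λ k → f (m ℕ.+ k))                 ∎

  ∑-head : ∀ n f → ∑ (suc n) f ≈ f 0 + ∑ n (f ∘ suc)
  ∑-head n f = trans (∑-append 1 n f) (+-congʳ (+-identityˡ (f 0)))

  ∑-blocks : ∀ p n f → ∑ (n ℕ.* p) f ≈ ∑ n (λ q → ∑ p (λ r → f (r ℕ.+ q ℕ.* p)))
  ∑-blocks p zero    f = refl
  ∑-blocks p (suc n) f = begin
    ∑ (p ℕ.+ n ℕ.* p) f                                          ≡⟨ ≡.cong (λ l → ∑ l f) (ℕₚ.+-comm p (n ℕ.* p)) ⟩
    ∑ (n ℕ.* p ℕ.+ p) f                                          ≈⟨ ∑-append (n ℕ.* p) p f ⟩
    ∑ (n ℕ.* p) f + ∑ p (λ r → f (n ℕ.* p ℕ.+ r))                ≈⟨ +-cong (∑-blocks p n f) (∑-cong p (λ r _ → reflexive (≡.cong f (ℕₚ.+-comm (n ℕ.* p) r)))) ⟩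
    ∑ n (λ q → ∑ p (λ r → f (r ℕ.+ q ℕ.* p))) + ∑ p (λ r → f (r ℕ.+ n ℕ.* p)) ∎

  ∑-single : ∀ n k {f} → k < n → (∀ i → i < n → i ≢ k → f i ≈ 0#) → ∑ n f ≈ f k
  ∑-single (suc n) k {f} k<n e with k ℕ.≟ n
  ... | yes ≡.refl =
    trans (+-congʳ (∑-zero n (λ i i<n → e i (ℕₚ.m<n⇒m<1+n i<n) (ℕₚ.<⇒≢ i<n)))) (+-identityˡ _)
  ... | no k≢n =
    trans (+-cong (∑-single n k (ℕₚ.≤∧≢⇒< (ℕₚ.≤-pred k<n) k≢n) (λ i i<n → e i (ℕₚ.m<n⇒m<1+n i<n)))
                  (e n (ℕₚ.n<1+n n) (k≢n ∘ ≡.sym)))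
          (+-identityʳ _)

  ∑-reverse : ∀ n f → ∑ (suc n) f ≈ ∑ (suc n) (λ k → f (n ∸ k))
  ∑-reverse zero    f = refl
  ∑-reverse (suc n) f = begin
    ∑ (suc n) f + f (suc n)                    ≈⟨ +-congʳ (∑-reverse n f) ⟩
    ∑ (suc n) (λ k → f (n ∸ k)) + f (suc n)    ≈⟨ +-comm _ _ ⟩
    f (suc n) + ∑ (suc n) (λ k → f (n ∸ k))    ≈⟨ ∑-head (suc n) (λ k → f (suc n ∸ k)) ⟨
    ∑ (suc (suc n)) (λ k → f (suc n ∸ k))      ∎

-- The ring of formal power series.

module PowerSeriesRing (R : CommutativeRing 0ℓ 0ℓ) where
  open CommutativeRing R
  open Sums R
  open SetoidReasoning setoid

  Series : Set
  Series = ℕ → Carrier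

  infix 4 _≋_
  -- A record rather than a bare family of equations, so that both series can be inferred from a
  -- proof of their equality.
  record _≋_ (x y : Series) : Set where
    constructor pointwise
    field at : ∀ n → x n ≈ y n
  open _≋_ public

  infixl 7 _⊗_
  infixl 6 _⊕_

  _⊗_ : Series → Series → Series
  (x ⊗ y) n = ∑ (suc n) (λ k → x k * y (n ∸ k))

  _⊕_ : Series → Series → Series
  (x ⊕ y) n = x n + y n

  ⊖_ : Series → Series
  (⊖ x) n = - x n

  0ˢ 1ˢ : Series
  0ˢ _ = 0#
  1ˢ zero    = 1#
  1ˢ (suc _) = 0#

  tail : Series → Series
  tail x n = x (suc n)

  ⊗-cong : ∀ {x x′ y y′} → x ≋ x′ → y ≋ y′ → x ⊗ y ≋ x′ ⊗ y′
  ⊗-cong e e′ .at n = ∑-cong (suc n) (λ k _ → *-cong (at e k) (at e′ (n ∸ k)))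

  -- The Cauchy product as a recursion on the left factor. It turns associativity into an induction
  -- on the index, with no triangular double sum to exchange.
  ⊗-tail : ∀ x y n → (x ⊗ y) (suc n) ≈ x 0 * y (suc n) + (tail x ⊗ y) n
  ⊗-tail x y n = ∑-head (suc n) (λ k → x k * y (suc n ∸ k))

  ⊗-comm : ∀ x y → x ⊗ y ≋ y ⊗ x
  ⊗-comm x y .at n = begin
    (x ⊗ y) n                                        ≈⟨ ∑-reverse n _ ⟩
    ∑ (suc n) (λ k → x (n ∸ k) * y (n ∸ (n ∸ k)))    ≈⟨ ∑-cong (suc n) (λ k k<sn → trans (*-comm _ _)
                                                          (*-congʳ (reflexive (≡.cong y (ℕₚ.m∸[m∸n]≡n (ℕₚ.≤-pred k<sn)))))) ⟩
    (y ⊗ x) n                                        ∎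

  ⊗-distribʳ : ∀ x y z → (y ⊕ z) ⊗ x ≋ (y ⊗ x) ⊕ (z ⊗ x)
  ⊗-distribʳ x y z .at n =
    trans (∑-cong (suc n) (λ k _ → distribʳ (x (n ∸ k)) (y k) (z k))) (∑-+ (suc n) _ _)

  ⊗-scale : ∀ c x y n → ((λ k → c * x k) ⊗ y) n ≈ c * (x ⊗ y) n
  ⊗-scale c x y n = trans (∑-cong (suc n) (λ k _ → *-assoc c (x k) (y (n ∸ k)))) (∑-*ˡ (suc n) c _)

  ⊗-assoc : ∀ x y z → (x ⊗ y) ⊗ z ≋ x ⊗ (y ⊗ z)
  ⊗-assoc x y z .at n = go n x
    where
    go : ∀ n x → ((x ⊗ y) ⊗ z) n ≈ (x ⊗ (y ⊗ z)) n
    go zero x = +-congˡ (begin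
      (0# + x 0 * y 0) * z 0     ≈⟨ *-congʳ (+-identityˡ _) ⟩
      (x 0 * y 0) * z 0          ≈⟨ *-assoc _ _ _ ⟩
      x 0 * (y 0 * z 0)          ≈⟨ *-congˡ (+-identityˡ _) ⟨
      x 0 * (0# + y 0 * z 0)     ∎)
    go (suc n) x = begin
      ((x ⊗ y) ⊗ z) (suc n)
        ≈⟨ ⊗-tail (x ⊗ y) z n ⟩
      (x ⊗ y) 0 * z (suc n) + (tail (x ⊗ y) ⊗ z) n
        ≈⟨ +-cong (trans (*-congʳ (+-identityˡ _)) (*-assoc _ _ _))
                  (trans (⊗-cong {y = z} (pointwise (⊗-tail x y)) (pointwise (λ _ → refl)) .at n)
                         (⊗-distribʳ z (λ k → x 0 * tail y k) (tail x ⊗ y) .at n)) ⟩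
      x 0 * (y 0 * z (suc n)) + (((λ k → x 0 * tail y k) ⊗ z) n + ((tail x ⊗ y) ⊗ z) n)
        ≈⟨ +-congˡ (+-cong (⊗-scale (x 0) (tail y) z n) (go n (tail x))) ⟩
      x 0 * (y 0 * z (suc n)) + (x 0 * (tail y ⊗ z) n + (tail x ⊗ (y ⊗ z)) n)
        ≈⟨ +-assoc _ _ _ ⟨
      (x 0 * (y 0 * z (suc n)) + x 0 * (tail y ⊗ z) n) + (tail x ⊗ (y ⊗ z)) n
        ≈⟨ +-congʳ (distribˡ _ _ _) ⟨
      x 0 * (y 0 * z (suc n) + (tail y ⊗ z) n) + (tail x ⊗ (y ⊗ z)) n
        ≈⟨ +-congʳ (*-congˡ (⊗-tail y z n)) ⟨
      x 0 * (y ⊗ z) (suc n) + (tail x ⊗ (y ⊗ z)) n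
        ≈⟨ ⊗-tail x (y ⊗ z) n ⟨
      (x ⊗ (y ⊗ z)) (suc n) ∎

  ⊗-identityˡ : ∀ x → 1ˢ ⊗ x ≋ x
  ⊗-identityˡ x .at n = begin
    (1ˢ ⊗ x) n     ≈⟨ ∑-single (suc n) 0 (s≤s z≤n) vanish ⟩
    1# * x n       ≈⟨ *-identityˡ (x n) ⟩
    x n            ∎
    where
    vanish : ∀ i → i < suc n → i ≢ 0 → 1ˢ i * x (n ∸ i) ≈ 0#
    vanish zero    _ i≢0 = ⊥-elim (i≢0 ≡.refl)
    vanish (suc i) _ _   = zeroˡ _

  seriesRing : CommutativeRing 0ℓ 0ℓ
  seriesRing = record
    { Carrier = Series
    ; _≈_ = _≋_
    ; _+_ = _⊕_
    ; _*_ = _⊗_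
    ; -_ = ⊖_
    ; 0# = 0ˢ
    ; 1# = 1ˢ
    ; isCommutativeRing = record
      { isRing = record
        { +-isAbelianGroup = record
          { isGroup = record
            { isMonoid = record
              { isSemigroup = record
                { isMagma = record
                  { isEquivalence = record
                    { refl = pointwise (λ _ → refl)
                    ; sym = λ e → pointwise (λ n → sym (at e n))
                    ; trans = λ e e′ → pointwise (λ n → trans (at e n) (at e′ n)) }
                  ; ∙-cong = λ e e′ → pointwise (λ n → +-cong (at e n) (at e′ n)) }
                ; assoc = λ x y z → pointwise (λ n → +-assoc (x n) (y n) (z n)) }
              ; identity = (λ x → pointwise (λ n → +-identityˡ (x n)))
                         , (λ x → pointwise (λ n → +-identityʳ (x n))) }
            ; inverse = (λ x → pointwise (λ n → -‿inverseˡ (x n)))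
                      , (λ x → pointwise (λ n → -‿inverseʳ (x n)))
            ; ⁻¹-cong = λ e → pointwise (λ n → -‿cong (at e n)) }
          ; comm = λ x y → pointwise (λ n → +-comm (x n) (y n)) }
        ; *-cong = ⊗-cong
        ; *-assoc = ⊗-assoc
        ; *-identity = ⊗-identityˡ
                     , (λ x → pointwise (λ n → trans (at (⊗-comm x 1ˢ) n) (at (⊗-identityˡ x) n)))
        ; distrib = (λ x y z → pointwise (λ n → trans (at (⊗-comm x (y ⊕ z)) n)
                        (trans (at (⊗-distribʳ x y z) n)
                               (+-cong (at (⊗-comm y x) n) (at (⊗-comm z x) n)))))
                  , ⊗-distribʳ }
      ; *-comm = ⊗-comm } }

-- Polynomials as power series that vanish from some index on.

∸-intro : ∀ k {m n} → k ℕ.+ m ≤ n → m ≤ n ∸ k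
∸-intro k {m} k+m≤n = ℕₚ.m+n≤o⇒m≤o∸n m (ℕₚ.≤-trans (ℕₚ.≤-reflexive (ℕₚ.+-comm m k)) k+m≤n)

module Polynomials (R : CommutativeRing 0ℓ 0ℓ) where
  open CommutativeRing R
  open Sums R
  open PowerSeriesRing R
  open SetoidReasoning setoid

  open CommutativeRing seriesRing public using () renaming
    ( setoid to series-setoid; refl to ≋-refl; sym to ≋-sym; trans to ≋-trans
    ; +-cong to ⊕-cong
    ; zeroˡ to ⊗-zeroˡ; zeroʳ to ⊗-zeroʳ)
  open Exp (CommutativeRing.commutativeSemiring seriesRing) public
    using () renaming (_^_ to _^ˢ_; ^-homo-* to ^ˢ-homo-⊗)
  open CommutativeSemigroupProperties
    (CommutativeMonoid.commutativeSemigroup (CommutativeRing.*-commutativeMonoid seriesRing)) public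
    using () renaming (interchange to ⊗-interchange; x∙yz≈y∙xz to x⊗yz≋y⊗xz; xy∙z≈xz∙y to xy⊗z≋xz⊗y)

  Below : ℕ → Series → Set
  Below N x = ∀ n → N ≤ n → x n ≈ 0#

  HasDegree : Series → ℕ → Set
  HasDegree x e = ¬ (x e ≈ 0#) × Below (suc e) x

  below-mono : ∀ {M N x} → M ≤ N → Below M x → Below N x
  below-mono M≤N b n N≤n = b n (ℕₚ.≤-trans M≤N N≤n)

  below-⊕ : ∀ {N x y} → Below N x → Below N y → Below N (x ⊕ y)
  below-⊕ b c n N≤n = trans (+-cong (b n N≤n) (c n N≤n)) (+-identityˡ 0#)

  product-zero : ∀ {a b} → a ≈ 0# ⊎ b ≈ 0# → a * b ≈ 0#
  product-zero (inj₁ a≈0) = trans (*-congʳ a≈0) (zeroˡ _)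
  product-zero (inj₂ b≈0) = trans (*-congˡ b≈0) (zeroʳ _)

  degrees-split : ∀ {M N n} k → M ℕ.+ N ≤ n → M ≤ k ⊎ N ≤ n ∸ k
  degrees-split {M} {N} {n} k M+N≤n with M ℕ.≤? k
  ... | yes M≤k = inj₁ M≤k
  ... | no  M≰k = inj₂ (∸-intro k
    (ℕₚ.≤-trans (ℕₚ.+-monoˡ-≤ N (ℕₚ.<⇒≤ (ℕₚ.≰⇒> M≰k))) M+N≤n))

  -- `M + N - 1` would be sharp; one unit is given away to avoid a subtraction. Where degrees must
  -- be exact, `hasDegree-⊗` is used instead.
  below-⊗ : ∀ {M N x y} → Below M x → Below N y → Below (M ℕ.+ N) (x ⊗ y)
  below-⊗ {x = x} {y} b c n M+N≤n = ∑-zero (suc n) (λ k _ → product-zero (vanish k (degrees-split k M+N≤n)))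
    where
    vanish : ∀ k → _ → x k ≈ 0# ⊎ y (n ∸ k) ≈ 0#
    vanish k (inj₁ M≤k)  = inj₁ (b k M≤k)
    vanish k (inj₂ N≤n∸k) = inj₂ (c (n ∸ k) N≤n∸k)

  below-1 : Below 1 1ˢ
  below-1 (suc n) _ = refl

  leading-⊗ : ∀ {d e x y} → Below (suc d) x → Below (suc e) y → (x ⊗ y) (d ℕ.+ e) ≈ x d * y e
  leading-⊗ {d} {e} {x} {y} b c =
    trans (∑-single (suc (d ℕ.+ e)) d (s≤s (ℕₚ.m≤m+n d e)) vanish)
          (*-congˡ (reflexive (≡.cong y (ℕₚ.m+n∸m≡n d e))))
    where
    vanish : ∀ k → k < suc (d ℕ.+ e) → k ≢ d → x k * y (d ℕ.+ e ∸ k) ≈ 0#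
    vanish k _ k≢d with suc d ℕ.≤? k
    ... | yes d<k = product-zero (inj₁ (b k d<k))
    ... | no  d≮k = product-zero (inj₂ (c _ (∸-intro k (ℕₚ.≤-trans (ℕₚ.≤-reflexive (ℕₚ.+-suc k e))
          (ℕₚ.+-monoˡ-≤ e (ℕₚ.≤∧≢⇒< (ℕₚ.≤-pred (ℕₚ.≰⇒> d≮k)) k≢d))))))

  hasDegree-cong : ∀ {x y e} → x ≋ y → HasDegree x e → HasDegree y e
  hasDegree-cong x≋y (nz , b) = (λ ye≈0 → nz (trans (at x≋y _) ye≈0))
                              , (λ n e<n → trans (sym (at x≋y n)) (b n e<n))

  hasDegree-unique : ∀ {x d e} → HasDegree x d → HasDegree x e → d ≡ e
  hasDegree-unique {x} {d} {e} (nz , b) (nz′ , b′) with ℕₚ.<-cmp d e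
  ... | tri< d<e _ _ = ⊥-elim (nz′ (b e d<e))
  ... | tri≈ _ d≡e _ = d≡e
  ... | tri> _ _ e<d = ⊥-elim (nz (b′ d e<d))

  -- A series with constant term 1 is invertible, so the coefficients of `x` vanish one after the
  -- other. This covers factors that are not polynomials, such as the solutions `u m` of the Kummer
  -- argument.
  ⊗-cancel-unit : ∀ {x u} → u 0 ≈ 1# → x ⊗ u ≋ 0ˢ → ∀ n → x n ≈ 0#
  ⊗-cancel-unit {x} {u} u₀≈1 xu≋0 n = upTo (suc n) n (ℕₚ.n<1+n n)
    where
    upTo : ∀ N n → n < N → x n ≈ 0#
    upTo (suc N) n n<sN with n ℕ.<? N
    ... | yes n<N = upTo N n n<N
    ... | no  n≮N = begin
      x n                                                ≈⟨ *-identityʳ (x n) ⟨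
      x n * 1#                                           ≈⟨ *-congˡ u₀≈1 ⟨
      x n * u 0                                          ≈⟨ *-congˡ (reflexive (≡.cong u (ℕₚ.n∸n≡0 n))) ⟨
      x n * u (n ∸ n)                                    ≈⟨ +-identityˡ _ ⟨
      0# + x n * u (n ∸ n)                               ≈⟨ +-congʳ (∑-zero n (λ k k<n → product-zero (inj₁ (upTo N k
                                                              (ℕₚ.<-≤-trans k<n (ℕₚ.≤-pred n<sN)))))) ⟨
      ∑ n (λ k → x k * u (n ∸ k)) + x n * u (n ∸ n)      ≈⟨ at xu≋0 n ⟩
      0#                                                 ∎

-- The substitution of z^p and the Cartier operators.

module Frobenius (R : CommutativeRing 0ℓ 0ℓ) (p : ℕ) .{{_ : NonZero p}} where
  open CommutativeRing R
  open Sums R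
  open PowerSeriesRing R
  open Polynomials R
  open SetoidReasoning setoid

  -- σ h is h(z^p), and Λ r is the Cartier operator extracting the residue class r.
  σ : Series → Series
  σ h n with n % p
  ... | zero  = h (n / p)
  ... | suc _ = 0#

  Λ : ℕ → Series → Series
  Λ r h n = h (r ℕ.+ n ℕ.* p)

  σ-multiple : ∀ h n → σ h (n ℕ.* p) ≈ h n
  σ-multiple h n with (n ℕ.* p) % p | m*n%n≡0 n p
  ... | zero | _ = reflexive (≡.cong h (m*n/n≡m n p))

  σ-nonmultiple : ∀ h r n → r ≢ 0 → r < p → σ h (r ℕ.+ n ℕ.* p) ≈ 0#
  σ-nonmultiple h r n r≢0 r<p
    with (r ℕ.+ n ℕ.* p) % p | ≡.trans ([m+kn]%n≡m%n r n p) (m<n⇒m%n≡m r<p)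
  ... | zero  | eq = ⊥-elim (r≢0 (≡.sym eq))
  ... | suc _ | _  = refl

  σ-cong : ∀ {x y} → x ≋ y → σ x ≋ σ y
  σ-cong e .at n with n % p
  ... | zero  = at e (n / p)
  ... | suc _ = refl

  0<p : 0 < p
  0<p = ℕ.>-nonZero⁻¹ p

  by-residues : ∀ {x y} → (∀ r → r < p → Λ r x ≋ Λ r y) → x ≋ y
  by-residues {x} {y} e .at n = begin
    x n                              ≡⟨ ≡.cong x (m≡m%n+[m/n]*n n p) ⟩
    x (n % p ℕ.+ (n / p) ℕ.* p)      ≈⟨ at (e (n % p) (m%n<n n p)) (n / p) ⟩
    y (n % p ℕ.+ (n / p) ℕ.* p)      ≡⟨ ≡.cong y (m≡m%n+[m/n]*n n p) ⟨
    y n                              ∎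

  Λ-cong : ∀ r {x y} → x ≋ y → Λ r x ≋ Λ r y
  Λ-cong r e .at n = at e (r ℕ.+ n ℕ.* p)

  -- The projection formula. `σ w` lives on the multiples of `p`, so each block of `p` summands
  -- keeps only the one of index `q p`, where `h` is read in the residue class `r`. The last block
  -- is cut off after `r + 1` summands but still contains its only nonzero one.
  Λ-⊗-σ : ∀ r → r < p → ∀ h w → Λ r (h ⊗ σ w) ≋ Λ r h ⊗ w
  Λ-⊗-σ r r<p h w = ≋-trans (pointwise flipped) (⊗-comm w (Λ r h))
    where
    module _ (n : ℕ) where
      N : ℕ
      N = r ℕ.+ n ℕ.* p
      F : ℕ → Carrier
      F k = σ w k * h (N ∸ k)

      vanish : ∀ q i → i < p → i ≢ 0 → F (i ℕ.+ q ℕ.* p) ≈ 0#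
      vanish q i i<p i≢0 = product-zero (inj₁ (σ-nonmultiple w i q i≢0 i<p))

      term : ∀ q → q ≤ n → F (q ℕ.* p) ≈ w q * Λ r h (n ∸ q)
      term q q≤n = *-cong (σ-multiple w q) (reflexive (≡.cong h (≡.trans
        (ℕₚ.+-∸-assoc r (ℕₚ.*-monoˡ-≤ p q≤n))
        (≡.cong (r ℕ.+_) (≡.sym (ℕₚ.*-distribʳ-∸ p n q))))))

      flipped : (h ⊗ σ w) N ≈ (w ⊗ Λ r h) n
      flipped = begin
        (h ⊗ σ w) N
          ≈⟨ at (⊗-comm h (σ w)) N ⟩
        ∑ (suc r ℕ.+ n ℕ.* p) F
          ≡⟨ ≡.cong (λ l → ∑ l F) (ℕₚ.+-comm (suc r) (n ℕ.* p)) ⟩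
        ∑ (n ℕ.* p ℕ.+ suc r) F
          ≈⟨ ∑-append (n ℕ.* p) (suc r) F ⟩
        ∑ (n ℕ.* p) F + ∑ (suc r) (λ i → F (n ℕ.* p ℕ.+ i))
          ≈⟨ +-cong
               (trans (∑-blocks p n F) (∑-cong n (λ q q<n →
                 trans (∑-single p 0 0<p (λ i → vanish q i)) (term q (ℕₚ.<⇒≤ q<n)))))
               (trans (∑-single (suc r) 0 (s≤s z≤n) (λ i i≤r i≢0 →
                   trans (reflexive (≡.cong F (ℕₚ.+-comm (n ℕ.* p) i)))
                         (vanish n i (ℕₚ.<-≤-trans i≤r r<p) i≢0)))
                 (trans (reflexive (≡.cong F (ℕₚ.+-identityʳ (n ℕ.* p)))) (term n ℕₚ.≤-refl))) ⟩
        (w ⊗ Λ r h) n ∎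

  Λ-σ-zero : ∀ h → Λ 0 (σ h) ≋ h
  Λ-σ-zero h .at n = σ-multiple h n

  σ-⊗ : ∀ x y → σ (x ⊗ y) ≋ σ x ⊗ σ y
  σ-⊗ x y = by-residues step
    where
    step : ∀ r → r < p → Λ r (σ (x ⊗ y)) ≋ Λ r (σ x ⊗ σ y)
    step zero r<p = ≋-trans (Λ-σ-zero (x ⊗ y))
      (≋-sym (≋-trans (Λ-⊗-σ 0 r<p (σ x) y) (⊗-cong (Λ-σ-zero x) (≋-refl {y}))))
    step r@(suc _) r<p = ≋-trans (pointwise (λ n → σ-nonmultiple (x ⊗ y) r n (λ ()) r<p))
      (≋-sym (≋-trans (Λ-⊗-σ r r<p (σ x) y)
        (≋-trans (⊗-cong (pointwise (λ n → σ-nonmultiple x r n (λ ()) r<p)) (≋-refl {y})) (⊗-zeroˡ y))))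

  σ-1 : σ 1ˢ ≋ 1ˢ
  σ-1 = by-residues step
    where
    step : ∀ r → r < p → Λ r (σ 1ˢ) ≋ Λ r 1ˢ
    step zero r<p = pointwise λ
      { zero    → σ-multiple 1ˢ 0
      ; (suc n) → trans (σ-multiple 1ˢ (suc n)) (sym (below-1 (suc n ℕ.* p)
                    (ℕₚ.≤-trans 0<p (ℕₚ.m≤m+n p (n ℕ.* p))))) }
    step r@(suc _) r<p = pointwise (λ n → σ-nonmultiple 1ˢ r n (λ ()) r<p)

  σ-hasDegree : ∀ {h e} → HasDegree h e → HasDegree (σ h) (e ℕ.* p)
  σ-hasDegree {h} {e} (nz , b) = (λ eq → nz (trans (sym (σ-multiple h e)) eq)) , vanish
    where
    vanish : Below (suc (e ℕ.* p)) (σ h)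
    vanish n ep<n with n % p | m≡m%n+[m/n]*n n p
    ... | suc _ | _  = refl
    ... | zero  | eq = b (n / p) (ℕₚ.*-cancelʳ-< p e (n / p) (≡.subst (e ℕ.* p <_) eq ep<n))

-- Degrees and cancellation over a domain.

-- `zero?` makes the degree of a bounded polynomial computable, so that every split into "zero" or
-- "of exact degree e" is constructive.
record DecidableDomain (R : CommutativeRing 0ℓ 0ℓ) : Set where
  open CommutativeRing R
  field
    zero? : ∀ a → Dec (a ≈ 0#)
    noZeroDivisors : ∀ {a b} → a * b ≈ 0# → a ≈ 0# ⊎ b ≈ 0#
    1≉0 : ¬ (1# ≈ 0#)

module DomainPolynomials (R : CommutativeRing 0ℓ 0ℓ) (isDomain : DecidableDomain R) where
  open CommutativeRing R
  open DecidableDomain isDomain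
  open PowerSeriesRing R
  open Polynomials R
  open RingProperties (CommutativeRing.ring seriesRing) using (x∙y⁻¹≈ε⇒x≈y; [y-z]x≈yx-zx)

  degree? : ∀ N {x} → Below N x → x ≋ 0ˢ ⊎ ∃ λ e → e < N × HasDegree x e
  degree? zero    b = inj₁ (pointwise (λ n → b n z≤n))
  degree? (suc N) {x} b with zero? (x N)
  ... | no  xN≉0 = inj₂ (N , ℕₚ.n<1+n N , xN≉0 , b)
  ... | yes xN≈0 with degree? N {x} below
    where
    below : Below N x
    below n N≤n with N ℕ.≟ n
    ... | yes ≡.refl = xN≈0
    ... | no  N≢n    = b n (ℕₚ.≤∧≢⇒< N≤n N≢n)
  ... | inj₁ x≋0            = inj₁ x≋0
  ... | inj₂ (e , e<N , he) = inj₂ (e , ℕₚ.m<n⇒m<1+n e<N , he)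

  ¬hasDegree-0 : ∀ {x e} → x ≋ 0ˢ → ¬ HasDegree x e
  ¬hasDegree-0 x≋0 (nz , _) = nz (at x≋0 _)

  hasDegree-⊗ : ∀ {x y d e} → HasDegree x d → HasDegree y e → HasDegree (x ⊗ y) (d ℕ.+ e)
  hasDegree-⊗ {x} {y} {d} {e} (nz , b) (nz′ , b′) = leading≉0 , below
    where
    leading≉0 : ¬ ((x ⊗ y) (d ℕ.+ e) ≈ 0#)
    leading≉0 eq with noZeroDivisors (trans (sym (leading-⊗ {x = x} {y} b b′)) eq)
    ... | inj₁ xd≈0 = nz xd≈0
    ... | inj₂ ye≈0 = nz′ ye≈0
    open Sums R
    below : Below (suc (d ℕ.+ e)) (x ⊗ y)
    below n d+e<n = ∑-zero (suc n) (λ k _ → product-zero (vanish k))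
      where
      vanish : ∀ k → x k ≈ 0# ⊎ y (n ∸ k) ≈ 0#
      vanish k with suc d ℕ.≤? k
      ... | yes d<k = inj₁ (b k d<k)
      ... | no  d≮k = inj₂ (b′ (n ∸ k) (∸-intro k (ℕₚ.≤-trans (ℕₚ.≤-reflexive (ℕₚ.+-suc k e))
            (ℕₚ.≤-trans (s≤s (ℕₚ.+-monoˡ-≤ e (ℕₚ.≤-pred (ℕₚ.≰⇒> d≮k)))) d+e<n))))

  hasDegree-1 : HasDegree 1ˢ 0
  hasDegree-1 = 1≉0 , below-1

  hasDegree-^ : ∀ {x d} → HasDegree x d → ∀ j → HasDegree (x ^ˢ j) (j ℕ.* d)
  hasDegree-^ h zero    = hasDegree-1
  hasDegree-^ h (suc j) = hasDegree-⊗ h (hasDegree-^ h j)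

  ⊗-zeroDivisor : ∀ {N x y e} → Below N x → HasDegree y e → x ⊗ y ≋ 0ˢ → x ≋ 0ˢ
  ⊗-zeroDivisor {N} b hy xy≋0 with degree? N b
  ... | inj₁ x≋0          = x≋0
  ... | inj₂ (_ , _ , hx) = ⊥-elim (¬hasDegree-0 xy≋0 (hasDegree-⊗ hx hy))

  below-⊖ : ∀ {N x} → Below N x → Below N (⊖ x)
  below-⊖ b n N≤n = trans (-‿cong (b n N≤n)) (RingProperties.-0#≈0# ring)

  ⊗-cancelʳ : ∀ {N x y z e} → Below N x → Below N y → HasDegree z e → x ⊗ z ≋ y ⊗ z → x ≋ y
  ⊗-cancelʳ {x = x} {y} {z} bx by hz xz≋yz =
    x∙y⁻¹≈ε⇒x≈y x y (⊗-zeroDivisor (below-⊕ {x = x} {⊖ y} bx (below-⊖ by)) hz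
      (≋-trans ([y-z]x≈yx-zx z x y)
        (≋-trans (⊕-cong xz≋yz ≋-refl) (CommutativeRing.-‿inverseʳ seriesRing (y ⊗ z)))))

-- Linear independence over polynomials of solutions of u = a · σ u whose multipliers are
-- pairwise inequivalent modulo (p-1)-st powers (Kummer theory with the Cartier operator
-- in place of Galois groups): if c is a shortest relation, so is each Λ r (c a), hence the two
-- are proportional, which forces cₙ aₙ σ(cₘ) = cₘ aₘ σ(cₙ).
module Kummer (R : CommutativeRing 0ℓ 0ℓ) (isDomain : DecidableDomain R) (p : ℕ) .{{_ : NonZero p}} where
  open CommutativeRing R
  open PowerSeriesRing R
  open Polynomials R
  open Frobenius R p
  open DomainPolynomials R isDomain
  open Sums seriesRing
  open RingProperties (CommutativeRing.ring seriesRing) using (-‿distribˡ-*; x∙y⁻¹≈ε⇒x≈y)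
  open SetoidReasoning series-setoid

  -- `S` counts the solutions, `D` bounds the degrees of their multipliers in units of `p`, and `K`
  -- is the ceiling for the degrees of all coefficient polynomials that the descent produces.
  module Independence
    (u a : ℕ → Series) (frobenius : ∀ m → u m ≋ a m ⊗ σ (u m)) (u₀≈1 : ∀ m → u m 0 ≈ 1#)
    (S D K : ℕ) (K<p : K < p)
    (a-below : ∀ m → m < S → Below (D ℕ.* p ℕ.+ 1) (a m))
    (inequivalent : ∀ {m n x y d e} → m < S → n < S → m ≢ n → d < K → e < K →
      HasDegree x d → HasDegree y e → ¬ ((y ⊗ a n) ⊗ σ x ≋ (x ⊗ a m) ⊗ σ y)) where

    Relation : ℕ → (ℕ → Series) → Set
    Relation s c = ∑ s (λ m → c m ⊗ u m) ≋ 0ˢ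

    Λ-∑ : ∀ r s f → Λ r (∑ s f) ≋ ∑ s (λ m → Λ r (f m))
    Λ-∑ r zero    f = ≋-refl
    Λ-∑ r (suc s) f = ⊕-cong (Λ-∑ r s f) (≋-refl {Λ r (f s)})

    -- Because `c u = (c a) σ u`, the projection formula moves `Λ r` past `σ u` and returns a
    -- relation between the same solutions.
    cartier-relation : ∀ r → r < p → ∀ s {c} → Relation s c → Relation s (λ m → Λ r (c m ⊗ a m))
    cartier-relation r r<p s {c} rel = begin
      ∑ s (λ m → Λ r (c m ⊗ a m) ⊗ u m)        ≈⟨ ∑-cong s (λ m _ → Λ-⊗-σ r r<p (c m ⊗ a m) (u m)) ⟨
      ∑ s (λ m → Λ r ((c m ⊗ a m) ⊗ σ (u m)))  ≈⟨ ∑-cong s (λ m _ → Λ-cong r (≋-trans (⊗-assoc (c m) (a m) (σ (u m)))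
                                                    (⊗-cong ≋-refl (≋-sym (frobenius m))))) ⟩
      ∑ s (λ m → Λ r (c m ⊗ u m))              ≈⟨ Λ-∑ r s _ ⟨
      Λ r (∑ s (λ m → c m ⊗ u m))              ≈⟨ Λ-cong r rel ⟩
      0ˢ                                       ∎

    combine-relations : ∀ s {c c′} x y → Relation s c → Relation s c′ →
      Relation s (λ m → (x ⊗ c m) ⊕ (y ⊗ c′ m))
    combine-relations s {c} {c′} x y rel rel′ = begin
      ∑ s (λ m → ((x ⊗ c m) ⊕ (y ⊗ c′ m)) ⊗ u m)
        ≈⟨ ∑-cong s (λ m _ → ≋-trans (⊗-distribʳ (u m) (x ⊗ c m) (y ⊗ c′ m))
             (⊕-cong (⊗-assoc x (c m) (u m)) (⊗-assoc y (c′ m) (u m)))) ⟩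
      ∑ s (λ m → (x ⊗ (c m ⊗ u m)) ⊕ (y ⊗ (c′ m ⊗ u m)))
        ≈⟨ ∑-+ s _ _ ⟩
      ∑ s (λ m → x ⊗ (c m ⊗ u m)) ⊕ ∑ s (λ m → y ⊗ (c′ m ⊗ u m))
        ≈⟨ ⊕-cong (∑-*ˡ s x _) (∑-*ˡ s y _) ⟩
      (x ⊗ ∑ s (λ m → c m ⊗ u m)) ⊕ (y ⊗ ∑ s (λ m → c′ m ⊗ u m))
        ≈⟨ ⊕-cong (≋-trans (⊗-cong (≋-refl {x}) rel) (⊗-zeroʳ x)) (≋-trans (⊗-cong (≋-refl {y}) rel′) (⊗-zeroʳ y)) ⟩
      0ˢ ⊕ 0ˢ
        ≈⟨ CommutativeRing.+-identityˡ seriesRing 0ˢ ⟩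
      0ˢ ∎

    drop-last : ∀ s {c} → c s ≋ 0ˢ → Relation (suc s) c → Relation s c
    drop-last s {c} cs≋0 rel = begin
      ∑ s (λ m → c m ⊗ u m)                    ≈⟨ CommutativeRing.+-identityʳ seriesRing _ ⟨
      ∑ s (λ m → c m ⊗ u m) ⊕ 0ˢ               ≈⟨ ⊕-cong ≋-refl (≋-trans (⊗-cong cs≋0 (≋-refl {u s})) (⊗-zeroˡ (u s))) ⟨
      ∑ (suc s) (λ m → c m ⊗ u m)              ≈⟨ rel ⟩
      0ˢ                                       ∎

    -- `Λ r` divides degrees by `p`. For a coefficient of degree below `p` and a multiplier of
    -- degree at most `D p` the result has degree at most `D`, whatever `N` was.
    cartier-below : ∀ {N c m} r → m < S → N < p → Below N c → Below (suc D) (Λ r (c ⊗ a m))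
    cartier-below {N} {c} {m} r m<S N<p b n D<n =
      below-⊗ {x = c} {a m} b (a-below m m<S) (r ℕ.+ n ℕ.* p) bound
      where
      bound : N ℕ.+ (D ℕ.* p ℕ.+ 1) ≤ r ℕ.+ n ℕ.* p
      bound = ℕₚ.≤-trans (ℕₚ.≤-reflexive (≡.trans (≡.cong (N ℕ.+_) (ℕₚ.+-comm _ 1)) (ℕₚ.+-suc N _)))
        (ℕₚ.≤-trans (ℕₚ.+-monoˡ-≤ (D ℕ.* p) N<p)
          (ℕₚ.≤-trans (ℕₚ.*-monoˡ-≤ p D<n) (ℕₚ.m≤n+m (n ℕ.* p) r)))

    -- Induction on the length of the relation. Eliminating the last term by cross multiplication
    -- doubles the degree bound, and `N * 2 ^ s ≤ K` reserves room for the `s` eliminations to come;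
    -- `suc D ≤ N` lets the Cartier images obey the same bound as the original coefficients.
    independent : ∀ s N → s ≤ S → suc D ≤ N → N ℕ.* 2 ℕ.^ s ≤ K → ∀ c →
      (∀ m → m < s → Below N (c m)) → Relation s c → ∀ m → m < s → c m ≋ 0ˢ
    independent (suc s) N s<S D<N N2^s≤K c below rel = conclude (degree? N (below s (ℕₚ.n<1+n s)))
      where
      N≤2N : N ≤ N ℕ.+ N
      N≤2N = ℕₚ.m≤m+n N N

      2N2^s≤K : (N ℕ.+ N) ℕ.* 2 ℕ.^ s ≤ K
      2N2^s≤K = ≡.subst (_≤ K) (≡.trans (≡.sym (ℕₚ.*-assoc N 2 (2 ℕ.^ s)))
        (≡.cong (ℕ._* 2 ℕ.^ s) (≡.trans (ℕₚ.*-comm N 2) (≡.cong (N ℕ.+_) (ℕₚ.+-identityʳ N))))) N2^s≤K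

      N≤K : N ≤ K
      N≤K = ℕₚ.≤-trans (ℕₚ.≤-trans N≤2N (ℕₚ.m≤m*n (N ℕ.+ N) (2 ℕ.^ s) {{ℕₚ.m^n≢0 2 s}})) 2N2^s≤K

      below′ : ∀ m → m < s → Below N (c m)
      below′ m m<s = below m (ℕₚ.m<n⇒m<1+n m<s)

      c^ : ℕ → ℕ → Series
      c^ r m = Λ r (c m ⊗ a m)

      c^-below : ∀ r m → m < suc s → Below N (c^ r m)
      c^-below r m m≤s = below-mono D<N (cartier-below r (ℕₚ.≤-trans m≤s s<S) (ℕₚ.≤-<-trans N≤K K<p) (below m m≤s))

      -- Subtracting suitable multiples of the relation and of its Cartier image cancels the last
      -- term; the shorter relation that remains is trivial by induction.
      proportional : ∀ r → r < p → ∀ n → n < s → c^ r n ⊗ c s ≋ c^ r s ⊗ c n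
      proportional r r<p n n<s = ≋-trans (⊗-comm (c^ r n) (c s)) (x∙y⁻¹≈ε⇒x≈y _ _
        (≋-trans (⊕-cong ≋-refl (-‿distribˡ-* (c^ r s) (c n)))
          (independent s (N ℕ.+ N) (ℕₚ.<⇒≤ s<S) (ℕₚ.≤-trans D<N N≤2N) 2N2^s≤K
            combination
            (λ m m<s → below-⊕ {x = c s ⊗ c^ r m} {(⊖ c^ r s) ⊗ c m}
               (below-⊗ {x = c s} {c^ r m} (below s (ℕₚ.n<1+n s)) (c^-below r m (ℕₚ.m<n⇒m<1+n m<s)))
               (below-⊗ {x = ⊖ c^ r s} {c m} (below-⊖ {x = c^ r s} (c^-below r s (ℕₚ.n<1+n s))) (below′ m m<s)))
            (drop-last s combination-last
              (combine-relations (suc s) (c s) (⊖ c^ r s) (cartier-relation r r<p (suc s) rel) rel))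
            n n<s)))
        where
        combination : ℕ → Series
        combination m = (c s ⊗ c^ r m) ⊕ ((⊖ c^ r s) ⊗ c m)
        combination-last : combination s ≋ 0ˢ
        combination-last = ≋-trans (⊕-cong (⊗-comm (c s) (c^ r s)) (≋-sym (-‿distribˡ-* (c^ r s) (c s))))
          (CommutativeRing.-‿inverseʳ seriesRing _)

      -- The proportionalities of all residue classes are the Cartier components of one equation,
      -- which no longer mentions `Λ`.
      equivalent : ∀ n → n < s → (c n ⊗ a n) ⊗ σ (c s) ≋ (c s ⊗ a s) ⊗ σ (c n)
      equivalent n n<s = by-residues (λ r r<p → ≋-trans (Λ-⊗-σ r r<p (c n ⊗ a n) (c s))
        (≋-trans (proportional r r<p n n<s) (≋-sym (Λ-⊗-σ r r<p (c s ⊗ a s) (c n)))))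

      earlier-zero : ∀ {d} → d < N → HasDegree (c s) d → ∀ n → n < s → c n ≋ 0ˢ
      earlier-zero d<N hs n n<s with degree? N (below′ n n<s)
      ... | inj₁ cn≋0 = cn≋0
      ... | inj₂ (e , e<N , hn) = ⊥-elim (inequivalent s<S (ℕₚ.<-trans n<s s<S) (ℕₚ.<⇒≢ n<s ∘ ≡.sym)
              (ℕₚ.<-≤-trans d<N N≤K) (ℕₚ.<-≤-trans e<N N≤K) hs hn (equivalent n n<s))

      last-zero : (∀ n → n < s → c n ≋ 0ˢ) → c s ≋ 0ˢ
      last-zero earlier = pointwise (⊗-cancel-unit {c s} {u s} (u₀≈1 s) (begin
        c s ⊗ u s                       ≈⟨ CommutativeRing.+-identityˡ seriesRing _ ⟨
        0ˢ ⊕ (c s ⊗ u s)                ≈⟨ ⊕-cong (∑-zero s (λ m m<s → ≋-trans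
                                             (⊗-cong (earlier m m<s) (≋-refl {u m})) (⊗-zeroˡ (u m)))) ≋-refl ⟨
        ∑ (suc s) (λ m → c m ⊗ u m)     ≈⟨ rel ⟩
        0ˢ                              ∎))

      conclude : _ → ∀ m → m < suc s → c m ≋ 0ˢ
      conclude (inj₁ cs≋0) m m≤s with m ℕ.≟ s
      ... | yes ≡.refl = cs≋0
      ... | no  m≢s    = independent s N (ℕₚ.<⇒≤ s<S) D<N
        (ℕₚ.≤-trans (ℕₚ.*-monoˡ-≤ (2 ℕ.^ s) N≤2N) 2N2^s≤K) c below′ (drop-last s cs≋0 rel)
        m (ℕₚ.≤∧≢⇒< (ℕₚ.≤-pred m≤s) m≢s)
      conclude (inj₂ (d , d<N , hs)) m m≤s with m ℕ.≟ s
      ... | yes ≡.refl = last-zero (earlier-zero d<N hs)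
      ... | no  m≢s    = earlier-zero d<N hs m (ℕₚ.≤∧≢⇒< (ℕₚ.≤-pred m≤s) m≢s)

-- Binomials, finite differences and power sums in characteristic p.

nCk*k![n∸k]!≡n! : ∀ {n k} → k ≤ n → (n C k) ℕ.* (k ! ℕ.* (n ∸ k) !) ≡ n !
nCk*k![n∸k]!≡n! {n} {k} k≤n = ≡.trans
  (≡.cong (ℕ._* (k ! ℕ.* (n ∸ k) !)) (nCk≡n!/k![n-k]! k≤n)) (m/n*n≡m (k![n∸k]!∣n! k≤n))
  where
  instance
    k![n∸k]!≢0 : NonZero (k ! ℕ.* (n ∸ k) !)
    k![n∸k]!≢0 = k ℕₚ.!* (n ∸ k) !≢0

nC0≡1 : ∀ n → n C 0 ≡ 1
nC0≡1 n = ℕₚ.*-cancelʳ-≡ (n C 0) 1 (n !) {{n ℕₚ.!≢0}} (≡.trans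
  (≡.cong ((n C 0) ℕ.*_) (≡.sym (ℕₚ.*-identityˡ (n !))))
  (≡.trans (nCk*k![n∸k]!≡n! {n} z≤n) (≡.sym (ℕₚ.*-identityˡ (n !)))))

module RingExtras (R : CommutativeRing 0ℓ 0ℓ) where
  open CommutativeRing R
  open SetoidReasoning setoid
  open Mult semiring using (×-homo-+; ×1-homo-*) renaming (_×_ to _·_)
  open Exp commutativeSemiring public using (_^_; ^-congˡ; ^-homo-*; ^-assocʳ; ^-distrib-*)
  module Solver = SemiringSolver commutativeSemiring

  ι : ℕ → Carrier
  ι n = n · 1#

  ι-+ : ∀ m n → ι (m ℕ.+ n) ≈ ι m + ι n
  ι-+ = ×-homo-+ 1#

  ι-* : ∀ m n → ι (m ℕ.* n) ≈ ι m * ι n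
  ι-* = ×1-homo-*

  ι-1 : ι 1 ≈ 1#
  ι-1 = +-identityʳ 1#

  ι-cong : ∀ {m n} → m ≡ n → ι m ≈ ι n
  ι-cong e = reflexive (≡.cong ι e)

  ι-^ : ∀ m k → ι (m ℕ.^ k) ≈ ι m ^ k
  ι-^ m zero    = ι-1
  ι-^ m (suc k) = trans (ι-* m (m ℕ.^ k)) (*-congˡ (ι-^ m k))

record Characteristic (R : CommutativeRing 0ℓ 0ℓ) (p : ℕ) : Set where
  open CommutativeRing R
  open RingExtras R using (ι)
  field
    ι-p : ι p ≈ 0#
    ι≉0 : ∀ {k} → 0 < k → k < p → ¬ (ι k ≈ 0#)

module DomainExtras (R : CommutativeRing 0ℓ 0ℓ) (isDomain : DecidableDomain R) where
  open CommutativeRing R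
  open DecidableDomain isDomain
  open RingExtras R
  open RingProperties ring using (x∙y⁻¹≈ε⇒x≈y; x[y-z]≈xy-xz)

  *-≉0 : ∀ {a b} → ¬ (a ≈ 0#) → ¬ (b ≈ 0#) → ¬ (a * b ≈ 0#)
  *-≉0 a≉0 b≉0 ab≈0 with noZeroDivisors ab≈0
  ... | inj₁ a≈0 = a≉0 a≈0
  ... | inj₂ b≈0 = b≉0 b≈0

  ^-≉0 : ∀ {a} k → ¬ (a ≈ 0#) → ¬ (a ^ k ≈ 0#)
  ^-≉0 zero    a≉0 = 1≉0
  ^-≉0 (suc k) a≉0 = *-≉0 a≉0 (^-≉0 k a≉0)

  *-zeroʳ⁻¹ : ∀ {a x} → ¬ (a ≈ 0#) → a * x ≈ 0# → x ≈ 0#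
  *-zeroʳ⁻¹ a≉0 ax≈0 with noZeroDivisors ax≈0
  ... | inj₁ a≈0 = ⊥-elim (a≉0 a≈0)
  ... | inj₂ x≈0 = x≈0

  *-cancelˡ : ∀ {a x y} → ¬ (a ≈ 0#) → a * x ≈ a * y → x ≈ y
  *-cancelˡ {a} {x} {y} a≉0 ax≈ay = x∙y⁻¹≈ε⇒x≈y x y (*-zeroʳ⁻¹ a≉0
    (trans (x[y-z]≈xy-xz a x y) (trans (+-congʳ ax≈ay) (-‿inverseʳ (a * y)))))

module FiniteDifferences (R : CommutativeRing 0ℓ 0ℓ) where
  open CommutativeRing R
  open Sums R
  open RingExtras R
  open RingProperties ring using (-0#≈0#; xyx⁻¹≈y; //-rightDividesˡ; x[y-z]≈xy-xz)
  open SetoidReasoning setoid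

  Δ : (ℕ → Carrier) → ℕ → Carrier
  Δ f n = f (suc n) - f n

  Δ^ : ℕ → (ℕ → Carrier) → ℕ → Carrier
  Δ^ zero    f = f
  Δ^ (suc k) f = Δ^ k (Δ f)

  Δ-step : ∀ f n → f (suc n) ≈ f n + Δ f n
  Δ-step f n = sym (trans (+-comm (f n) (Δ f n)) (//-rightDividesˡ (f n) (f (suc n))))

  Δ-unique : ∀ f (g : ℕ → Carrier) n → f (suc n) ≈ f n + g n → Δ f n ≈ g n
  Δ-unique f g n e = trans (+-congʳ e) (xyx⁻¹≈y (f n) (g n))

  -- Stands for "polynomial function of degree below `d`". Differences replace coefficients:
  -- products with linear factors, zeros at consecutive points and sums over a period can all be
  -- handled through them without any division.
  PolyBelow : ℕ → (ℕ → Carrier) → Set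
  PolyBelow d f = ∀ n → Δ^ d f n ≈ 0#

  Δ^-cong : ∀ d {f g} → (∀ n → f n ≈ g n) → ∀ n → Δ^ d f n ≈ Δ^ d g n
  Δ^-cong zero    e = e
  Δ^-cong (suc d) {f} {g} e = Δ^-cong d {Δ f} {Δ g} (λ n → +-cong (e (suc n)) (-‿cong (e n)))

  Δ^-scale : ∀ k c f n → Δ^ k (λ m → c * f m) n ≈ c * Δ^ k f n
  Δ^-scale zero    c f n = refl
  Δ^-scale (suc k) c f n = trans (Δ^-cong k (λ m → sym (x[y-z]≈xy-xz c (f (suc m)) (f m))) n)
    (Δ^-scale k c (Δ f) n)

  poly-cong : ∀ d {f g} → (∀ n → f n ≈ g n) → PolyBelow d f → PolyBelow d g
  poly-cong d {f} {g} e b n = trans (sym (Δ^-cong d {f} {g} e n)) (b n)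

  poly-step : ∀ d {f g} → (∀ n → f (suc n) ≈ f n + g n) → PolyBelow d g → PolyBelow (suc d) f
  poly-step d {f} {g} e = poly-cong d {g} {Δ f} (λ n → sym (Δ-unique f g n (e n)))

  poly-suc : ∀ d {f} → PolyBelow d f → PolyBelow (suc d) f
  poly-suc zero        b = λ n → trans (+-cong (b (suc n)) (trans (-‿cong (b n)) -0#≈0#)) (+-identityˡ 0#)
  poly-suc (suc d) {f} b = poly-suc d {Δ f} b

  poly-mono : ∀ {d e f} → d ≤ e → PolyBelow d f → PolyBelow e f
  poly-mono {zero}  {zero}      _         b = b
  poly-mono {zero}  {suc e} {f} _         b = poly-suc e {f} (poly-mono {e = e} {f} z≤n b)
  poly-mono {suc d} {suc e} {f} (s≤s d≤e) b = poly-mono {f = Δ f} d≤e b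

  poly-+ : ∀ d {f g} → PolyBelow d f → PolyBelow d g → PolyBelow d (λ n → f n + g n)
  poly-+ zero    b c = λ n → trans (+-cong (b n) (c n)) (+-identityˡ 0#)
  poly-+ (suc d) {f} {g} b c = poly-step d
    (λ n → trans (+-cong (Δ-step f n) (Δ-step g n)) (interchange (f n) (Δ f n) (g n) (Δ g n)))
    (poly-+ d {Δ f} {Δ g} b c)
    where
    open CommutativeSemigroupProperties (CommutativeMonoid.commutativeSemigroup +-commutativeMonoid)
      using (interchange)

  poly-scale : ∀ d c {f} → PolyBelow d f → PolyBelow d (λ n → c * f n)
  poly-scale zero    c b = λ n → trans (*-congˡ (b n)) (zeroʳ c)
  poly-scale (suc d) c {f} b = poly-step d
    (λ n → trans (*-congˡ (Δ-step f n)) (distribˡ c (f n) (Δ f n))) (poly-scale d c {Δ f} b)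

  poly-shift : ∀ d {f} → PolyBelow d f → PolyBelow d (f ∘ suc)
  poly-shift zero    b = b ∘ suc
  poly-shift (suc d) {f} b = poly-shift d {Δ f} b

  poly-const : ∀ c → PolyBelow 1 (λ _ → c)
  poly-const c n = -‿inverseʳ c

  -- The product rule `Δ (n f) = f (n + 1) + n Δ f`, in which the shifted `f` has the same degree as
  -- `f`.
  poly-ι* : ∀ d {f} → PolyBelow d f → PolyBelow (suc d) (λ n → ι n * f n)
  poly-ι* zero {f} b = poly-suc 0 {λ n → ι n * f n} (λ n → trans (*-congˡ (b n)) (zeroʳ (ι n)))
  poly-ι* (suc d) {f} b = poly-step (suc d) step
    (poly-+ (suc d) {f ∘ suc} {λ n → ι n * Δ f n} (poly-shift (suc d) {f} b) (poly-ι* d {Δ f} b))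
    where
    step : ∀ n → ι (suc n) * f (suc n) ≈ ι n * f n + (f (suc n) + ι n * Δ f n)
    step n = trans (*-congˡ (Δ-step f n)) (trans
      (solve 3 (λ i a b → (con 1 :+ i) :* (a :+ b) := i :* a :+ ((a :+ b) :+ i :* b)) refl (ι n) (f n) (Δ f n))
      (+-congˡ (+-congʳ (sym (Δ-step f n)))))
      where open Solver

  poly-linear : ∀ d {f} a b → PolyBelow d f → PolyBelow (suc d) (λ n → ι (b ℕ.* n ℕ.+ a) * f n)
  poly-linear d {f} a b h = poly-cong (suc d) {λ n → ι b * (ι n * f n) + ι a * f n}
    (λ n → sym (trans (*-congʳ (trans (ι-+ (b ℕ.* n) a) (+-congʳ (ι-* b n))))
      (trans (distribʳ (f n) (ι b * ι n) (ι a)) (+-congʳ (*-assoc (ι b) (ι n) (f n))))))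
    (poly-+ (suc d) {λ n → ι b * (ι n * f n)} {λ n → ι a * f n}
      (poly-scale (suc d) (ι b) {λ n → ι n * f n} (poly-ι* d {f} h))
      (poly-suc d {λ n → ι a * f n} (poly-scale d (ι a) {f} h)))

  -- The zeros are consecutive, so `Δ f` inherits all but one of them. This makes the count of roots
  -- valid over any commutative ring.
  poly-zero : ∀ d {f} → PolyBelow d f → (∀ n → n < d → f n ≈ 0#) → ∀ n → f n ≈ 0#
  poly-zero zero    b z = b
  poly-zero (suc d) {f} b z = go
    where
    Δf≈0 : ∀ n → Δ f n ≈ 0#
    Δf≈0 = poly-zero d {Δ f} b (λ n n<d → trans (+-cong (z (suc n) (s≤s n<d))
      (trans (-‿cong (z n (ℕₚ.m<n⇒m<1+n n<d))) -0#≈0#)) (+-identityˡ 0#))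
    go : ∀ n → f n ≈ 0#
    go zero    = z 0 (s≤s z≤n)
    go (suc n) = trans (Δ-step f n) (trans (+-cong (go n) (Δf≈0 n)) (+-identityˡ 0#))

  newton : ∀ n f → f n ≈ ∑ (suc n) (λ k → ι (n C k) * Δ^ k f 0)
  newton zero    f = sym (trans (+-identityˡ _) (trans (*-congʳ ι-1) (*-identityˡ _)))
  newton (suc n) f = begin
    f (suc n)
      ≈⟨ Δ-step f n ⟩
    f n + Δ f n
      ≈⟨ +-cong (newton n f) (newton n (Δ f)) ⟩
    ∑ (suc n) (λ k → ι (n C k) * Δ^ k f 0) + ∑ (suc n) (λ k → ι (n C k) * Δ^ (suc k) f 0)
      ≈⟨ +-congʳ extend ⟩
    (ι (n C 0) * f 0 + ∑ (suc n) (λ k → ι (n C suc k) * Δ^ (suc k) f 0))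
      + ∑ (suc n) (λ k → ι (n C k) * Δ^ (suc k) f 0)
      ≈⟨ trans (+-assoc _ _ _) (+-congˡ (trans (+-comm _ _) (sym (∑-+ (suc n) _ _)))) ⟩
    ι (n C 0) * f 0 + ∑ (suc n) (λ k → ι (n C k) * Δ^ (suc k) f 0 + ι (n C suc k) * Δ^ (suc k) f 0)
      ≈⟨ +-cong (*-congʳ (ι-cong (≡.trans (nC0≡1 n) (≡.sym (nC0≡1 (suc n))))))
           (∑-cong (suc n) (λ k _ → trans (sym (distribʳ _ _ _)) (*-congʳ
             (trans (sym (ι-+ (n C k) (n C suc k))) (ι-cong (nCk+nC[k+1]≡[n+1]C[k+1] n k)))))) ⟩
    ι (suc n C 0) * f 0 + ∑ (suc n) (λ k → ι (suc n C suc k) * Δ^ (suc k) f 0)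
      ≈⟨ ∑-head (suc n) _ ⟨
    ∑ (suc (suc n)) (λ k → ι (suc n C k) * Δ^ k f 0) ∎
    where
    extend : ∑ (suc n) (λ k → ι (n C k) * Δ^ k f 0)
           ≈ ι (n C 0) * f 0 + ∑ (suc n) (λ k → ι (n C suc k) * Δ^ (suc k) f 0)
    extend = trans (sym (trans (+-congˡ (trans (*-congʳ (ι-cong (k>n⇒nCk≡0 (ℕₚ.n<1+n n)))) (zeroˡ _)))
      (+-identityʳ _))) (∑-head (suc n) (λ k → ι (n C k) * Δ^ k f 0))

module PrimeCharacteristic (R : CommutativeRing 0ℓ 0ℓ) (isDomain : DecidableDomain R)
  (p : ℕ) .{{_ : NonZero p}} (isChar : Characteristic R p) where
  open CommutativeRing R
  open DecidableDomain isDomain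
  open Characteristic isChar
  open Sums R
  open RingExtras R
  open DomainExtras R isDomain
  open FiniteDifferences R
  open RingProperties ring using (xyx⁻¹≈y; [y-z]x≈yx-zx)
  open SetoidReasoning setoid

  ι[k!]≉0 : ∀ k → k < p → ¬ (ι (k !) ≈ 0#)
  ι[k!]≉0 zero    k<p e = 1≉0 (trans (sym ι-1) e)
  ι[k!]≉0 (suc k) k<p e = *-≉0 (ι≉0 (s≤s z≤n) k<p) (ι[k!]≉0 k (ℕₚ.<-trans (ℕₚ.n<1+n k) k<p))
    (trans (sym (ι-* (suc k) (k !))) e)

  ι-multiple : ∀ k → ι (k ℕ.* p) ≈ 0#
  ι-multiple k = trans (ι-* k p) (trans (*-congˡ ι-p) (zeroʳ (ι k)))

  ι[p!]≈0 : ι (p !) ≈ 0#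
  ι[p!]≈0 = trans (ι-cong (≡.trans (≡.sym (≡.cong _! (ℕₚ.suc-pred p))) (≡.trans
      (ℕₚ.*-comm (suc (ℕ.pred p)) (ℕ.pred p !)) (≡.cong (ℕ.pred p ! ℕ.*_) (ℕₚ.suc-pred p)))))
    (ι-multiple (ℕ.pred p !))

  ι[pCk]≈0 : ∀ k → k ≢ 0 → k < p → ι (p C k) ≈ 0#
  ι[pCk]≈0 k k≢0 k<p = *-zeroʳ⁻¹
    (*-≉0 (ι[k!]≉0 k k<p) (ι[k!]≉0 (p ∸ k) (ℕₚ.∸-monoʳ-< (ℕₚ.n≢0⇒n>0 k≢0) (ℕₚ.<⇒≤ k<p))))
    (begin
      (ι (k !) * ι ((p ∸ k) !)) * ι (p C k)     ≈⟨ trans (*-comm _ _) (*-congˡ (sym (ι-* (k !) ((p ∸ k) !)))) ⟩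
      ι (p C k) * ι (k ! ℕ.* (p ∸ k) !)         ≈⟨ ι-* (p C k) _ ⟨
      ι ((p C k) ℕ.* (k ! ℕ.* (p ∸ k) !))       ≈⟨ ι-cong (nCk*k![n∸k]!≡n! (ℕₚ.<⇒≤ k<p)) ⟩
      ι (p !)                                   ≈⟨ ι[p!]≈0 ⟩
      0#                                        ∎)

  -- The operator identity `(1 + Δ)^p = 1 + Δ^p`. Both the vanishing of sums over a period and
  -- Fermat's theorem are instances of it.
  shift-p : ∀ f → f p ≈ f 0 + Δ^ p f 0
  shift-p f = begin
    f p
      ≈⟨ newton p f ⟩
    ∑ p (λ k → ι (p C k) * Δ^ k f 0) + ι (p C p) * Δ^ p f 0
      ≈⟨ +-cong (∑-single p 0 (ℕₚ.n≢0⇒n>0 (ℕ.≢-nonZero⁻¹ p)) (λ k k<p k≢0 → trans (*-congʳ (ι[pCk]≈0 k k≢0 k<p)) (zeroˡ _)))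
           (unit (nCn≡1 p) (Δ^ p f 0)) ⟩
    ι (p C 0) * f 0 + Δ^ p f 0
      ≈⟨ +-congʳ (unit (nC0≡1 p) (f 0)) ⟩
    f 0 + Δ^ p f 0 ∎
    where
    unit : ∀ {m} → m ≡ 1 → ∀ x → ι m * x ≈ x
    unit ≡.refl x = trans (*-congʳ ι-1) (*-identityˡ x)

  -- `shift-p` applied to the partial sums, whose degree is one higher. The bound `d < p` admits
  -- degrees up to `p - 2`.
  ∑-poly : ∀ {d} f → d < p → PolyBelow d f → ∑ p f ≈ 0#
  ∑-poly {d} f d<p b = begin
    ∑ p f                        ≈⟨ shift-p (λ n → ∑ n f) ⟩
    0# + Δ^ p (λ n → ∑ n f) 0    ≈⟨ +-identityˡ _ ⟩
    Δ^ p (λ n → ∑ n f) 0         ≈⟨ poly-mono {suc d} {p} {λ n → ∑ n f} d<p (poly-step d {λ n → ∑ n f} {f} (λ _ → refl) b) 0 ⟩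
    0#                           ∎

  ∑-periodic : ∀ f s → (∀ n → f (n ℕ.+ p) ≈ f n) → ∑ p (λ n → f (n ℕ.+ s)) ≈ ∑ p f
  ∑-periodic f zero    periodic = ∑-cong p (λ n _ → reflexive (≡.cong f (ℕₚ.+-identityʳ n)))
  ∑-periodic f (suc s) periodic = begin
    ∑ p (λ n → f (n ℕ.+ suc s))                          ≈⟨ ∑-cong p (λ n _ → reflexive (≡.cong f (ℕₚ.+-suc n s))) ⟩
    ∑ p (g ∘ suc)                                        ≈⟨ rotate ⟩
    ∑ p g                                                ≈⟨ ∑-periodic f s periodic ⟩
    ∑ p f                                                ∎
    where
    g : ℕ → Carrier
    g n = f (n ℕ.+ s)
    gp≈g0 : g p ≈ g 0
    gp≈g0 = trans (reflexive (≡.cong f (ℕₚ.+-comm p s))) (periodic s)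
    rotate : ∑ p (g ∘ suc) ≈ ∑ p g
    rotate = trans (sym (xyx⁻¹≈y (g 0) _)) (trans (+-congʳ (trans (sym (∑-head p g))
      (trans (+-congˡ gp≈g0) (+-comm _ _)))) (xyx⁻¹≈y (g 0) _))

  -- The function `n ↦ c ^ n` is an eigenvector of `Δ` with eigenvalue `c - 1`, so `shift-p` for it
  -- is the additivity of Frobenius.
  fermat-step : ∀ c → c ^ p ≈ 1# + (c - 1#) ^ p
  fermat-step c = trans (shift-p (c ^_)) (+-congˡ (trans (iterate p 0) (*-identityʳ _)))
    where
    Δ-power : ∀ n → Δ (c ^_) n ≈ (c - 1#) * c ^ n
    Δ-power n = sym (trans ([y-z]x≈yx-zx (c ^ n) c 1#) (+-congˡ (-‿cong (*-identityˡ (c ^ n)))))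
    iterate : ∀ k n → Δ^ k (c ^_) n ≈ (c - 1#) ^ k * c ^ n
    iterate zero    n = sym (*-identityˡ _)
    iterate (suc k) n = begin
      Δ^ k (Δ (c ^_)) n                       ≈⟨ Δ^-cong k Δ-power n ⟩
      Δ^ k (λ m → (c - 1#) * c ^ m) n         ≈⟨ Δ^-scale k (c - 1#) (c ^_) n ⟩
      (c - 1#) * Δ^ k (c ^_) n                ≈⟨ *-congˡ (iterate k n) ⟩
      (c - 1#) * ((c - 1#) ^ k * c ^ n)       ≈⟨ *-assoc _ _ _ ⟨
      (c - 1#) ^ suc k * c ^ n                ∎

  fermat : ∀ n → ι n ^ p ≈ ι n
  fermat zero    = trans (^-cong-suc) (zeroˡ _)
    where
    ^-cong-suc : 0# ^ p ≈ 0# * 0# ^ ℕ.pred p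
    ^-cong-suc = reflexive (≡.cong (0# ^_) (≡.sym (ℕₚ.suc-pred p)))
  fermat (suc n) = trans (fermat-step (ι (suc n))) (+-congˡ
    (trans (^-congˡ p (xyx⁻¹≈y 1# (ι n))) (fermat n)))

-- The two coefficient sequences and their Lucas congruences.

module Sequences (R : CommutativeRing 0ℓ 0ℓ) where
  open CommutativeRing R
  open Sums R
  open PowerSeriesRing R
  open RingExtras R

  -- The quotient `(4n)! / ((2n)! n!²)` is split into two binomials: this makes sense in every ring,
  -- and Lucas' theorem applies to each factor.
  seqA seqB : Series
  seqA n = ι ((4 ℕ.* n) C (2 ℕ.* n)) * ι ((2 ℕ.* n) C n)
  seqB n = ∑ (suc n) (λ k → ι (n C k) ^ 6)

module Lucas (R : CommutativeRing 0ℓ 0ℓ) (isDomain : DecidableDomain R)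
  (p : ℕ) .{{_ : NonZero p}} (isChar : Characteristic R p) where
  open CommutativeRing R
  open Sums R
  open PowerSeriesRing R
  open Polynomials R
  open Frobenius R p
  open RingExtras R
  open PrimeCharacteristic R isDomain p isChar
  open Sequences R
  open SetoidReasoning setoid

  ι0 : ∀ {m} → m ≡ 0 → ι m ≈ 0#
  ι0 = ι-cong

  ι1 : ∀ {m} → m ≡ 1 → ι m ≈ 1#
  ι1 e = trans (ι-cong e) ι-1

  binomial-zero : ∀ {n k} → n < k → ι (n C k) ≈ 0#
  binomial-zero n<k = ι0 (k>n⇒nCk≡0 n<k)

  -- The coefficients of `(1 + z)^n`. Lucas' theorem then comes from `(1 + z)^p = 1 + z^p`, which is
  -- `row-p`.
  row : ℕ → Series
  row n k = ι (n C k)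

  row-0 : row 0 ≋ 1ˢ
  row-0 .at zero    = ι-1
  row-0 .at (suc k) = binomial-zero {0} {suc k} (s≤s z≤n)

  tail-row-1 : tail (row 1) ≋ 1ˢ
  tail-row-1 .at zero    = ι-1
  tail-row-1 .at (suc k) = binomial-zero {1} {suc (suc k)} (s≤s (s≤s z≤n))

  row-suc : ∀ n → row (suc n) ≋ row 1 ⊗ row n
  row-suc n .at zero = begin
    ι (suc n C 0)                  ≈⟨ ι1 (nC0≡1 (suc n)) ⟩
    1#                             ≈⟨ *-identityˡ 1# ⟨
    1# * 1#                        ≈⟨ *-cong ι-1 (ι1 (nC0≡1 n)) ⟨
    ι (1 C 0) * ι (n C 0)          ≈⟨ +-identityˡ _ ⟨
    (row 1 ⊗ row n) 0              ∎
  row-suc n .at (suc k) = begin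
    ι (suc n C suc k)                                      ≈⟨ ι-cong (nCk+nC[k+1]≡[n+1]C[k+1] n k) ⟨
    ι (n C k ℕ.+ n C suc k)                                ≈⟨ ι-+ (n C k) (n C suc k) ⟩
    ι (n C k) + ι (n C suc k)                              ≈⟨ +-comm _ _ ⟩
    ι (n C suc k) + ι (n C k)                              ≈⟨ +-cong (trans (*-congʳ ι-1) (*-identityˡ _))
                                                                (trans (⊗-cong tail-row-1 (≋-refl {row n}) .at k) (⊗-identityˡ (row n) .at k)) ⟨
    row 1 0 * row n (suc k) + (tail (row 1) ⊗ row n) k     ≈⟨ ⊗-tail (row 1) (row n) k ⟨
    (row 1 ⊗ row n) (suc k)                                ∎

  row-+ : ∀ m n → row (m ℕ.+ n) ≋ row m ⊗ row n
  row-+ zero    n = ≋-sym (≋-trans (⊗-cong row-0 (≋-refl {row n})) (⊗-identityˡ (row n)))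
  row-+ (suc m) n = ≋-trans (row-suc (m ℕ.+ n)) (≋-trans (⊗-cong (≋-refl {row 1}) (row-+ m n))
    (≋-trans (≋-sym (⊗-assoc (row 1) (row m) (row n))) (⊗-cong (≋-sym (row-suc m)) (≋-refl {row n}))))

  row-p : row p ≋ σ (row 1)
  row-p = by-residues step
    where
    step : ∀ r → r < p → Λ r (row p) ≋ Λ r (σ (row 1))
    step zero r<p = ≋-trans (pointwise multiple) (≋-sym (Λ-σ-zero (row 1)))
      where
      multiple : ∀ q → row p (q ℕ.* p) ≈ row 1 q
      multiple zero          = trans (ι1 (nC0≡1 p)) (sym (ι1 {1 C 0} ≡.refl))
      multiple (suc zero)    = trans (ι1 (≡.trans (≡.cong (p C_) (ℕₚ.*-identityˡ p)) (nCn≡1 p))) (sym (ι1 {1 C 1} ≡.refl))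
      multiple (suc (suc q)) = trans (binomial-zero (ℕₚ.≤-trans (ℕₚ.m<n+m p {p} 0<p) (ℕₚ.+-monoʳ-≤ p (ℕₚ.m≤m+n p _))))
        (sym (binomial-zero {1} {suc (suc q)} (s≤s (s≤s z≤n))))
    step r@(suc _) r<p = pointwise λ q → trans (other q) (sym (σ-nonmultiple (row 1) r q (λ ()) r<p))
      where
      other : ∀ q → row p (r ℕ.+ q ℕ.* p) ≈ 0#
      other zero    = trans (reflexive (≡.cong (row p) (ℕₚ.+-identityʳ r))) (ι[pCk]≈0 r (λ ()) r<p)
      other (suc q) = binomial-zero (ℕₚ.≤-trans (ℕₚ.m<n+m p {r} (s≤s z≤n)) (ℕₚ.+-monoʳ-≤ r (ℕₚ.m≤m+n p _)))

  row-*p : ∀ q → row (q ℕ.* p) ≋ σ (row q)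
  row-*p zero    = ≋-trans row-0 (≋-trans (≋-sym σ-1) (σ-cong (≋-sym row-0)))
  row-*p (suc q) = ≋-trans (row-+ p (q ℕ.* p)) (≋-trans (⊗-cong row-p (row-*p q))
    (≋-trans (≋-sym (σ-⊗ (row 1) (row q))) (σ-cong (≋-sym (row-suc q)))))

  -- Here r may exceed p, as long as it is too small for carries to contribute.
  lucas : ∀ r q s j → s < p → r < s ℕ.+ p → ι ((r ℕ.+ q ℕ.* p) C (s ℕ.+ j ℕ.* p)) ≈ ι (r C s) * ι (q C j)
  lucas r q s j s<p r<s+p = begin
    row (r ℕ.+ q ℕ.* p) (s ℕ.+ j ℕ.* p)       ≈⟨ at (row-+ r (q ℕ.* p)) (s ℕ.+ j ℕ.* p) ⟩
    (row r ⊗ row (q ℕ.* p)) (s ℕ.+ j ℕ.* p)   ≈⟨ at (⊗-cong (≋-refl {row r}) (row-*p q)) (s ℕ.+ j ℕ.* p) ⟩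
    Λ s (row r ⊗ σ (row q)) j                 ≈⟨ at (Λ-⊗-σ s s<p (row r) (row q)) j ⟩
    (Λ s (row r) ⊗ row q) j                   ≈⟨ ∑-single (suc j) 0 (s≤s z≤n) vanish ⟩
    ι (r C (s ℕ.+ 0)) * ι (q C j)             ≈⟨ *-congʳ (ι-cong (≡.cong (r C_) (ℕₚ.+-identityʳ s))) ⟩
    ι (r C s) * ι (q C j)                     ∎
    where
    vanish : ∀ i → i < suc j → i ≢ 0 → Λ s (row r) i * row q (j ∸ i) ≈ 0#
    vanish zero    _ i≢0 = ⊥-elim (i≢0 ≡.refl)
    vanish (suc i) _ _   = product-zero (inj₁ (binomial-zero (ℕₚ.<-≤-trans r<s+p (ℕₚ.+-monoʳ-≤ s (ℕₚ.m≤m+n p _)))))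

  IsLucas : Series → Set
  IsLucas f = ∀ r q → r < p → f (r ℕ.+ q ℕ.* p) ≈ f r * f q

  2r<r+p : ∀ {r} → r < p → 2 ℕ.* r < r ℕ.+ p
  2r<r+p {r} r<p = ℕₚ.+-monoʳ-< r (≡.subst (_< p) (≡.sym (ℕₚ.+-identityʳ r)) r<p)

  -- Adding `r` to itself produces a carry: `2r = s + p` with `s < r`, so the lowest digit
  -- contributes `C(s, r) = 0`.
  central-zero : ∀ {r} → r < p → p ≤ 2 ℕ.* r → ι ((2 ℕ.* r) C r) ≈ 0#
  central-zero {r} r<p p≤2r = begin
    ι ((2 ℕ.* r) C r)                      ≈⟨ ι-cong (≡.cong₂ _C_ 2r≡s+p (≡.sym (ℕₚ.+-identityʳ r))) ⟩
    ι ((s ℕ.+ 1 ℕ.* p) C (r ℕ.+ 0 ℕ.* p))  ≈⟨ lucas s 1 r 0 r<p (ℕₚ.<-≤-trans s<r (ℕₚ.m≤m+n r p)) ⟩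
    ι (s C r) * ι (1 C 0)                  ≈⟨ product-zero (inj₁ (binomial-zero s<r)) ⟩
    0#                                     ∎
    where
    s : ℕ
    s = 2 ℕ.* r ∸ p
    2r≡s+p : 2 ℕ.* r ≡ s ℕ.+ 1 ℕ.* p
    2r≡s+p = ≡.trans (≡.sym (ℕₚ.m∸n+n≡m p≤2r)) (≡.cong (s ℕ.+_) (≡.sym (ℕₚ.*-identityˡ p)))
    s<r : s < r
    s<r = ℕₚ.+-cancelʳ-< p s r (≡.subst (_< r ℕ.+ p) (≡.sym (ℕₚ.m∸n+n≡m p≤2r)) (2r<r+p r<p))

  -- If `2r < p`, then `2r` is the lowest digit of the lower entry of `C(4n, 2n)`; the upper `4r`
  -- may exceed `p`, which `lucas` tolerates since `4r < 2r + p`. If `2r ≥ p`, the carry in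
  -- `C(2r, r)` annihilates both sides.
  seqA-lucas : IsLucas seqA
  seqA-lucas r q r<p with 2 ℕ.* r ℕ.<? p
  ... | yes 2r<p = begin
    seqA (r ℕ.+ q ℕ.* p)
      ≈⟨ *-cong
           (trans (ι-cong (≡.cong₂ _C_ (distribute 4) (distribute 2)))
             (lucas (4 ℕ.* r) (4 ℕ.* q) (2 ℕ.* r) (2 ℕ.* q) 2r<p
               (≡.subst (_< 2 ℕ.* r ℕ.+ p) (≡.sym (ℕₚ.*-assoc 2 2 r)) (2r<r+p 2r<p))))
           (trans (ι-cong (≡.cong (_C (r ℕ.+ q ℕ.* p)) (distribute 2))) (lucas (2 ℕ.* r) (2 ℕ.* q) r q r<p (2r<r+p r<p))) ⟩
    (ι ((4 ℕ.* r) C (2 ℕ.* r)) * ι ((4 ℕ.* q) C (2 ℕ.* q))) * (ι ((2 ℕ.* r) C r) * ι ((2 ℕ.* q) C q))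
      ≈⟨ interchange _ _ _ _ ⟩
    seqA r * seqA q ∎
    where
    open CommutativeSemigroupProperties (CommutativeMonoid.commutativeSemigroup *-commutativeMonoid) using (interchange)
    distribute : ∀ c → c ℕ.* (r ℕ.+ q ℕ.* p) ≡ c ℕ.* r ℕ.+ (c ℕ.* q) ℕ.* p
    distribute c = ≡.trans (ℕₚ.*-distribˡ-+ c r (q ℕ.* p)) (≡.cong (c ℕ.* r ℕ.+_) (≡.sym (ℕₚ.*-assoc c q p)))
  ... | no 2r≮p = begin
    seqA (r ℕ.+ q ℕ.* p)
      ≈⟨ product-zero (inj₂ (trans (ι-cong (≡.cong (_C (r ℕ.+ q ℕ.* p)) distribute))
           (trans (lucas (2 ℕ.* r) (2 ℕ.* q) r q r<p (2r<r+p r<p)) (product-zero (inj₁ zeroʳ′))))) ⟩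
    0#
      ≈⟨ product-zero (inj₁ (product-zero (inj₂ zeroʳ′))) ⟨
    seqA r * seqA q ∎
    where
    zeroʳ′ : ι ((2 ℕ.* r) C r) ≈ 0#
    zeroʳ′ = central-zero r<p (ℕₚ.≮⇒≥ 2r≮p)
    distribute : 2 ℕ.* (r ℕ.+ q ℕ.* p) ≡ 2 ℕ.* r ℕ.+ (2 ℕ.* q) ℕ.* p
    distribute = ≡.trans (ℕₚ.*-distribˡ-+ 2 r (q ℕ.* p)) (≡.cong (2 ℕ.* r ℕ.+_) (≡.sym (ℕₚ.*-assoc 2 q p)))

  ∑-extend : ∀ {m n f} → m ≤ n → (∀ k → m ≤ k → f k ≈ 0#) → ∑ m f ≈ ∑ n f
  ∑-extend {m} {n} {f} m≤n z = sym (begin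
    ∑ n f                                        ≡⟨ ≡.cong (λ l → ∑ l f) (ℕₚ.m+[n∸m]≡n m≤n) ⟨
    ∑ (m ℕ.+ (n ∸ m)) f                          ≈⟨ ∑-append m (n ∸ m) f ⟩
    ∑ m f + ∑ (n ∸ m) (λ k → f (m ℕ.+ k))        ≈⟨ +-congˡ (∑-zero (n ∸ m) (λ k _ → z (m ℕ.+ k) (ℕₚ.m≤m+n m k))) ⟩
    ∑ m f + 0#                                   ≈⟨ +-identityʳ _ ⟩
    ∑ m f                                        ∎)

  seqB-extend : ∀ {n N} → n < N → seqB n ≈ ∑ N (λ k → ι (n C k) ^ 6)
  seqB-extend {n} {N} n<N = ∑-extend n<N (λ k n<k → trans (^-congˡ 6 (binomial-zero n<k)) (zeroˡ _))

  seqB-lucas : IsLucas seqB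
  seqB-lucas r q r<p = begin
    seqB n
      -- Extending the range to whole blocks adds only vanishing binomials and lets the two digits
      -- of `k` vary independently.
      ≈⟨ seqB-extend (ℕₚ.+-monoˡ-< (q ℕ.* p) r<p) ⟩
    ∑ (suc q ℕ.* p) (λ k → ι (n C k) ^ 6)
      ≈⟨ ∑-blocks p (suc q) _ ⟩
    ∑ (suc q) (λ j → ∑ p (λ s → ι (n C (s ℕ.+ j ℕ.* p)) ^ 6))
      ≈⟨ ∑-cong (suc q) (λ j _ → ∑-cong p (λ s s<p → trans
           (^-congˡ 6 (lucas r q s j s<p (ℕₚ.<-≤-trans r<p (ℕₚ.m≤n+m p s)))) (^-distrib-* (ι (r C s)) (ι (q C j)) 6))) ⟩
    ∑ (suc q) (λ j → ∑ p (λ s → ι (r C s) ^ 6 * ι (q C j) ^ 6))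
      ≈⟨ ∑-cong (suc q) (λ j _ → ∑-*ʳ p (ι (q C j) ^ 6) _) ⟩
    ∑ (suc q) (λ j → ∑ p (λ s → ι (r C s) ^ 6) * ι (q C j) ^ 6)
      ≈⟨ ∑-*ˡ (suc q) _ _ ⟩
    ∑ p (λ s → ι (r C s) ^ 6) * seqB q
      ≈⟨ *-congʳ (seqB-extend r<p) ⟨
    seqB r * seqB q ∎
    where
    n : ℕ
    n = r ℕ.+ q ℕ.* p

  seqA-0 : seqA 0 ≈ 1#
  seqA-0 = trans (*-cong (ι1 {0 C 0} ≡.refl) (ι1 {0 C 0} ≡.refl)) (*-identityˡ 1#)

  seqB-0 : seqB 0 ≈ 1#
  seqB-0 = trans (+-identityˡ _) (trans (^-congˡ 6 ι-1) (1^ 6))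
    where
    1^ : ∀ k → 1# ^ k ≈ 1#
    1^ zero    = refl
    1^ (suc k) = trans (*-identityˡ _) (1^ k)

  truncate : Series → Series
  truncate f n with n ℕ.<? p
  ... | yes _ = f n
  ... | no  _ = 0#

  truncate-< : ∀ f {n} → n < p → truncate f n ≈ f n
  truncate-< f {n} n<p with n ℕ.<? p
  ... | yes _   = refl
  ... | no  n≮p = ⊥-elim (n≮p n<p)

  truncate-below : ∀ f → Below p (truncate f)
  truncate-below f n p≤n with n ℕ.<? p
  ... | yes n<p = ⊥-elim (ℕₚ.≤⇒≯ p≤n n<p)
  ... | no  _   = refl

  -- `Λ r (truncate f)` is the constant `f r`, so by the projection formula each residue class of
  -- the claim is one Lucas congruence.
  lucas⇒frobenius : ∀ f → IsLucas f → f ≋ truncate f ⊗ σ f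
  lucas⇒frobenius f isLucas = by-residues λ r r<p →
    ≋-trans (pointwise λ n → sym (begin
      (Λ r (truncate f) ⊗ f) n
        ≈⟨ ∑-single (suc n) 0 (s≤s z≤n) (λ i _ i≢0 → product-zero (inj₁ (truncate-below f _
             (ℕₚ.≤-trans (ℕₚ.m≤n*m p i {{ℕ.≢-nonZero i≢0}}) (ℕₚ.m≤n+m (i ℕ.* p) r))))) ⟩
      truncate f (r ℕ.+ 0) * f n
        ≈⟨ *-congʳ (trans (reflexive (≡.cong (truncate f) (ℕₚ.+-identityʳ r))) (truncate-< f r<p)) ⟩
      f r * f n
        ≈⟨ isLucas r n r<p ⟨
      Λ r f n ∎))
    (≋-sym (Λ-⊗-σ r r<p (truncate f) f))

-- The degrees of the truncated series modulo p.

[1+k]*nC[1+k]≡[n∸k]*nCk : ∀ n k → suc k ℕ.* (n C suc k) ≡ (n ∸ k) ℕ.* (n C k)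
[1+k]*nC[1+k]≡[n∸k]*nCk n k with k ℕ.<? n
... | no k≮n = ≡.trans (≡.cong (suc k ℕ.*_) (k>n⇒nCk≡0 (s≤s n≤k)))
    (≡.trans (ℕₚ.*-zeroʳ (suc k)) (≡.cong (ℕ._* (n C k)) (≡.sym (ℕₚ.m≤n⇒m∸n≡0 n≤k))))
  where
  n≤k : n ≤ k
  n≤k = ℕₚ.≮⇒≥ k≮n
... | yes k<n = ℕₚ.*-cancelʳ-≡ _ _ d {{d≢0}} (begin
    suc k ℕ.* (n C suc k) ℕ.* d                       ≡⟨ regroup (suc k) (n C suc k) (k !) ((n ∸ suc k) !) ⟩
    (n C suc k) ℕ.* (suc k ! ℕ.* (n ∸ suc k) !)       ≡⟨ nCk*k![n∸k]!≡n! k<n ⟩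
    n !                                               ≡⟨ nCk*k![n∸k]!≡n! (ℕₚ.<⇒≤ k<n) ⟨
    (n C k) ℕ.* (k ! ℕ.* (n ∸ k) !)                   ≡⟨ ≡.cong (λ x → (n C k) ℕ.* (k ! ℕ.* x)) ([n-k]*[n-k-1]!≡[n-k]! k<n) ⟨
    (n C k) ℕ.* (k ! ℕ.* ((n ∸ k) ℕ.* (n ∸ suc k) !)) ≡⟨ regroup′ (n ∸ k) (n C k) (k !) ((n ∸ suc k) !) ⟩
    (n ∸ k) ℕ.* (n C k) ℕ.* d                         ∎)
  where
  open ≡.≡-Reasoning
  d : ℕ
  d = k ! ℕ.* (n ∸ suc k) !
  d≢0 : NonZero d
  d≢0 = k ℕₚ.!* (n ∸ suc k) !≢0
  regroup : ∀ a b c e → a ℕ.* b ℕ.* (c ℕ.* e) ≡ b ℕ.* ((a ℕ.* c) ℕ.* e)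
  regroup = solve-∀
  regroup′ : ∀ a b c e → b ℕ.* (c ℕ.* (a ℕ.* e)) ≡ a ℕ.* b ℕ.* (c ℕ.* e)
  regroup′ = solve-∀

-- The product `(k + 1)(k + 2)⋯(k + m)`, which starts one above `k`; as a function of `k` it is a
-- polynomial of degree `m`.
rising : ℕ → ℕ → ℕ
rising k zero    = 1
rising k (suc m) = rising k m ℕ.* (k ℕ.+ suc m)

rising-suc : ∀ k m → suc k ℕ.* rising (suc k) m ≡ rising k (suc m)
rising-suc k zero    = ≡.trans (ℕₚ.*-identityʳ (suc k)) (≡.trans (ℕₚ.+-comm 1 k) (≡.sym (ℕₚ.*-identityˡ (k ℕ.+ 1))))
rising-suc k (suc m) = begin
  suc k ℕ.* (rising (suc k) m ℕ.* (suc k ℕ.+ suc m))   ≡⟨ ℕₚ.*-assoc (suc k) (rising (suc k) m) _ ⟨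
  suc k ℕ.* rising (suc k) m ℕ.* (suc k ℕ.+ suc m)     ≡⟨ ≡.cong₂ ℕ._*_ (rising-suc k m) (≡.sym (ℕₚ.+-suc k (suc m))) ⟩
  rising k (suc m) ℕ.* (k ℕ.+ suc (suc m))             ∎
  where open ≡.≡-Reasoning

rising-0 : ∀ m → rising 0 m ≡ m !
rising-0 zero    = ≡.refl
rising-0 (suc m) = ≡.trans (ℕₚ.*-comm (rising 0 m) (suc m)) (≡.cong (suc m ℕ.*_) (rising-0 m))

module DegreeA (R : CommutativeRing 0ℓ 0ℓ) (isDomain : DecidableDomain R)
  (p : ℕ) .{{_ : NonZero p}} (isChar : Characteristic R p) where
  open CommutativeRing R
  open Polynomials R
  open RingExtras R
  open DomainExtras R isDomain
  open PrimeCharacteristic R isDomain p isChar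
  open Sequences R
  open Lucas R isDomain p isChar

  ι[nCk]≉0 : ∀ {n k} → n < p → k ≤ n → ¬ (ι (n C k) ≈ 0#)
  ι[nCk]≉0 {n} {k} n<p k≤n e = ι[k!]≉0 n n<p (trans (ι-cong (≡.sym (nCk*k![n∸k]!≡n! k≤n)))
    (trans (ι-* (n C k) _) (product-zero (inj₁ e))))

  seqA≉0 : ∀ {n} → 4 ℕ.* n < p → ¬ (seqA n ≈ 0#)
  seqA≉0 {n} 4n<p = *-≉0 (ι[nCk]≉0 4n<p 2n≤4n) (ι[nCk]≉0 (ℕₚ.≤-<-trans 2n≤4n 4n<p) (ℕₚ.m≤n*m n 2))
    where
    2n≤4n : 2 ℕ.* n ≤ 4 ℕ.* n
    2n≤4n = ℕₚ.*-monoˡ-≤ n {2} {4} (s≤s (s≤s z≤n))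

  seqA≈0 : ∀ {r} → r < p → p ≤ 4 ℕ.* r → seqA r ≈ 0#
  seqA≈0 {r} r<p p≤4r with 2 ℕ.* r ℕ.<? p
  ... | no  2r≮p = product-zero (inj₂ (central-zero r<p (ℕₚ.≮⇒≥ 2r≮p)))
  ... | yes 2r<p = product-zero (inj₁ (trans (ι-cong (≡.cong (_C (2 ℕ.* r)) 4r≡2[2r]))
                     (central-zero 2r<p (≡.subst (p ≤_) 4r≡2[2r] p≤4r))))
    where
    4r≡2[2r] : 4 ℕ.* r ≡ 2 ℕ.* (2 ℕ.* r)
    4r≡2[2r] = ℕₚ.*-assoc 2 2 r

  degree-A : ∀ e → e < p → 4 ℕ.* e < p → p ≤ 4 ℕ.* suc e → HasDegree (truncate seqA) e
  degree-A e e<p 4e<p p≤4[1+e] = (λ z → seqA≉0 {e} 4e<p (trans (sym (truncate-< seqA e<p)) z)) , below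
    where
    below : Below (suc e) (truncate seqA)
    below n e<n with n ℕ.<? p
    ... | no  _   = refl
    ... | yes n<p = seqA≈0 n<p (ℕₚ.≤-trans p≤4[1+e] (ℕₚ.*-monoʳ-≤ 4 e<n))

-- Modulo p, C(p-1-m, k) is ± rising k m / m!, so that seqB (p-1-m) is, up to a unit, the sum over
-- 𝔽ₚ of a polynomial of degree 6m; such a sum only sees the coefficients of xᵉ with p-1 ∣ e > 0.
module DegreeB (R : CommutativeRing 0ℓ 0ℓ) (isDomain : DecidableDomain R)
  (p : ℕ) .{{_ : NonZero p}} (isChar : Characteristic R p) where
  open CommutativeRing R
  open Characteristic isChar
  open Sums R
  open PowerSeriesRing R
  open Polynomials R
  open RingExtras R
  open DomainExtras R isDomain
  open FiniteDifferences R
  open PrimeCharacteristic R isDomain p isChar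
  open Sequences R
  open Lucas R isDomain p isChar
  open RingProperties ring using (+-inverseˡ-unique; -‿involutive; -‿distribˡ-*; -‿distribʳ-*)
  open SetoidReasoning setoid

  -- Squaring removes the sign `(-1)^k` from the reflection of `C(p-1-m, k)`. The exponent 6 is
  -- even, so working with squares loses nothing.
  opposite-squares : ∀ {a b} → a + b ≈ 0# → a ^ 2 ≈ b ^ 2
  opposite-squares {a} {b} e = trans (^-congˡ 2 (+-inverseˡ-unique a b e)) (begin
    (- b) * ((- b) * 1#)     ≈⟨ *-congˡ (*-identityʳ (- b)) ⟩
    (- b) * (- b)            ≈⟨ -‿distribˡ-* b (- b) ⟨
    - (b * (- b))            ≈⟨ -‿cong (-‿distribʳ-* b b) ⟨
    - (- (b * b))            ≈⟨ -‿involutive (b * b) ⟩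
    b * b                    ≈⟨ *-congˡ (*-identityʳ b) ⟨
    b ^ 2                    ∎)

  module _ {n m : ℕ} (n+1+m≡p : n ℕ.+ suc m ≡ p) where

    -- Modulo `p`, `n - k` is the negative of `k + m + 1`. For `k > n` the truncated subtraction
    -- spoils this, but there `C(n, k)` is zero.
    reflect : ∀ k → ((ι (n ∸ k) * ι (n C k)) * ι (m !)) ^ 2 ≈ (ι (k ℕ.+ suc m) * (ι (n C k) * ι (m !))) ^ 2
    reflect k with k ℕ.≤? n
    ... | no  k≰n = trans (^-congˡ 2 (product-zero (inj₁ (product-zero (inj₂ z)))))
                      (sym (^-congˡ 2 (product-zero (inj₂ (product-zero (inj₁ z))))))
      where
      z : ι (n C k) ≈ 0#
      z = binomial-zero (ℕₚ.≰⇒> k≰n)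
    ... | yes k≤n = trans (^-congˡ 2 (*-assoc _ _ _)) (trans (^-distrib-* (ι (n ∸ k)) _ 2)
        (trans (*-congʳ (opposite-squares sum≈0)) (sym (^-distrib-* (ι (k ℕ.+ suc m)) _ 2))))
      where
      sum≈0 : ι (n ∸ k) + ι (k ℕ.+ suc m) ≈ 0#
      sum≈0 = trans (sym (ι-+ (n ∸ k) (k ℕ.+ suc m))) (trans (ι-cong
        (≡.trans (≡.sym (ℕₚ.+-assoc (n ∸ k) k (suc m)))
          (≡.trans (≡.cong (ℕ._+ suc m) (ℕₚ.m∸n+n≡m k≤n)) n+1+m≡p))) ι-p)

    -- Both sides satisfy the recurrence `(k+1)² X(k+1) = (k+m+1)² X(k)`, and `k + 1` is invertible
    -- as long as it stays below `p`.
    binomial²-rising : ∀ k → k < p → (ι (n C k) * ι (m !)) ^ 2 ≈ ι (rising k m) ^ 2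
    binomial²-rising zero _ = ^-congˡ 2 (trans (*-congʳ (ι1 (nC0≡1 n)))
      (trans (*-identityˡ _) (ι-cong (≡.sym (rising-0 m)))))
    binomial²-rising (suc k) k<p = *-cancelˡ (^-≉0 2 (ι≉0 (s≤s z≤n) k<p)) (begin
      ι (suc k) ^ 2 * (ι (n C suc k) * ι (m !)) ^ 2
        ≈⟨ ^-distrib-* (ι (suc k)) _ 2 ⟨
      (ι (suc k) * (ι (n C suc k) * ι (m !))) ^ 2
        ≈⟨ ^-congˡ 2 (trans (sym (*-assoc _ _ _)) (*-congʳ (trans (sym (ι-* (suc k) (n C suc k)))
             (trans (ι-cong ([1+k]*nC[1+k]≡[n∸k]*nCk n k)) (ι-* (n ∸ k) (n C k)))))) ⟩
      ((ι (n ∸ k) * ι (n C k)) * ι (m !)) ^ 2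
        ≈⟨ reflect k ⟩
      (ι (k ℕ.+ suc m) * (ι (n C k) * ι (m !))) ^ 2
        ≈⟨ ^-distrib-* (ι (k ℕ.+ suc m)) _ 2 ⟩
      ι (k ℕ.+ suc m) ^ 2 * (ι (n C k) * ι (m !)) ^ 2
        ≈⟨ *-congˡ (binomial²-rising k (ℕₚ.<-trans (ℕₚ.n<1+n k) k<p)) ⟩
      ι (k ℕ.+ suc m) ^ 2 * ι (rising k m) ^ 2
        ≈⟨ trans (*-comm _ _) (sym (^-distrib-* (ι (rising k m)) _ 2)) ⟩
      (ι (rising k m) * ι (k ℕ.+ suc m)) ^ 2
        ≈⟨ ^-congˡ 2 (trans (sym (ι-* (rising k m) _)) (trans (ι-cong (≡.sym (rising-suc k m))) (ι-* (suc k) (rising (suc k) m)))) ⟩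
      (ι (suc k) * ι (rising (suc k) m)) ^ 2
        ≈⟨ ^-distrib-* (ι (suc k)) _ 2 ⟩
      ι (suc k) ^ 2 * ι (rising (suc k) m) ^ 2 ∎)

    seqB-rising : seqB n * ι (m !) ^ 6 ≈ ∑ p (λ k → ι (rising k m) ^ 6)
    seqB-rising = begin
      seqB n * ι (m !) ^ 6
        ≈⟨ *-congʳ (seqB-extend (≡.subst (n <_) n+1+m≡p (ℕₚ.m<m+n n (s≤s z≤n)))) ⟩
      ∑ p (λ k → ι (n C k) ^ 6) * ι (m !) ^ 6
        ≈⟨ ∑-*ʳ p (ι (m !) ^ 6) _ ⟨
      ∑ p (λ k → ι (n C k) ^ 6 * ι (m !) ^ 6)
        ≈⟨ ∑-cong p (λ k k<p → begin
             ι (n C k) ^ 6 * ι (m !) ^ 6          ≈⟨ ^-distrib-* (ι (n C k)) (ι (m !)) 6 ⟨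
             (ι (n C k) * ι (m !)) ^ 6            ≈⟨ ^-assocʳ _ 2 3 ⟨
             ((ι (n C k) * ι (m !)) ^ 2) ^ 3      ≈⟨ ^-congˡ 3 (binomial²-rising k k<p) ⟩
             (ι (rising k m) ^ 2) ^ 3             ≈⟨ ^-assocʳ _ 2 3 ⟩
             ι (rising k m) ^ 6                   ∎) ⟩
      ∑ p (λ k → ι (rising k m) ^ 6) ∎

  rising-poly : ∀ m → PolyBelow (6 ℕ.* m ℕ.+ 1) (λ k → ι (rising k m) ^ 6)
  rising-poly zero    = poly-const (ι 1 ^ 6)
  rising-poly (suc m) = ≡.subst (λ d → PolyBelow d (λ k → ι (rising k (suc m)) ^ 6)) (degree m)
    (poly-cong (6 ℕ.+ d) {times 6 F} expand (times-poly 6))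
    where
    d : ℕ
    d = 6 ℕ.* m ℕ.+ 1
    F : ℕ → Carrier
    F k = ι (rising k m) ^ 6
    times : ℕ → (ℕ → Carrier) → ℕ → Carrier
    times zero    f k = f k
    times (suc j) f k = ι (1 ℕ.* k ℕ.+ suc m) * times j f k
    times-poly : ∀ j → PolyBelow (j ℕ.+ d) (times j F)
    times-poly zero    = rising-poly m
    times-poly (suc j) = poly-linear (j ℕ.+ d) {times j F} (suc m) 1 (times-poly j)
    times-^ : ∀ j k → times j F k ≈ ι (1 ℕ.* k ℕ.+ suc m) ^ j * F k
    times-^ zero    k = sym (*-identityˡ (F k))
    times-^ (suc j) k = trans (*-congˡ (times-^ j k)) (sym (*-assoc _ _ _))
    expand : ∀ k → times 6 F k ≈ ι (rising k (suc m)) ^ 6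
    expand k = trans (times-^ 6 k) (trans (*-congʳ (^-congˡ 6 (ι-cong (≡.cong (ℕ._+ suc m) (ℕₚ.*-identityˡ k)))))
      (trans (*-comm _ _) (trans (sym (^-distrib-* (ι (rising k m)) _ 6)) (^-congˡ 6 (sym (ι-* (rising k m) _))))))
    degree : ∀ m → 6 ℕ.+ (6 ℕ.* m ℕ.+ 1) ≡ 6 ℕ.* suc m ℕ.+ 1
    degree = solve-∀

  -- The product `(x - j)⋯(x - 1) x (x + 1)⋯(x + j)`. Being odd in `x`, it has an even sixth power,
  -- so that directly below the leading power `x^(12j+6)` comes `x^(12j+4)`.
  centered : ℕ → ℕ → Carrier
  centered zero    x = ι x
  centered (suc j) x = centered j x * (ι x ^ 2 - ι (suc j ℕ.* suc j))

  -- With `x = k + j + 2` the two outermost factors `k + 1` and `k + 2j + 3` multiply to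
  -- `x² - (j+1)²`, and the factors between them have the same centre.
  rising-centered : ∀ j k → ι (rising k (1 ℕ.+ 2 ℕ.* j)) ≈ centered j (k ℕ.+ suc j)
  rising-centered zero    k = ι-cong (ℕₚ.*-identityˡ (k ℕ.+ 1))
  rising-centered (suc j) k = begin
    ι (rising k (1 ℕ.+ 2 ℕ.* suc j))
      ≈⟨ ι-cong (≡.trans (≡.cong (rising k) (lengthen j)) (≡.cong (ℕ._* (k ℕ.+ suc (suc (1 ℕ.+ 2 ℕ.* j)))) (≡.sym (rising-suc k (1 ℕ.+ 2 ℕ.* j))))) ⟩
    ι (suc k ℕ.* rising (suc k) (1 ℕ.+ 2 ℕ.* j) ℕ.* (k ℕ.+ suc (suc (1 ℕ.+ 2 ℕ.* j))))
      ≈⟨ ι-cong (regroup (suc k) (rising (suc k) (1 ℕ.+ 2 ℕ.* j)) _) ⟩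
    ι (rising (suc k) (1 ℕ.+ 2 ℕ.* j) ℕ.* (suc k ℕ.* (k ℕ.+ suc (suc (1 ℕ.+ 2 ℕ.* j)))))
      ≈⟨ ι-* (rising (suc k) (1 ℕ.+ 2 ℕ.* j)) _ ⟩
    ι (rising (suc k) (1 ℕ.+ 2 ℕ.* j)) * ι (suc k ℕ.* (k ℕ.+ suc (suc (1 ℕ.+ 2 ℕ.* j))))
      ≈⟨ *-cong (trans (rising-centered j (suc k)) (reflexive (≡.cong (centered j) (≡.sym (ℕₚ.+-suc k (suc j)))))) ends ⟩
    centered (suc j) (k ℕ.+ suc (suc j)) ∎
    where
    lengthen : ∀ j → 1 ℕ.+ 2 ℕ.* suc j ≡ suc (suc (1 ℕ.+ 2 ℕ.* j))
    lengthen = solve-∀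
    regroup : ∀ a b c → a ℕ.* b ℕ.* c ≡ b ℕ.* (a ℕ.* c)
    regroup = solve-∀
    square : ∀ k j → suc k ℕ.* (k ℕ.+ suc (suc (1 ℕ.+ 2 ℕ.* j))) ℕ.+ suc j ℕ.* suc j ≡ (k ℕ.+ suc (suc j)) ℕ.* ((k ℕ.+ suc (suc j)) ℕ.* 1)
    square = solve-∀
    ends : ι (suc k ℕ.* (k ℕ.+ suc (suc (1 ℕ.+ 2 ℕ.* j)))) ≈ ι (k ℕ.+ suc (suc j)) ^ 2 - ι (suc j ℕ.* suc j)
    ends = sym (trans (+-congʳ (trans (sym (ι-^ (k ℕ.+ suc (suc j)) 2)) (trans (ι-cong (≡.sym (square k j)))
      (trans (ι-+ (suc k ℕ.* (k ℕ.+ suc (suc (1 ℕ.+ 2 ℕ.* j)))) (suc j ℕ.* suc j)) (+-comm _ _))))) (xyx⁻¹≈y (ι (suc j ℕ.* suc j)) _))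
      where open RingProperties ring using (xyx⁻¹≈y)

  -- The second coefficient is `-c`; moving it to the other side keeps `c` a natural number. The
  -- absence of `x^(N+1)` is part of the shape.
  record LeadingTerms (N c : ℕ) (f : ℕ → Carrier) : Set where
    field
      rest : ℕ → Carrier
      rest-below : PolyBelow N rest
      expansion : ∀ x → f x + ι c * ι x ^ N ≈ ι x ^ (2 ℕ.+ N) + rest x

  leading-factor : ∀ {N c f} e → LeadingTerms N c f →
    LeadingTerms (2 ℕ.+ N) (c ℕ.+ e) (λ x → f x * (ι x ^ 2 - ι e))
  leading-factor {N} {c} {f} e l = record
    { rest = rest′
    ; rest-below = poly-+ (2 ℕ.+ N) {λ x → ι x * (ι x * rest x) + (- ι e) * rest x} {λ x → (ι c * ι e) * ι x ^ N}
        (poly-+ (2 ℕ.+ N) {λ x → ι x * (ι x * rest x)} {λ x → (- ι e) * rest x}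
          (poly-ι* (suc N) {λ x → ι x * rest x} (poly-ι* N {rest} rest-below))
          (poly-mono {N} {2 ℕ.+ N} {λ x → (- ι e) * rest x} (ℕₚ.m≤n+m N 2) (poly-scale N (- ι e) {rest} rest-below)))
        (poly-suc (suc N) {λ x → (ι c * ι e) * ι x ^ N} (poly-scale (suc N) (ι c * ι e) {λ x → ι x ^ N} (monomial N)))
    ; expansion = λ x → trans (+-congˡ (*-congʳ (ι-+ c e))) (algebra (ι x) (ι x ^ N) (f x) (rest x) (ι c) (ι e) (- ι e) (-‿inverseʳ (ι e)) (expansion x))
    }
    where
    open LeadingTerms l
    open Solver
    rest′ : ℕ → Carrier
    rest′ x = (ι x * (ι x * rest x) + (- ι e) * rest x) + (ι c * ι e) * ι x ^ N
    algebra : ∀ y z F r c e e⁻ → e + e⁻ ≈ 0# → F + c * z ≈ y * (y * z) + r →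
      F * (y ^ 2 + e⁻) + (c + e) * (y * (y * z)) ≈ y * (y * (y * (y * z))) + ((y * (y * r) + e⁻ * r) + (c * e) * z)
    algebra y z F r c e e⁻ e+e⁻≈0 h = begin
      F * (y ^ 2 + e⁻) + (c + e) * (y * (y * z))
        ≈⟨ +-identityʳ _ ⟨
      (F * (y ^ 2 + e⁻) + (c + e) * (y * (y * z))) + 0#
        ≈⟨ +-congˡ (trans (*-congˡ e+e⁻≈0) (zeroʳ (c * z))) ⟨
      (F * (y ^ 2 + e⁻) + (c + e) * (y * (y * z))) + (c * z) * (e + e⁻)
        ≈⟨ solve 7 (λ y z F r c e e⁻ → (F :* (y :* (y :* con 1) :+ e⁻) :+ (c :+ e) :* (y :* (y :* z))) :+ (c :* z) :* (e :+ e⁻)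
             := (F :+ c :* z) :* (y :* y :+ e⁻) :+ (e :* (y :* (y :* z)) :+ (c :* e) :* z)) refl y z F r c e e⁻ ⟩
      (F + c * z) * (y * y + e⁻) + (e * (y * (y * z)) + (c * e) * z)
        ≈⟨ +-congʳ (*-congʳ h) ⟩
      (y * (y * z) + r) * (y * y + e⁻) + (e * (y * (y * z)) + (c * e) * z)
        ≈⟨ solve 7 (λ y z F r c e e⁻ → (y :* (y :* z) :+ r) :* (y :* y :+ e⁻) :+ (e :* (y :* (y :* z)) :+ (c :* e) :* z)
             := (y :* (y :* (y :* (y :* z))) :+ ((y :* (y :* r) :+ e⁻ :* r) :+ (c :* e) :* z)) :+ (y :* (y :* z)) :* (e :+ e⁻)) refl y z F r c e e⁻ ⟩
      (y * (y * (y * (y * z))) + ((y * (y * r) + e⁻ * r) + (c * e) * z)) + (y * (y * z)) * (e + e⁻)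
        ≈⟨ trans (+-congˡ (trans (*-congˡ e+e⁻≈0) (zeroʳ _))) (+-identityʳ _) ⟩
      y * (y * (y * (y * z))) + ((y * (y * r) + e⁻ * r) + (c * e) * z) ∎
    monomial : ∀ N → PolyBelow (suc N) (λ x → ι x ^ N)
    monomial zero    = poly-const 1#
    monomial (suc N) = poly-ι* (suc N) {λ x → ι x ^ N} (monomial N)

  leading-cong : ∀ {N c c′ f g} → c ≡ c′ → (∀ x → f x ≈ g x) → LeadingTerms N c f → LeadingTerms N c′ g
  leading-cong ≡.refl e l = record
    { rest = rest ; rest-below = rest-below ; expansion = λ x → trans (+-congʳ (sym (e x))) (expansion x) }
    where open LeadingTerms l

  -- Every `x² - i²` occurs six times and adds `i²` each time, and
  -- `6 (1² + ⋯ + j²) = j (j+1) (2j+1)`. The start is `x^6`, whence the 4 in the exponent.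
  centered-leading : ∀ j → LeadingTerms (j ℕ.* 12 ℕ.+ 4) (j ℕ.* suc j ℕ.* (1 ℕ.+ 2 ℕ.* j)) (λ x → centered j x ^ 6)
  centered-leading zero    = record
    { rest = λ _ → 0#
    ; rest-below = poly-mono {0} {4} {λ _ → 0#} z≤n (λ _ → refl)
    ; expansion = λ x → +-congˡ (zeroˡ (ι x ^ 4)) }
  centered-leading (suc j) = leading-cong coefficient sixth-power
    (leading-factor e (leading-factor e (leading-factor e (leading-factor e (leading-factor e (leading-factor e (centered-leading j)))))))
    where
    e : ℕ
    e = suc j ℕ.* suc j
    coefficient : j ℕ.* suc j ℕ.* (1 ℕ.+ 2 ℕ.* j) ℕ.+ e ℕ.+ e ℕ.+ e ℕ.+ e ℕ.+ e ℕ.+ e ≡ suc j ℕ.* suc (suc j) ℕ.* (1 ℕ.+ 2 ℕ.* suc j)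
    coefficient = ≡.trans (collect (j ℕ.* suc j ℕ.* (1 ℕ.+ 2 ℕ.* j)) e) (cubic j)
      where
      collect : ∀ x e → x ℕ.+ e ℕ.+ e ℕ.+ e ℕ.+ e ℕ.+ e ℕ.+ e ≡ x ℕ.+ 6 ℕ.* e
      collect = solve-∀
      cubic : ∀ j → j ℕ.* suc j ℕ.* (1 ℕ.+ 2 ℕ.* j) ℕ.+ 6 ℕ.* (suc j ℕ.* suc j) ≡ suc j ℕ.* suc (suc j) ℕ.* (1 ℕ.+ 2 ℕ.* suc j)
      cubic = solve-∀
    sixth-power : ∀ x → let g = ι x ^ 2 - ι e in centered j x ^ 6 * g * g * g * g * g * g ≈ centered (suc j) x ^ 6
    sixth-power x = solve 2 (λ f g → (f :^ 6) :* g :* g :* g :* g :* g :* g := (f :* g) :^ 6) refl (centered j x) (ι x ^ 2 - ι e)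
      where open Solver

  centered-periodic : ∀ j x → centered j (x ℕ.+ p) ≈ centered j x
  centered-periodic zero    x = trans (ι-+ x p) (trans (+-congˡ ι-p) (+-identityʳ (ι x)))
  centered-periodic (suc j) x = *-cong (centered-periodic j x) (+-congʳ (^-congˡ 2 (centered-periodic 0 x)))

  module _ (t : ℕ) (t≢0 : t ≢ 0) (p≡ : suc (t ℕ.* 12 ℕ.+ 4) ≡ p) where

    N : ℕ
    N = t ℕ.* 12 ℕ.+ 4

    N<p : N < p
    N<p = ℕₚ.≤-reflexive p≡

    fermat′ : ∀ x → ι x ^ suc N ≈ ι x
    fermat′ x = trans (reflexive (≡.cong (ι x ^_) p≡)) (fermat x)

    ∑-power-N : ∑ p (λ x → ι x ^ N) ≈ ι N
    ∑-power-N = begin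
      ∑ p (λ x → ι x ^ N)                        ≡⟨ ≡.cong (λ l → ∑ l (λ x → ι x ^ N)) p≡ ⟨
      ∑ (suc N) (λ x → ι x ^ N)                  ≈⟨ ∑-head N _ ⟩
      0# ^ N + ∑ N (λ x → ι (suc x) ^ N)         ≈⟨ +-cong (0^ (ℕₚ.≤-trans (s≤s z≤n) (ℕₚ.m≤n+m 4 (t ℕ.* 12)))) (∑-cong N (λ x x<N → unit x
                                                      (ℕₚ.≤-<-trans x<N N<p))) ⟩
      0# + ∑ N (λ _ → 1#)                        ≈⟨ +-identityˡ _ ⟩
      ∑ N (λ _ → 1#)                             ≈⟨ ∑-1 N ⟩
      ι N                                        ∎
      where
      0^ : ∀ {k} → 0 < k → 0# ^ k ≈ 0#
      0^ {suc k} _ = zeroˡ (0# ^ k)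
      unit : ∀ x → suc x < p → ι (suc x) ^ N ≈ 1#
      unit x x<p = *-cancelˡ (ι≉0 (s≤s z≤n) x<p) (trans (fermat′ (suc x)) (sym (*-identityʳ (ι (suc x)))))
      ∑-1 : ∀ k → ∑ k (λ _ → 1#) ≈ ι k
      ∑-1 zero    = refl
      ∑-1 (suc k) = trans (+-congʳ (∑-1 k)) (+-comm (ι k) 1#)

    -- Here `N = p - 1`. On 𝔽ₚ the power `x^(N+2)` acts as `x²` and sums to zero, as does `rest`, so
    -- a vanishing total would force `c (p - 1)` to vanish. The factors `t`, `t + 1`, `2t + 1` of
    -- `c` lie strictly between 0 and `p`; this is where `t ≢ 0` enters.
    ∑-centered≉0 : ¬ (∑ p (λ x → centered t x ^ 6) ≈ 0#)
    ∑-centered≉0 ∑≈0 = *-≉0 c≉0 (ι≉0 (ℕₚ.≤-trans (s≤s z≤n) (ℕₚ.m≤n+m 4 (t ℕ.* 12))) N<p) (begin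
      ι c * ι N
        ≈⟨ *-congˡ ∑-power-N ⟨
      ι c * ∑ p (λ x → ι x ^ N)
        ≈⟨ ∑-*ˡ p (ι c) _ ⟨
      ∑ p (λ x → ι c * ι x ^ N)
        ≈⟨ trans (+-congʳ ∑≈0) (+-identityˡ _) ⟨
      ∑ p (λ x → centered t x ^ 6) + ∑ p (λ x → ι c * ι x ^ N)
        ≈⟨ ∑-+ p _ _ ⟨
      ∑ p (λ x → centered t x ^ 6 + ι c * ι x ^ N)
        ≈⟨ ∑-cong p (λ x _ → expansion x) ⟩
      ∑ p (λ x → ι x ^ (2 ℕ.+ N) + rest x)
        ≈⟨ ∑-+ p _ _ ⟩
      ∑ p (λ x → ι x ^ (2 ℕ.+ N)) + ∑ p rest
        ≈⟨ +-cong (trans (∑-cong p (λ x _ → *-congˡ (trans (fermat′ x) (sym (*-identityʳ (ι x))))))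
                         (∑-poly {3} _ 3<p (poly-ι* 2 {λ x → ι x * 1#} (poly-ι* 1 {λ _ → 1#} (poly-const 1#)))))
                  (∑-poly {N} rest N<p rest-below) ⟩
      0# + 0#
        ≈⟨ +-identityˡ 0# ⟩
      0# ∎)
      where
      open LeadingTerms (centered-leading t)
      c : ℕ
      c = t ℕ.* suc t ℕ.* (1 ℕ.+ 2 ℕ.* t)
      3<p : 3 < p
      3<p = ℕₚ.<-trans (ℕₚ.m≤n+m 4 (t ℕ.* 12)) N<p
      1+2t<p : 1 ℕ.+ 2 ℕ.* t < p
      1+2t<p = ≡.subst (1 ℕ.+ 2 ℕ.* t <_) (≡.trans (split t) p≡) (s≤s (s≤s (ℕₚ.m≤m+n (2 ℕ.* t) (t ℕ.* 10 ℕ.+ 3))))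
        where
        split : ∀ t → 2 ℕ.+ (2 ℕ.* t ℕ.+ (t ℕ.* 10 ℕ.+ 3)) ≡ suc (t ℕ.* 12 ℕ.+ 4)
        split = solve-∀
      1+t<p : suc t < p
      1+t<p = ℕₚ.≤-<-trans (s≤s (ℕₚ.m≤n*m t 2)) 1+2t<p
      c≉0 : ¬ (ι c ≈ 0#)
      c≉0 e = *-≉0 (*-≉0 (ι≉0 (ℕₚ.n≢0⇒n>0 t≢0) (ℕₚ.<-trans (ℕₚ.n<1+n t) 1+t<p)) (ι≉0 (s≤s z≤n) 1+t<p))
        (ι≉0 (s≤s z≤n) 1+2t<p)
        (trans (sym (trans (ι-* (t ℕ.* suc t) (1 ℕ.+ 2 ℕ.* t)) (*-congʳ (ι-* t (suc t))))) e)

    -- The complementary index is `m = 1 + 2t`, the first for which `6m` reaches `p - 1`: it equals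
    -- `p + 1`. The shift by `t + 1` that centres the product is harmless in a sum over a period.
    seqB≉0 : ¬ (seqB (3 ℕ.+ 10 ℕ.* t) ≈ 0#)
    seqB≉0 e = ∑-centered≉0 (begin
      ∑ p (λ x → centered t x ^ 6)
        ≈⟨ ∑-periodic (λ x → centered t x ^ 6) (suc t) (λ x → ^-congˡ 6 (centered-periodic t x)) ⟨
      ∑ p (λ k → centered t (k ℕ.+ suc t) ^ 6)
        ≈⟨ ∑-cong p (λ k _ → ^-congˡ 6 (rising-centered t k)) ⟨
      ∑ p (λ k → ι (rising k (1 ℕ.+ 2 ℕ.* t)) ^ 6)
        ≈⟨ seqB-rising {3 ℕ.+ 10 ℕ.* t} {1 ℕ.+ 2 ℕ.* t} (≡.trans (total t) p≡) ⟨
      seqB (3 ℕ.+ 10 ℕ.* t) * ι ((1 ℕ.+ 2 ℕ.* t) !) ^ 6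
        ≈⟨ product-zero (inj₁ e) ⟩
      0# ∎)
      where
      total : ∀ t → 3 ℕ.+ 10 ℕ.* t ℕ.+ suc (1 ℕ.+ 2 ℕ.* t) ≡ suc (t ℕ.* 12 ℕ.+ 4)
      total = solve-∀

    -- Now the complementary `m` is at most `2t`, and a polynomial of degree `6m ≤ p - 5` sums to
    -- zero.
    seqB≈0 : ∀ {n} → 3 ℕ.+ 10 ℕ.* t < n → n < p → seqB n ≈ 0#
    seqB≈0 {n} e<n n<p = *-zeroʳ⁻¹ (^-≉0 6 (ι[k!]≉0 m (ℕₚ.≤-<-trans m≤2t 2t<p)))
      (trans (*-comm _ _) (trans (seqB-rising {n} {m} n+1+m≡p) (∑-poly {6 ℕ.* m ℕ.+ 1} _ 6m+1<p (rising-poly m))))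
      where
      m : ℕ
      m = p ∸ suc n
      n+1+m≡p : n ℕ.+ suc m ≡ p
      n+1+m≡p = ≡.trans (ℕₚ.+-suc n m) (ℕₚ.m+[n∸m]≡n n<p)
      total : ∀ t → 2 ℕ.* t ℕ.+ suc (suc (3 ℕ.+ 10 ℕ.* t)) ≡ suc (t ℕ.* 12 ℕ.+ 4)
      total = solve-∀
      m≤2t : m ≤ 2 ℕ.* t
      m≤2t = ≡.subst (m ≤_) (≡.trans (≡.cong (_∸ suc (suc (3 ℕ.+ 10 ℕ.* t))) (≡.trans (≡.sym p≡) (≡.sym (total t))))
        (ℕₚ.m+n∸n≡m (2 ℕ.* t) (suc (suc (3 ℕ.+ 10 ℕ.* t))))) (ℕₚ.∸-monoʳ-≤ p (s≤s e<n))
      split : ∀ t → suc (6 ℕ.* (2 ℕ.* t) ℕ.+ 1) ℕ.+ 3 ≡ suc (t ℕ.* 12 ℕ.+ 4)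
      split = solve-∀
      6m+1<p : 6 ℕ.* m ℕ.+ 1 < p
      6m+1<p = ℕₚ.≤-trans (s≤s (ℕₚ.+-monoˡ-≤ 1 (ℕₚ.*-monoʳ-≤ 6 m≤2t)))
        (≡.subst (suc (6 ℕ.* (2 ℕ.* t) ℕ.+ 1) ≤_) (≡.trans (split t) p≡) (ℕₚ.m≤m+n _ 3))
      2t<p : 2 ℕ.* t < p
      2t<p = ≡.subst (2 ℕ.* t <_) (≡.trans (total t) p≡) (ℕₚ.m<m+n (2 ℕ.* t) (s≤s z≤n))

    degree-B : HasDegree (truncate seqB) (3 ℕ.+ 10 ℕ.* t)
    degree-B = (λ z → seqB≉0 (trans (sym (truncate-< seqB e<p)) z)) , below
      where
      split : ∀ t → suc (3 ℕ.+ 10 ℕ.* t) ℕ.+ (2 ℕ.* t ℕ.+ 1) ≡ suc (t ℕ.* 12 ℕ.+ 4)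
      split = solve-∀
      e<p : 3 ℕ.+ 10 ℕ.* t < p
      e<p = ≡.subst (3 ℕ.+ 10 ℕ.* t <_) (≡.trans (split t) p≡) (ℕₚ.m≤m+n _ (2 ℕ.* t ℕ.+ 1))
      below : Below (suc (3 ℕ.+ 10 ℕ.* t)) (truncate seqB)
      below n e<n with n ℕ.<? p
      ... | no  _   = refl
      ... | yes n<p = seqB≈0 e<n n<p

-- The hypergeometric recurrence and differential equations for A.

central : ℕ → ℕ
central n = ((4 ℕ.* n) C (2 ℕ.* n)) ℕ.* ((2 ℕ.* n) C n)

central-! : ∀ n → central n ℕ.* ((2 ℕ.* n) ! ℕ.* (n ! ℕ.* n !)) ≡ (4 ℕ.* n) !
central-! n = begin
  central n ℕ.* ((2 ℕ.* n) ! ℕ.* (n ! ℕ.* n !))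
    ≡⟨ regroup ((4 ℕ.* n) C (2 ℕ.* n)) ((2 ℕ.* n) C n) ((2 ℕ.* n) !) (n ! ℕ.* n !) ⟩
  ((4 ℕ.* n) C (2 ℕ.* n)) ℕ.* ((2 ℕ.* n) ! ℕ.* (((2 ℕ.* n) C n) ℕ.* (n ! ℕ.* n !)))
    ≡⟨ ≡.cong (λ x → ((4 ℕ.* n) C (2 ℕ.* n)) ℕ.* ((2 ℕ.* n) ! ℕ.* x)) (half n) ⟩
  ((4 ℕ.* n) C (2 ℕ.* n)) ℕ.* ((2 ℕ.* n) ! ℕ.* (2 ℕ.* n) !)
    ≡⟨ ≡.cong (λ m → (m C (2 ℕ.* n)) ℕ.* ((2 ℕ.* n) ! ℕ.* (2 ℕ.* n) !)) (ℕₚ.*-assoc 2 2 n) ⟩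
  ((2 ℕ.* (2 ℕ.* n)) C (2 ℕ.* n)) ℕ.* ((2 ℕ.* n) ! ℕ.* (2 ℕ.* n) !)
    ≡⟨ half (2 ℕ.* n) ⟩
  (2 ℕ.* (2 ℕ.* n)) !
    ≡⟨ ≡.cong _! (ℕₚ.*-assoc 2 2 n) ⟨
  (4 ℕ.* n) ! ∎
  where
  open ≡.≡-Reasoning
  regroup : ∀ a b c d → a ℕ.* b ℕ.* (c ℕ.* d) ≡ a ℕ.* (c ℕ.* (b ℕ.* d))
  regroup = solve-∀
  half : ∀ n → ((2 ℕ.* n) C n) ℕ.* (n ! ℕ.* n !) ≡ (2 ℕ.* n) !
  half n = ≡.trans
    (≡.cong (λ m → ((2 ℕ.* n) C n) ℕ.* (n ! ℕ.* m !)) (≡.sym (≡.trans (ℕₚ.m+n∸m≡n n (1 ℕ.* n)) (ℕₚ.*-identityˡ n))))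
    (nCk*k![n∸k]!≡n! (ℕₚ.m≤n*m n 2))

-- The numerator of the term ratio over `(n+1)²`: of the four new factors of `(4n+4)!`, the even
-- ones cancel against `(2n+2)(2n+1)` and leave 4. Modulo `p = 4α + 1` it vanishes at `α` and at
-- `3α`.
ratio : ℕ → ℕ
ratio n = 4 ℕ.* ((4 ℕ.* n ℕ.+ 1) ℕ.* (4 ℕ.* n ℕ.+ 3))

central-ratio : ∀ n → central (suc n) ℕ.* (suc n ℕ.* suc n) ≡ ratio n ℕ.* central n
central-ratio n = ℕₚ.*-cancelʳ-≡ _ _ D {{D≢0}} (begin
  central (suc n) ℕ.* (suc n ℕ.* suc n) ℕ.* D
    ≡⟨ regroup (central (suc n)) (suc n) ((2 ℕ.+ 2 ℕ.* n) ℕ.* (1 ℕ.+ 2 ℕ.* n)) ((2 ℕ.* n) !) (n !) ⟩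
  central (suc n) ℕ.* (((2 ℕ.+ 2 ℕ.* n) ℕ.* (1 ℕ.+ 2 ℕ.* n) ℕ.* (2 ℕ.* n) !) ℕ.* (suc n ! ℕ.* suc n !))
    ≡⟨ ≡.cong (λ x → central (suc n) ℕ.* (x ℕ.* (suc n ! ℕ.* suc n !)))
         (≡.trans (ℕₚ.*-assoc (2 ℕ.+ 2 ℕ.* n) (1 ℕ.+ 2 ℕ.* n) ((2 ℕ.* n) !)) (≡.cong _! (double n))) ⟩
  central (suc n) ℕ.* ((2 ℕ.* suc n) ! ℕ.* (suc n ! ℕ.* suc n !))
    ≡⟨ central-! (suc n) ⟩
  (4 ℕ.* suc n) !
    ≡⟨ ≡.cong _! (quadruple n) ⟩
  (4 ℕ.+ 4 ℕ.* n) !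
    ≡⟨ ≡.cong (λ x → (4 ℕ.+ 4 ℕ.* n) ℕ.* ((3 ℕ.+ 4 ℕ.* n) ℕ.* ((2 ℕ.+ 4 ℕ.* n) ℕ.* ((1 ℕ.+ 4 ℕ.* n) ℕ.* x)))) (central-! n) ⟨
  (4 ℕ.+ 4 ℕ.* n) ℕ.* ((3 ℕ.+ 4 ℕ.* n) ℕ.* ((2 ℕ.+ 4 ℕ.* n) ℕ.* ((1 ℕ.+ 4 ℕ.* n) ℕ.* (central n ℕ.* e))))
    ≡⟨ collect (4 ℕ.+ 4 ℕ.* n) (3 ℕ.+ 4 ℕ.* n) (2 ℕ.+ 4 ℕ.* n) (1 ℕ.+ 4 ℕ.* n) (central n ℕ.* e) ⟩
  (3 ℕ.+ 4 ℕ.* n) ℕ.* (1 ℕ.+ 4 ℕ.* n) ℕ.* ((4 ℕ.+ 4 ℕ.* n) ℕ.* (2 ℕ.+ 4 ℕ.* n)) ℕ.* (central n ℕ.* e)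
    ≡⟨ ≡.cong₂ (λ x y → x ℕ.* y ℕ.* (central n ℕ.* e)) (odd n) (even n) ⟩
  (4 ℕ.* n ℕ.+ 1) ℕ.* (4 ℕ.* n ℕ.+ 3) ℕ.* (4 ℕ.* ((2 ℕ.+ 2 ℕ.* n) ℕ.* (1 ℕ.+ 2 ℕ.* n))) ℕ.* (central n ℕ.* e)
    ≡⟨ finish ((4 ℕ.* n ℕ.+ 1) ℕ.* (4 ℕ.* n ℕ.+ 3)) ((2 ℕ.+ 2 ℕ.* n) ℕ.* (1 ℕ.+ 2 ℕ.* n)) (central n) e ⟩
  ratio n ℕ.* central n ℕ.* D ∎)
  where
  open ≡.≡-Reasoning
  e D : ℕ
  e = (2 ℕ.* n) ! ℕ.* (n ! ℕ.* n !)
  D = ((2 ℕ.+ 2 ℕ.* n) ℕ.* (1 ℕ.+ 2 ℕ.* n)) ℕ.* e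
  D≢0 : NonZero D
  D≢0 = ℕₚ.m*n≢0 ((2 ℕ.+ 2 ℕ.* n) ℕ.* (1 ℕ.+ 2 ℕ.* n)) e {{_}} {{ℕₚ.m*n≢0 ((2 ℕ.* n) !) (n ! ℕ.* n !) {{(2 ℕ.* n) ℕₚ.!≢0}} {{n ℕₚ.!* n !≢0}}}}
  regroup : ∀ c s d x y → c ℕ.* (s ℕ.* s) ℕ.* (d ℕ.* (x ℕ.* (y ℕ.* y))) ≡ c ℕ.* ((d ℕ.* x) ℕ.* ((s ℕ.* y) ℕ.* (s ℕ.* y)))
  regroup = solve-∀
  collect : ∀ a b c d x → a ℕ.* (b ℕ.* (c ℕ.* (d ℕ.* x))) ≡ b ℕ.* d ℕ.* (a ℕ.* c) ℕ.* x
  collect = solve-∀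
  double : ∀ n → 2 ℕ.+ 2 ℕ.* n ≡ 2 ℕ.* suc n
  double = solve-∀
  quadruple : ∀ n → 4 ℕ.* suc n ≡ 4 ℕ.+ 4 ℕ.* n
  quadruple = solve-∀
  odd : ∀ n → (3 ℕ.+ 4 ℕ.* n) ℕ.* (1 ℕ.+ 4 ℕ.* n) ≡ (4 ℕ.* n ℕ.+ 1) ℕ.* (4 ℕ.* n ℕ.+ 3)
  odd = solve-∀
  even : ∀ n → (4 ℕ.+ 4 ℕ.* n) ℕ.* (2 ℕ.+ 4 ℕ.* n) ≡ 4 ℕ.* ((2 ℕ.+ 2 ℕ.* n) ℕ.* (1 ℕ.+ 2 ℕ.* n))
  even = solve-∀
  finish : ∀ a b c e → a ℕ.* (4 ℕ.* b) ℕ.* (c ℕ.* e) ≡ 4 ℕ.* a ℕ.* c ℕ.* (b ℕ.* e)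
  finish = solve-∀

module LogarithmicDerivative (R : CommutativeRing 0ℓ 0ℓ) (isDomain : DecidableDomain R)
  (p : ℕ) .{{_ : NonZero p}} (isChar : Characteristic R p) where
  open CommutativeRing R
  open DecidableDomain isDomain
  open Characteristic isChar
  open Sums R
  open PowerSeriesRing R
  open Polynomials R
  open RingExtras R
  open DomainExtras R isDomain
  open FiniteDifferences R
  open PrimeCharacteristic R isDomain p isChar
  open Sequences R
  open Lucas R isDomain p isChar
  open DegreeA R isDomain p isChar
  open Frobenius R p
  open SetoidReasoning setoid

  -- The Euler operator `z d/dz`, chosen over `d/dz` because it is diagonal on coefficients and
  -- preserves degree bounds.
  θ : Series → Series
  θ x n = ι n * x n

  seqA-ratio : ∀ n → ι (suc n) ^ 2 * seqA (suc n) ≈ ι (ratio n) * seqA n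
  seqA-ratio n = begin
    ι (suc n) ^ 2 * seqA (suc n)
      ≈⟨ *-comm _ _ ⟩
    seqA (suc n) * ι (suc n) ^ 2
      ≈⟨ *-cong (sym (ι-* ((4 ℕ.* suc n) C (2 ℕ.* suc n)) _)) (trans (*-congˡ (*-identityʳ _)) (sym (ι-* (suc n) (suc n)))) ⟩
    ι (central (suc n)) * ι (suc n ℕ.* suc n)
      ≈⟨ ι-* (central (suc n)) (suc n ℕ.* suc n) ⟨
    ι (central (suc n) ℕ.* (suc n ℕ.* suc n))
      ≈⟨ ι-cong (central-ratio n) ⟩
    ι (ratio n ℕ.* central n)
      ≈⟨ trans (ι-* (ratio n) (central n)) (*-congˡ (ι-* ((4 ℕ.* n) C (2 ℕ.* n)) _)) ⟩
    ι (ratio n) * seqA n ∎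

  ratio-root : ∀ {M} → ι (4 ℕ.* M ℕ.+ 1) ≈ 0# ⊎ ι (4 ℕ.* M ℕ.+ 3) ≈ 0# → ι (ratio M) ≈ 0#
  ratio-root {M} e = trans (ι-* 4 ((4 ℕ.* M ℕ.+ 1) ℕ.* (4 ℕ.* M ℕ.+ 3)))
    (product-zero (inj₂ (trans (ι-* (4 ℕ.* M ℕ.+ 1) (4 ℕ.* M ℕ.+ 3)) (product-zero e))))

  module _ (t : ℕ) (p≡ : suc (t ℕ.* 12 ℕ.+ 4) ≡ p) where

    A : Series
    A = truncate seqA

    α : ℕ
    α = 1 ℕ.+ 3 ℕ.* t

    p≡4α+1 : 1 ℕ.+ 4 ℕ.* α ≡ p
    p≡4α+1 = ≡.trans (lemma t) p≡
      where
      lemma : ∀ t → 1 ℕ.+ 4 ℕ.* (1 ℕ.+ 3 ℕ.* t) ≡ suc (t ℕ.* 12 ℕ.+ 4)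
      lemma = solve-∀

    4α<p : 4 ℕ.* α < p
    4α<p = ℕₚ.≤-reflexive p≡4α+1

    α<p : α < p
    α<p = ℕₚ.≤-<-trans (ℕₚ.m≤n*m α 4) 4α<p

    A≉0 : ∀ {n} → n ≤ α → ¬ (A n ≈ 0#)
    A≉0 {n} n≤α e = seqA≉0 {n} (ℕₚ.≤-<-trans (ℕₚ.*-monoʳ-≤ 4 n≤α) 4α<p)
      (trans (sym (truncate-< seqA (ℕₚ.≤-<-trans n≤α α<p))) e)

    A-ratio : ∀ {n} → suc n ≤ α → ι (suc n) ^ 2 * A (suc n) ≈ ι (ratio n) * A n
    A-ratio {n} n<α = begin
      ι (suc n) ^ 2 * A (suc n)       ≈⟨ *-congˡ (truncate-< seqA (ℕₚ.≤-<-trans n<α α<p)) ⟩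
      ι (suc n) ^ 2 * seqA (suc n)    ≈⟨ seqA-ratio n ⟩
      ι (ratio n) * seqA n            ≈⟨ *-congˡ (truncate-< seqA (ℕₚ.<-trans n<α α<p)) ⟨
      ι (ratio n) * A n               ∎

    -- The z^(M+I)-coefficient of Q θA + P A, divided by a(M) and multiplied by (M+1)²⋯(M+I)², is a
    -- polynomial H I in M.  It vanishes for all M with M + I ≤ α, hence identically; at the two zeros
    -- of the ratio modulo p only the coefficients of index I contribute.
    module TopCoefficient (I : ℕ) (Q P : Series) (below-Q : Below (suc I) Q) (below-P : Below (suc I) P)
      (3I+1≤α : 3 ℕ.* I ℕ.+ 1 ≤ α) (equation : (Q ⊗ θ A) ⊕ (P ⊗ A) ≋ 0ˢ) where

      -- The weight of `A (M + l)` in the coefficient of `z^(M+I)`. Counting from the lowest index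
      -- of `A` puts the top coefficients of `Q` and `P` at `l = 0`.
      w : ℕ → ℕ → Carrier
      w l M = Q (I ∸ l) * ι (M ℕ.+ l) + P (I ∸ l)

      S squares ratios H : ℕ → ℕ → Carrier
      S L M = ∑ (suc L) (λ l → w l M * A (M ℕ.+ l))
      squares zero    M = 1#
      squares (suc L) M = squares L M * ι (M ℕ.+ suc L) ^ 2
      ratios zero    M = 1#
      ratios (suc L) M = ratios L M * ι (ratio (M ℕ.+ L))
      H zero    M = w 0 M
      H (suc L) M = H L M * ι (M ℕ.+ suc L) ^ 2 + w (suc L) M * ratios (suc L) M

      squares-ratios : ∀ L M → M ℕ.+ L ≤ α → squares L M * A (M ℕ.+ L) ≈ ratios L M * A M
      squares-ratios zero    M _ = *-congˡ (reflexive (≡.cong A (ℕₚ.+-identityʳ M)))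
      squares-ratios (suc L) M M+L≤α = begin
        squares L M * ι (M ℕ.+ suc L) ^ 2 * A (M ℕ.+ suc L)
          ≡⟨ ≡.cong (λ n → squares L M * ι n ^ 2 * A n) (ℕₚ.+-suc M L) ⟩
        squares L M * ι (suc (M ℕ.+ L)) ^ 2 * A (suc (M ℕ.+ L))
          ≈⟨ trans (*-assoc _ _ _) (*-congˡ (A-ratio 1+M+L≤α)) ⟩
        squares L M * (ι (ratio (M ℕ.+ L)) * A (M ℕ.+ L))
          ≈⟨ x∙yz≈y∙xz _ _ _ ⟩
        ι (ratio (M ℕ.+ L)) * (squares L M * A (M ℕ.+ L))
          ≈⟨ *-congˡ (squares-ratios L M (ℕₚ.<⇒≤ 1+M+L≤α)) ⟩
        ι (ratio (M ℕ.+ L)) * (ratios L M * A M)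
          ≈⟨ trans (sym (*-assoc _ _ _)) (*-congʳ (*-comm _ _)) ⟩
        ratios (suc L) M * A M ∎
        where
        open CommutativeSemigroupProperties (CommutativeMonoid.commutativeSemigroup *-commutativeMonoid) using (x∙yz≈y∙xz)
        1+M+L≤α : suc (M ℕ.+ L) ≤ α
        1+M+L≤α = ≡.subst (_≤ α) (ℕₚ.+-suc M L) M+L≤α

      S≈H : ∀ L M → M ℕ.+ L ≤ α → squares L M * S L M ≈ H L M * A M
      S≈H zero    M _ = trans (*-identityˡ _) (trans (+-identityˡ _) (*-congˡ (reflexive (≡.cong A (ℕₚ.+-identityʳ M)))))
      S≈H (suc L) M M+L≤α = begin
        squares (suc L) M * (S L M + w (suc L) M * A (M ℕ.+ suc L))
          ≈⟨ solve 5 (λ s x S w a → (s :* x) :* (S :+ w :* a) := (s :* S) :* x :+ w :* ((s :* x) :* a)) refl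
               (squares L M) (ι (M ℕ.+ suc L) ^ 2) (S L M) (w (suc L) M) (A (M ℕ.+ suc L)) ⟩
        (squares L M * S L M) * ι (M ℕ.+ suc L) ^ 2 + w (suc L) M * (squares (suc L) M * A (M ℕ.+ suc L))
          ≈⟨ +-cong (*-congʳ (S≈H L M (ℕₚ.≤-trans (ℕₚ.+-monoʳ-≤ M (ℕₚ.n≤1+n L)) M+L≤α)))
                    (*-congˡ (squares-ratios (suc L) M M+L≤α)) ⟩
        (H L M * A M) * ι (M ℕ.+ suc L) ^ 2 + w (suc L) M * (ratios (suc L) M * A M)
          ≈⟨ solve 5 (λ h a x w r → (h :* a) :* x :+ w :* (r :* a) := (h :* x :+ w :* r) :* a) refl
               (H L M) (A M) (ι (M ℕ.+ suc L) ^ 2) (w (suc L) M) (ratios (suc L) M) ⟩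
        H (suc L) M * A M ∎
        where open Solver

      equation-S : ∀ M → S I M ≈ 0#
      equation-S M = begin
        ∑ (suc I) (λ l → w l M * A (M ℕ.+ l))
          ≈⟨ ∑-cong (suc I) (λ l l≤I → reindex l (ℕₚ.≤-pred l≤I)) ⟩
        ∑ (suc I) (λ l → c (I ∸ l))
          ≈⟨ ∑-reverse I c ⟨
        ∑ (suc I) c
          ≈⟨ ∑-extend (s≤s (ℕₚ.m≤n+m I M)) (λ i I<i → trans (+-cong (product-zero (inj₁ (below-Q i I<i))) (product-zero (inj₁ (below-P i I<i)))) (+-identityˡ 0#)) ⟩
        ∑ (suc (M ℕ.+ I)) c
          ≈⟨ ∑-+ (suc (M ℕ.+ I)) _ _ ⟩
        ((Q ⊗ θ A) ⊕ (P ⊗ A)) (M ℕ.+ I)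
          ≈⟨ at equation (M ℕ.+ I) ⟩
        0# ∎
        where
        c : ℕ → Carrier
        c i = Q i * (ι (M ℕ.+ I ∸ i) * A (M ℕ.+ I ∸ i)) + P i * A (M ℕ.+ I ∸ i)
        reindex : ∀ l → l ≤ I → w l M * A (M ℕ.+ l) ≈ c (I ∸ l)
        reindex l l≤I = trans (distribʳ _ _ _) (trans (+-congʳ (*-assoc _ _ _))
          (reflexive (≡.cong (λ n → Q (I ∸ l) * (ι n * A n) + P (I ∸ l) * A n) (≡.sym (≡.trans
            (ℕₚ.+-∸-assoc M (ℕₚ.m∸n≤m I l)) (≡.cong (M ℕ.+_) (ℕₚ.m∸[m∸n]≡n l≤I)))))))

      w*-poly : ∀ l d {f} → PolyBelow d f → PolyBelow (suc d) (λ M → w l M * f M)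
      w*-poly l d {f} b = poly-cong (suc d) {λ M → Q (I ∸ l) * (ι (1 ℕ.* M ℕ.+ l) * f M) + P (I ∸ l) * f M}
        (λ M → trans (+-congʳ (trans (sym (*-assoc _ _ _)) (*-congʳ (*-congˡ (ι-cong (≡.cong (ℕ._+ l) (ℕₚ.*-identityˡ M)))))))
          (sym (distribʳ _ _ _)))
        (poly-+ (suc d) {λ M → Q (I ∸ l) * (ι (1 ℕ.* M ℕ.+ l) * f M)} {λ M → P (I ∸ l) * f M}
          (poly-scale (suc d) (Q (I ∸ l)) {λ M → ι (1 ℕ.* M ℕ.+ l) * f M} (poly-linear d {f} l 1 b))
          (poly-suc d {λ M → P (I ∸ l) * f M} (poly-scale d (P (I ∸ l)) {f} b)))

      ratios-poly : ∀ L → PolyBelow (L ℕ.* 2 ℕ.+ 1) (ratios L)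
      ratios-poly zero    = poly-const 1#
      ratios-poly (suc L) = poly-cong (2 ℕ.+ d) {λ M → ι 4 * (ι (4 ℕ.* M ℕ.+ (4 ℕ.* L ℕ.+ 1)) * (ι (4 ℕ.* M ℕ.+ (4 ℕ.* L ℕ.+ 3)) * ratios L M))}
        (λ M → trans (solve 4 (λ a b c r → a :* (b :* (c :* r)) := r :* (a :* (b :* c))) refl _ _ _ _)
          (*-congˡ (trans (*-congˡ (*-cong (ι-cong (shift M L 1)) (ι-cong (shift M L 3))))
            (trans (*-congˡ (sym (ι-* (4 ℕ.* (M ℕ.+ L) ℕ.+ 1) (4 ℕ.* (M ℕ.+ L) ℕ.+ 3))))
              (sym (ι-* 4 ((4 ℕ.* (M ℕ.+ L) ℕ.+ 1) ℕ.* (4 ℕ.* (M ℕ.+ L) ℕ.+ 3))))))))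
        (poly-scale (2 ℕ.+ d) (ι 4) {λ M → ι (4 ℕ.* M ℕ.+ (4 ℕ.* L ℕ.+ 1)) * (ι (4 ℕ.* M ℕ.+ (4 ℕ.* L ℕ.+ 3)) * ratios L M)}
          (poly-linear (1 ℕ.+ d) {λ M → ι (4 ℕ.* M ℕ.+ (4 ℕ.* L ℕ.+ 3)) * ratios L M} (4 ℕ.* L ℕ.+ 1) 4
            (poly-linear d {ratios L} (4 ℕ.* L ℕ.+ 3) 4 (ratios-poly L))))
        where
        open Solver
        d : ℕ
        d = L ℕ.* 2 ℕ.+ 1
        shift : ∀ M L s → 4 ℕ.* M ℕ.+ (4 ℕ.* L ℕ.+ s) ≡ 4 ℕ.* (M ℕ.+ L) ℕ.+ s
        shift = solve-∀

      H-poly : ∀ L → PolyBelow (L ℕ.* 2 ℕ.+ 2) (H L)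
      H-poly zero    = poly-cong 2 {λ M → w 0 M * 1#} (λ M → *-identityʳ (w 0 M)) (w*-poly 0 1 {λ _ → 1#} (poly-const 1#))
      H-poly (suc L) = poly-+ (2 ℕ.+ d) {λ M → H L M * ι (M ℕ.+ suc L) ^ 2} {λ M → w (suc L) M * ratios (suc L) M}
        (poly-cong (2 ℕ.+ d) {λ M → ι (1 ℕ.* M ℕ.+ suc L) * (ι (1 ℕ.* M ℕ.+ suc L) * H L M)}
          (λ M → trans (solve 2 (λ x h → x :* (x :* h) := h :* (x :^ 2)) refl _ _)
            (*-congˡ (^-congˡ 2 (ι-cong (≡.cong (ℕ._+ suc L) (ℕₚ.*-identityˡ M))))))
          (poly-linear (1 ℕ.+ d) {λ M → ι (1 ℕ.* M ℕ.+ suc L) * H L M} (suc L) 1 (poly-linear d {H L} (suc L) 1 (H-poly L))))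
        (≡.subst (λ n → PolyBelow n (λ M → w (suc L) M * ratios (suc L) M)) (≡.sym (ℕₚ.+-suc (suc L ℕ.* 2) 1))
          (w*-poly (suc L) (suc L ℕ.* 2 ℕ.+ 1) {ratios (suc L)} (ratios-poly (suc L))))
        where
        open Solver
        d : ℕ
        d = L ℕ.* 2 ℕ.+ 2

      -- The degree is below `2I + 2`, so the zeros `M = 0, …, 2I + 1` suffice. For these
      -- `M + I ≤ 3I + 1`, which explains the hypothesis on `α`.
      H≈0 : ∀ M → H I M ≈ 0#
      H≈0 = poly-zero (I ℕ.* 2 ℕ.+ 2) {H I} (H-poly I) λ M M<2I+2 → vanish M
        (ℕₚ.≤-trans (ℕₚ.≤-pred (ℕₚ.≤-trans (ℕₚ.+-monoˡ-≤ I M<2I+2) (ℕₚ.≤-reflexive (collect I)))) 3I+1≤α)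
        where
        collect : ∀ I → I ℕ.* 2 ℕ.+ 2 ℕ.+ I ≡ suc (3 ℕ.* I ℕ.+ 1)
        collect = solve-∀
        vanish : ∀ M → M ℕ.+ I ≤ α → H I M ≈ 0#
        vanish M M+I≤α = *-zeroʳ⁻¹ (A≉0 (ℕₚ.≤-trans (ℕₚ.m≤m+n M I) M+I≤α))
          (trans (*-comm _ _) (trans (sym (S≈H I M M+I≤α)) (product-zero (inj₂ (equation-S M)))))

      H-at-root : ∀ {M} → ι (ratio M) ≈ 0# → ∀ L → H L M ≈ w 0 M * squares L M
      H-at-root {M} root zero    = sym (*-identityʳ (w 0 M))
      H-at-root {M} root (suc L) = trans (+-cong (*-congʳ (H-at-root root L)) (product-zero (inj₂ (ratios≈0 L))))
        (trans (+-identityʳ _) (*-assoc _ _ _))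
        where
        ratios≈0 : ∀ L → ratios (suc L) M ≈ 0#
        ratios≈0 zero    = product-zero (inj₂ (trans (ι-cong (≡.cong ratio (ℕₚ.+-identityʳ M))) root))
        ratios≈0 (suc L) = product-zero (inj₁ (ratios≈0 L))

      w-at-root : ∀ {M} → ι (ratio M) ≈ 0# → M ℕ.+ I < p → Q I * ι M + P I ≈ 0#
      w-at-root {M} root M+I<p = begin
        Q I * ι M + P I              ≈⟨ +-congʳ (*-congˡ (ι-cong (ℕₚ.+-identityʳ M))) ⟨
        w 0 M                        ≈⟨ *-zeroʳ⁻¹ (squares≉0 I M+I<p) (trans (*-comm _ _) (trans (sym (H-at-root root I)) (H≈0 M))) ⟩
        0#                           ∎
        where
        squares≉0 : ∀ L → M ℕ.+ L < p → ¬ (squares L M ≈ 0#)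
        squares≉0 zero    _     = 1≉0
        squares≉0 (suc L) M+L<p = *-≉0 (squares≉0 L (ℕₚ.<-trans (ℕₚ.+-monoʳ-< M (ℕₚ.n<1+n L)) M+L<p))
          (^-≉0 2 (ι≉0 (ℕₚ.≤-trans (s≤s z≤n) (ℕₚ.m≤n+m (suc L) M)) M+L<p))

      -- The linear function `Q I * x + P I` vanishes at the two roots `α` and `3α` of `ratio`,
      -- whose difference `2α` is nonzero modulo `p`. From `I ≤ α` follows `3α + I < p`, so no
      -- square that was cleared is divisible by `p`.
      top-zero : Q I ≈ 0# × P I ≈ 0#
      top-zero = Q≈0 , trans (sym (+-identityˡ (P I))) (trans (+-congʳ (sym (product-zero (inj₁ Q≈0)))) at-α)
        where
        I≤α : I ≤ α
        I≤α = ℕₚ.≤-trans (ℕₚ.≤-trans (ℕₚ.m≤n*m I 3) (ℕₚ.m≤m+n (3 ℕ.* I) 1)) 3I+1≤α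
        3α+I<p : 3 ℕ.* α ℕ.+ I < p
        3α+I<p = ℕₚ.≤-<-trans (ℕₚ.+-monoʳ-≤ (3 ℕ.* α) I≤α) (≡.subst (_< p) (ℕₚ.+-comm α (3 ℕ.* α)) 4α<p)
        at-α : Q I * ι α + P I ≈ 0#
        at-α = w-at-root (ratio-root {α} (inj₁ (trans (ι-cong (≡.trans (ℕₚ.+-comm (4 ℕ.* α) 1) p≡4α+1)) ι-p)))
          (ℕₚ.≤-<-trans (ℕₚ.+-monoˡ-≤ I (ℕₚ.m≤n*m α 3)) 3α+I<p)
        at-3α : Q I * ι (3 ℕ.* α) + P I ≈ 0#
        at-3α = w-at-root (ratio-root {3 ℕ.* α} (inj₂ (trans (ι-cong (≡.trans (triple α) (≡.cong (3 ℕ.*_) p≡4α+1))) (ι-multiple 3)))) 3α+I<p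
          where
          triple : ∀ α → 4 ℕ.* (3 ℕ.* α) ℕ.+ 3 ≡ 3 ℕ.* (1 ℕ.+ 4 ℕ.* α)
          triple = solve-∀
        Q≈0 : Q I ≈ 0#
        Q≈0 = *-zeroʳ⁻¹ (ι≉0 {2 ℕ.* α} (s≤s z≤n) (ℕₚ.≤-<-trans (ℕₚ.*-monoˡ-≤ α {2} {4} (s≤s (s≤s z≤n))) 4α<p)) (trans (*-comm _ _) (begin
          Q I * ι (2 ℕ.* α)                              ≈⟨ +-identityʳ _ ⟨
          Q I * ι (2 ℕ.* α) + 0#                         ≈⟨ +-congˡ at-α ⟨
          Q I * ι (2 ℕ.* α) + (Q I * ι α + P I)          ≈⟨ solve 4 (λ q a b c → q :* a :+ (q :* b :+ c) := q :* (b :+ a) :+ c) refl _ _ _ _ ⟩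
          Q I * (ι α + ι (2 ℕ.* α)) + P I                ≈⟨ +-congʳ (*-congˡ (ι-+ α (2 ℕ.* α))) ⟨
          Q I * ι (3 ℕ.* α) + P I                        ≈⟨ at-3α ⟩
          0#                                             ∎))
          where open Solver

    -- Descent on the degree bound: at each stage `top-zero` removes the highest possible
    -- coefficient of `Q` and of `P` simultaneously.
    no-small-ode : ∀ N {Q P} → 3 ℕ.* N ≤ α → Below N Q → Below N P → (Q ⊗ θ A) ⊕ (P ⊗ A) ≋ 0ˢ → Q ≋ 0ˢ
    no-small-ode zero    _    below-Q _       _        = pointwise (λ n → below-Q n z≤n)
    no-small-ode (suc I) {Q} {P} 3N≤α below-Q below-P equation =
      no-small-ode I (ℕₚ.≤-trans (ℕₚ.*-monoʳ-≤ 3 (ℕₚ.n≤1+n I)) 3N≤α)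
        (lower {Q} below-Q (proj₁ top-zero)) (lower {P} below-P (proj₂ top-zero)) equation
      where
      expand : ∀ I → 3 ℕ.* I ℕ.+ 1 ℕ.+ 2 ≡ 3 ℕ.* suc I
      expand = solve-∀
      open TopCoefficient I Q P below-Q below-P
        (ℕₚ.≤-trans (≡.subst (3 ℕ.* I ℕ.+ 1 ≤_) (expand I) (ℕₚ.m≤m+n _ 2)) 3N≤α) equation
        using (top-zero)
      lower : ∀ {x} → Below (suc I) x → x I ≈ 0# → Below I x
      lower b xI≈0 n I≤n with I ℕ.≟ n
      ... | yes ≡.refl = xI≈0
      ... | no  I≢n    = b n (ℕₚ.≤∧≢⇒< I≤n I≢n)

-- Inequivalence of the multipliers of the products of powers.

module Inequivalence (R : CommutativeRing 0ℓ 0ℓ) (isDomain : DecidableDomain R)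
  (p : ℕ) .{{_ : NonZero p}} (isChar : Characteristic R p)
  (t : ℕ) (t≢0 : t ≢ 0) (p≡ : suc (t ℕ.* 12 ℕ.+ 4) ≡ p) where
  open CommutativeRing R
  open Sums R
  open PowerSeriesRing R
  open Polynomials R
  open DomainPolynomials R isDomain
  open RingExtras R
  open RingExtras seriesRing using () renaming (ι to ιˢ; module Solver to SeriesSolver)
  open Characteristic isChar
  open PrimeCharacteristic R isDomain p isChar
  open Sequences R
  open Lucas R isDomain p isChar
  open Frobenius R p
  open DegreeA R isDomain p isChar using (degree-A)
  open DegreeB R isDomain p isChar using (degree-B)
  module LD = LogarithmicDerivative R isDomain p isChar
  open LD using (θ)

  A B : Series
  A = truncate seqA
  B = truncate seqB

  α β : ℕ
  α = 1 ℕ.+ 3 ℕ.* t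
  β = 3 ℕ.+ 10 ℕ.* t

  p≡4α+1 : 1 ℕ.+ 4 ℕ.* α ≡ p
  p≡4α+1 = LD.p≡4α+1 t p≡

  α<p : α < p
  α<p = LD.α<p t p≡

  hasDegree-A : HasDegree A α
  hasDegree-A = degree-A α α<p (LD.4α<p t p≡) (≡.subst (_≤ 4 ℕ.* suc α) p≡4α+1
    (≡.subst (1 ℕ.+ 4 ℕ.* α ≤_) (≡.sym (ℕₚ.*-suc 4 α)) (ℕₚ.+-monoˡ-≤ (4 ℕ.* α) {1} {4} (s≤s z≤n))))

  hasDegree-B : HasDegree B β
  hasDegree-B = degree-B t t≢0 p≡

  θ-cong : ∀ {x y} → x ≋ y → θ x ≋ θ y
  θ-cong e .at n = *-congˡ (at e n)

  θ-⊗ : ∀ x y → θ (x ⊗ y) ≋ (θ x ⊗ y) ⊕ (x ⊗ θ y)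
  θ-⊗ x y .at n = begin
    ι n * (x ⊗ y) n
      ≈⟨ ∑-*ˡ (suc n) (ι n) _ ⟨
    ∑ (suc n) (λ k → ι n * (x k * y (n ∸ k)))
      ≈⟨ ∑-cong (suc n) (λ k k≤n → trans (*-congʳ (trans (ι-cong (≡.sym (ℕₚ.m+[n∸m]≡n (ℕₚ.≤-pred k≤n)))) (ι-+ k (n ∸ k))))
           (solve 4 (λ a b x y → (a :+ b) :* (x :* y) := (a :* x) :* y :+ x :* (b :* y)) refl (ι k) (ι (n ∸ k)) (x k) (y (n ∸ k)))) ⟩
    ∑ (suc n) (λ k → θ x k * y (n ∸ k) + x k * θ y (n ∸ k))
      ≈⟨ ∑-+ (suc n) _ _ ⟩
    ((θ x ⊗ y) ⊕ (x ⊗ θ y)) n ∎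
    where
    open Solver
    open SetoidReasoning setoid

  θ-σ : ∀ x → θ (σ x) ≋ 0ˢ
  θ-σ x = by-residues step
    where
    step : ∀ r → r < p → Λ r (θ (σ x)) ≋ Λ r 0ˢ
    step zero    _   .at q = product-zero (inj₁ (ι-multiple q))
    step (suc r) r<p .at q = product-zero (inj₂ (σ-nonmultiple x (suc r) q (λ ()) r<p))

  θ-below : ∀ {N x} → Below N x → Below N (θ x)
  θ-below b n N≤n = product-zero (inj₂ (b n N≤n))

  open SetoidReasoning series-setoid

  θ-^ : ∀ x n → θ (x ^ˢ suc n) ≋ ιˢ (suc n) ⊗ (x ^ˢ n ⊗ θ x)
  θ-^ x n = begin
    θ (x ⊗ (x ^ˢ n))
      ≈⟨ θ-⊗ x (x ^ˢ n) ⟩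
    (θ x ⊗ (x ^ˢ n)) ⊕ (x ⊗ θ (x ^ˢ n))
      ≈⟨ ⊕-cong (≋-refl {θ x ⊗ (x ^ˢ n)}) (tail-power n) ⟩
    (θ x ⊗ (x ^ˢ n)) ⊕ (ιˢ n ⊗ (x ^ˢ n ⊗ θ x))
      ≈⟨ solve 3 (λ d e i → d :* e :+ i :* (e :* d) := (con 1 :+ i) :* (e :* d)) ≋-refl (θ x) (x ^ˢ n) (ιˢ n) ⟩
    ιˢ (suc n) ⊗ (x ^ˢ n ⊗ θ x) ∎
    where
    open SeriesSolver
    tail-power : ∀ n → x ⊗ θ (x ^ˢ n) ≋ ιˢ n ⊗ (x ^ˢ n ⊗ θ x)
    tail-power zero = ≋-trans (⊗-cong (≋-refl {x}) (pointwise θ1)) (≋-trans (⊗-zeroʳ x) (≋-sym (⊗-zeroˡ (1ˢ ⊗ θ x))))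
      where
      θ1 : ∀ n → θ 1ˢ n ≈ 0#
      θ1 zero    = zeroˡ 1#
      θ1 (suc n) = zeroʳ (ι (suc n))
    tail-power (suc n) = ≋-trans (⊗-cong (≋-refl {x}) (θ-^ x n))
      (solve 4 (λ x i e d → x :* (i :* (e :* d)) := i :* ((x :* e) :* d)) ≋-refl x (ιˢ (suc n)) (x ^ˢ n) (θ x))

  hasDegree-ιˢ : ∀ {i} → 0 < i → i < p → HasDegree (ιˢ i) 0
  hasDegree-ιˢ {i} 0<i i<p = (λ e → ι≉0 0<i i<p (trans (sym (constant i)) e)) , below i
    where
    constant : ∀ i → ιˢ i 0 ≈ ι i
    constant zero    = refl
    constant (suc i) = +-congˡ (constant i)
    below : ∀ i → Below 1 (ιˢ i)
    below zero    _ _ = refl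
    below (suc i) = below-⊕ {x = 1ˢ} {ιˢ i} below-1 (below i)

  hasDegree-below : ∀ {x d N} → HasDegree x d → d < N → Below N x
  hasDegree-below {x} (_ , b) d<N = below-mono {x = x} d<N b

  -- Applying θ, which kills σ x and σ y, turns the equation into a first order differential
  -- equation for A with coefficients of small degree.
  power-not-equivalent : ∀ {K x y d e} i → 3 ℕ.* (K ℕ.+ K) ≤ α → suc i < p → d < K → e < K →
    HasDegree x d → HasDegree y e → ¬ ((y ⊗ (A ^ˢ suc i)) ⊗ σ x ≋ x ⊗ σ y)
  power-not-equivalent {K} {x} {y} {d} {e} i 6K≤α i<p d<K e<K hx hy h =
    ¬hasDegree-0 (LD.no-small-ode t p≡ (K ℕ.+ K) {Q} {P} 6K≤α
      (hasDegree-below hQ (ℕₚ.+-mono-< d<K e<K))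
      (below-⊕ {x = x ⊗ θ y} {⊖ (θ x ⊗ y)} (below-⊗ {x = x} {θ y} below-x (θ-below {x = y} below-y))
        (below-⊖ {x = θ x ⊗ y} (below-⊗ {x = θ x} {y} (θ-below {x = x} below-x) below-y))) equation) hQ
    where
    open SeriesSolver
    E u Q P : Series
    E = A ^ˢ i
    u = y ⊗ (A ^ˢ suc i)
    Q = ιˢ (suc i) ⊗ (x ⊗ y)
    P = (x ⊗ θ y) ⊕ (⊖ (θ x ⊗ y))
    -- By `suc i < p` the exponent `i + 1` survives in characteristic `p`; without this the
    -- differential equation could be trivial.
    hQ : HasDegree Q (d ℕ.+ e)
    hQ = hasDegree-⊗ (hasDegree-ιˢ (s≤s z≤n) i<p) (hasDegree-⊗ hx hy)
    below-x : Below K x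
    below-x = hasDegree-below hx d<K
    below-y : Below K y
    below-y = hasDegree-below hy e<K
    hE : HasDegree E (i ℕ.* α)
    hE = hasDegree-^ hasDegree-A i
    below-A : Below (suc α) A
    below-A = proj₂ hasDegree-A

    differentiated : θ u ⊗ σ x ≋ θ x ⊗ σ y
    differentiated = begin
      θ u ⊗ σ x                      ≈⟨ differentiate u x ⟨
      θ (u ⊗ σ x)                    ≈⟨ θ-cong h ⟩
      θ (x ⊗ σ y)                    ≈⟨ differentiate x y ⟩
      θ x ⊗ σ y                      ∎
      where
      differentiate : ∀ v w → θ (v ⊗ σ w) ≋ θ v ⊗ σ w
      differentiate v w = ≋-trans (θ-⊗ v (σ w)) (≋-trans
        (⊕-cong (≋-refl {θ v ⊗ σ w}) (≋-trans (⊗-cong (≋-refl {v}) (θ-σ w)) (⊗-zeroʳ v)))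
        (CommutativeRing.+-identityʳ seriesRing (θ v ⊗ σ w)))

    below-u : Below (suc (e ℕ.+ (α ℕ.+ i ℕ.* α))) u
    below-u = proj₂ (hasDegree-⊗ hy (hasDegree-⊗ hasDegree-A hE))

    -- After multiplication by `x`, the original equation trades `x ⊗ σ y` for `u ⊗ σ x`; then `σ x`
    -- is a common factor.
    without-σ : x ⊗ θ u ≋ θ x ⊗ u
    without-σ = ⊗-cancelʳ {K ℕ.+ suc (e ℕ.+ (α ℕ.+ i ℕ.* α))} {x ⊗ θ u} {θ x ⊗ u} {σ x}
      (below-⊗ {x = x} {θ u} below-x (θ-below {x = u} below-u))
      (below-⊗ {x = θ x} {u} (θ-below {x = x} below-x) below-u) (σ-hasDegree hx) (begin
        (x ⊗ θ u) ⊗ σ x        ≈⟨ ⊗-assoc x (θ u) (σ x) ⟩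
        x ⊗ (θ u ⊗ σ x)        ≈⟨ ⊗-cong (≋-refl {x}) differentiated ⟩
        x ⊗ (θ x ⊗ σ y)        ≈⟨ x⊗yz≋y⊗xz x (θ x) (σ y) ⟩
        θ x ⊗ (x ⊗ σ y)        ≈⟨ ⊗-cong (≋-refl {θ x}) h ⟨
        θ x ⊗ (u ⊗ σ x)        ≈⟨ ⊗-assoc (θ x) u (σ x) ⟨
        (θ x ⊗ u) ⊗ σ x        ∎)

    -- Both `A ^ˢ suc i` and its derivative are divisible by `A ^ˢ i`. Cancelling it leaves an
    -- equation whose coefficients have degrees independent of `i`.
    without-E : (Q ⊗ θ A) ⊕ ((x ⊗ θ y) ⊗ A) ≋ (θ x ⊗ y) ⊗ A
    without-E = ⊗-cancelʳ {K ℕ.+ K ℕ.+ suc α} {(Q ⊗ θ A) ⊕ ((x ⊗ θ y) ⊗ A)} {(θ x ⊗ y) ⊗ A} {E}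
      (below-⊕ {x = Q ⊗ θ A} {(x ⊗ θ y) ⊗ A}
        (below-⊗ {x = Q} {θ A} (hasDegree-below hQ (ℕₚ.+-mono-< d<K e<K)) (θ-below {x = A} below-A))
        (below-⊗ {x = x ⊗ θ y} {A} (below-⊗ {x = x} {θ y} below-x (θ-below {x = y} below-y)) below-A))
      (below-⊗ {x = θ x ⊗ y} {A} (below-⊗ {x = θ x} {y} (θ-below {x = x} below-x) below-y) below-A) hE (begin
        ((Q ⊗ θ A) ⊕ ((x ⊗ θ y) ⊗ A)) ⊗ E
          ≈⟨ solve 7 (λ i x y A A′ y′ E → ((i :* (x :* y)) :* A′ :+ (x :* y′) :* A) :* E
               := x :* (y′ :* (A :* E) :+ y :* (i :* (E :* A′)))) ≋-refl (ιˢ (suc i)) x y A (θ A) (θ y) E ⟩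
        x ⊗ ((θ y ⊗ (A ⊗ E)) ⊕ (y ⊗ (ιˢ (suc i) ⊗ (E ⊗ θ A))))
          ≈⟨ ⊗-cong (≋-refl {x}) (≋-trans (⊕-cong (≋-refl {θ y ⊗ (A ⊗ E)}) (⊗-cong (≋-refl {y}) (≋-sym (θ-^ A i)))) (≋-sym (θ-⊗ y (A ⊗ E)))) ⟩
        x ⊗ θ u
          ≈⟨ without-σ ⟩
        θ x ⊗ (y ⊗ (A ⊗ E))
          ≈⟨ solve 4 (λ x′ y A E → x′ :* (y :* (A :* E)) := ((x′ :* y) :* A) :* E) ≋-refl (θ x) y A E ⟩
        ((θ x ⊗ y) ⊗ A) ⊗ E ∎)

    equation : (Q ⊗ θ A) ⊕ (P ⊗ A) ≋ 0ˢ
    equation = begin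
      (Q ⊗ θ A) ⊕ (P ⊗ A)
        ≈⟨ solve 5 (λ q a v w A → q :* a :+ (v :+ w) :* A := (q :* a :+ v :* A) :+ w :* A) ≋-refl Q (θ A) (x ⊗ θ y) (⊖ (θ x ⊗ y)) A ⟩
      ((Q ⊗ θ A) ⊕ ((x ⊗ θ y) ⊗ A)) ⊕ ((⊖ (θ x ⊗ y)) ⊗ A)
        ≈⟨ ⊕-cong without-E (≋-refl {(⊖ (θ x ⊗ y)) ⊗ A}) ⟩
      ((θ x ⊗ y) ⊗ A) ⊕ ((⊖ (θ x ⊗ y)) ⊗ A)
        ≈⟨ ⊗-distribʳ A (θ x ⊗ y) (⊖ (θ x ⊗ y)) ⟨
      ((θ x ⊗ y) ⊕ (⊖ (θ x ⊗ y))) ⊗ A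
        ≈⟨ ⊗-cong (CommutativeRing.-‿inverseʳ seriesRing (θ x ⊗ y)) (≋-refl {A}) ⟩
      0ˢ ⊗ A
        ≈⟨ ⊗-zeroˡ A ⟩
      0ˢ ∎

  multiplier : ℕ → ℕ → Series
  multiplier j k = (A ^ˢ j) ⊗ (B ^ˢ k)

  hasDegree-multiplier : ∀ j k → HasDegree (multiplier j k) (j ℕ.* α ℕ.+ k ℕ.* β)
  hasDegree-multiplier j k = hasDegree-⊗ (hasDegree-^ hasDegree-A j) (hasDegree-^ hasDegree-B k)

  -- p - 1 = 4α and 3β = 10α - 1.
  degrees-determine-k : ∀ {j k j′ k′ d e} → k < α → k′ < α →
    e ℕ.+ (j ℕ.* α ℕ.+ k ℕ.* β) ℕ.+ d ℕ.* p ≡ d ℕ.+ (j′ ℕ.* α ℕ.+ k′ ℕ.* β) ℕ.+ e ℕ.* p → k ≡ k′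
  degrees-determine-k {j} {k} {j′} {k′} {d} {e} k<α k′<α eq = ≡.sym (≡.trans (≡.sym (m<n⇒m%n≡m k′<α)) (≡.trans (≡.sym ([m+kn]%n≡m%n k′ X α))
    (≡.trans (≡.cong (_% α) X≡Y) (≡.trans ([m+kn]%n≡m%n k Y α) (m<n⇒m%n≡m k<α)))))
    where
    X Y : ℕ
    X = 3 ℕ.* j ℕ.+ 10 ℕ.* k ℕ.+ 12 ℕ.* d
    Y = 3 ℕ.* j′ ℕ.+ 10 ℕ.* k′ ℕ.+ 12 ℕ.* e
    -- Three times the degree equation, where `3β` becomes `10α - 1`: modulo `α` only `k` and `k′`
    -- remain. Adding `k + k′` to both sides avoids subtraction.
    X≡Y : k′ ℕ.+ X ℕ.* α ≡ k ℕ.+ Y ℕ.* α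
    X≡Y = ℕₚ.+-cancelʳ-≡ (3 ℕ.* (d ℕ.+ e)) _ _ (≡.trans (≡.sym (expand j k d e k′)) (≡.trans
      (≡.cong (λ n → 3 ℕ.* n ℕ.+ k ℕ.+ k′) eq′) (≡.trans (swap (d ℕ.+ (j′ ℕ.* α ℕ.+ k′ ℕ.* β) ℕ.+ e ℕ.* (1 ℕ.+ 4 ℕ.* α)) k k′)
        (≡.trans (expand j′ k′ e d k) (≡.cong (λ n → k ℕ.+ Y ℕ.* α ℕ.+ 3 ℕ.* n) (ℕₚ.+-comm e d))))))
      where
      eq′ : e ℕ.+ (j ℕ.* α ℕ.+ k ℕ.* β) ℕ.+ d ℕ.* (1 ℕ.+ 4 ℕ.* α) ≡ d ℕ.+ (j′ ℕ.* α ℕ.+ k′ ℕ.* β) ℕ.+ e ℕ.* (1 ℕ.+ 4 ℕ.* α)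
      eq′ = ≡.subst (λ n → e ℕ.+ (j ℕ.* α ℕ.+ k ℕ.* β) ℕ.+ d ℕ.* n ≡ d ℕ.+ (j′ ℕ.* α ℕ.+ k′ ℕ.* β) ℕ.+ e ℕ.* n) (≡.sym p≡4α+1) eq
      swap : ∀ x k k′ → 3 ℕ.* x ℕ.+ k ℕ.+ k′ ≡ 3 ℕ.* x ℕ.+ k′ ℕ.+ k
      swap = solve-∀
      expand : ∀ j k d e k′ → 3 ℕ.* (e ℕ.+ (j ℕ.* α ℕ.+ k ℕ.* β) ℕ.+ d ℕ.* (1 ℕ.+ 4 ℕ.* α)) ℕ.+ k ℕ.+ k′
        ≡ k′ ℕ.+ (3 ℕ.* j ℕ.+ 10 ℕ.* k ℕ.+ 12 ℕ.* d) ℕ.* α ℕ.+ 3 ℕ.* (d ℕ.+ e)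
      expand j k d e k′ = ≡.trans (collect j k d e k′ α β) (≡.trans
        (≡.cong (λ n → k′ ℕ.+ (3 ℕ.* j ℕ.+ 12 ℕ.* d) ℕ.* α ℕ.+ k ℕ.* n ℕ.+ 3 ℕ.* (d ℕ.+ e)) (3β+1≡10α t)) (collect′ j k d e k′ α))
        where
        collect : ∀ j k d e k′ α β → 3 ℕ.* (e ℕ.+ (j ℕ.* α ℕ.+ k ℕ.* β) ℕ.+ d ℕ.* (1 ℕ.+ 4 ℕ.* α)) ℕ.+ k ℕ.+ k′
          ≡ k′ ℕ.+ (3 ℕ.* j ℕ.+ 12 ℕ.* d) ℕ.* α ℕ.+ k ℕ.* (3 ℕ.* β ℕ.+ 1) ℕ.+ 3 ℕ.* (d ℕ.+ e)
        collect = solve-∀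
        collect′ : ∀ j k d e k′ α → k′ ℕ.+ (3 ℕ.* j ℕ.+ 12 ℕ.* d) ℕ.* α ℕ.+ k ℕ.* (10 ℕ.* α) ℕ.+ 3 ℕ.* (d ℕ.+ e)
          ≡ k′ ℕ.+ (3 ℕ.* j ℕ.+ 10 ℕ.* k ℕ.+ 12 ℕ.* d) ℕ.* α ℕ.+ 3 ℕ.* (d ℕ.+ e)
        collect′ = solve-∀
        3β+1≡10α : ∀ t → 3 ℕ.* (3 ℕ.+ 10 ℕ.* t) ℕ.+ 1 ≡ 10 ℕ.* (1 ℕ.+ 3 ℕ.* t)
        3β+1≡10α = solve-∀

  -- Degrees give `k ≡ k′`. The powers of `A` and `B` common to both sides then cancel, which leaves
  -- the case of a single power of `A`, with `x` and `y` exchanged when `j < j′`.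
  multipliers-inequivalent : ∀ {K j k j′ k′ x y d e} → 3 ℕ.* (K ℕ.+ K) ≤ α →
    j < α → k < α → j′ < α → k′ < α → ¬ (j ≡ j′ × k ≡ k′) → d < K → e < K →
    HasDegree x d → HasDegree y e →
    ¬ ((y ⊗ multiplier j k) ⊗ σ x ≋ (x ⊗ multiplier j′ k′) ⊗ σ y)
  multipliers-inequivalent {K} {j} {k} {j′} {k′} {x} {y} {d} {e} 6K≤α j<α k<α j′<α k′<α ≢′ d<K e<K hx hy h =
    conclude k≡k′ (ℕₚ.<-cmp j j′)
    where
    k≡k′ : k ≡ k′
    k≡k′ = degrees-determine-k {j} {k} {j′} {k′} {d} {e} k<α k′<α (hasDegree-unique
      (hasDegree-⊗ (hasDegree-⊗ hy (hasDegree-multiplier j k)) (σ-hasDegree hx))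
      (hasDegree-cong (≋-sym h) (hasDegree-⊗ (hasDegree-⊗ hx (hasDegree-multiplier j′ k′)) (σ-hasDegree hy))))

    cancel : ∀ {x y d e} j i k → suc (j ℕ.+ i) < α → d < K → e < K → HasDegree x d → HasDegree y e →
      ¬ ((y ⊗ multiplier (j ℕ.+ suc i) k) ⊗ σ x ≋ (x ⊗ multiplier j k) ⊗ σ y)
    cancel {x} {y} {d} {e} j i k j+i<α d<K e<K hx hy h = power-not-equivalent {K} {x} {y} i 6K≤α
      (ℕₚ.<-trans (ℕₚ.≤-<-trans (s≤s (ℕₚ.m≤n+m i j)) j+i<α) α<p) d<K e<K hx hy
      (⊗-cancelʳ {M ℕ.+ N} {(y ⊗ (A ^ˢ suc i)) ⊗ σ x} {x ⊗ σ y} {multiplier j k}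
        (λ n M+N≤n → proj₂ hl n (ℕₚ.≤-trans (ℕₚ.m≤m+n M N) M+N≤n))
        (λ n M+N≤n → proj₂ hr n (ℕₚ.≤-trans (ℕₚ.m≤n+m N M) M+N≤n))
        (hasDegree-multiplier j k) (begin
          ((y ⊗ (A ^ˢ suc i)) ⊗ σ x) ⊗ multiplier j k
            ≈⟨ solve 5 (λ y a x J k → ((y :* a) :* x) :* (J :* k) := (y :* ((J :* a) :* k)) :* x) ≋-refl y (A ^ˢ suc i) (σ x) (A ^ˢ j) (B ^ˢ k) ⟩
          (y ⊗ ((A ^ˢ j ⊗ A ^ˢ suc i) ⊗ (B ^ˢ k))) ⊗ σ x
            ≈⟨ ⊗-cong (⊗-cong (≋-refl {y}) (⊗-cong (≋-sym (^ˢ-homo-⊗ A j (suc i))) (≋-refl {B ^ˢ k}))) (≋-refl {σ x}) ⟩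
          (y ⊗ multiplier (j ℕ.+ suc i) k) ⊗ σ x
            ≈⟨ h ⟩
          (x ⊗ multiplier j k) ⊗ σ y
            ≈⟨ xy⊗z≋xz⊗y x (multiplier j k) (σ y) ⟩
          (x ⊗ σ y) ⊗ multiplier j k ∎))
      where
      open SeriesSolver
      hl : HasDegree ((y ⊗ (A ^ˢ suc i)) ⊗ σ x) (e ℕ.+ suc i ℕ.* α ℕ.+ d ℕ.* p)
      hl = hasDegree-⊗ (hasDegree-⊗ hy (hasDegree-^ hasDegree-A (suc i))) (σ-hasDegree hx)
      hr : HasDegree (x ⊗ σ y) (d ℕ.+ e ℕ.* p)
      hr = hasDegree-⊗ hx (σ-hasDegree hy)
      M N : ℕ
      M = suc (e ℕ.+ suc i ℕ.* α ℕ.+ d ℕ.* p)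
      N = suc (d ℕ.+ e ℕ.* p)

    suc-difference : ∀ {m n} → m < n → m ℕ.+ suc (n ∸ suc m) ≡ n
    suc-difference {m} {n} m<n = ≡.trans (ℕₚ.+-suc m _) (ℕₚ.m+[n∸m]≡n m<n)

    conclude : k ≡ k′ → _ → ⊥
    conclude ≡.refl (tri≈ _ j≡j′ _) = ≢′ (j≡j′ , ≡.refl)
    conclude ≡.refl (tri< j<j′ _ _) = cancel j (j′ ∸ suc j) k (≡.subst (_< α) (≡.sym (ℕₚ.m+[n∸m]≡n j<j′)) j′<α) e<K d<K hy hx
      (≡.subst (λ i → (x ⊗ multiplier i k) ⊗ σ y ≋ (y ⊗ multiplier j k) ⊗ σ x) (≡.sym (suc-difference j<j′)) (≋-sym h))
    conclude ≡.refl (tri> _ _ j′<j) = cancel j′ (j ∸ suc j′) k (≡.subst (_< α) (≡.sym (ℕₚ.m+[n∸m]≡n j′<j)) j<α) d<K e<K hx hy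
      (≡.subst (λ i → (y ⊗ multiplier i k) ⊗ σ x ≋ (x ⊗ multiplier j′ k) ⊗ σ y) (≡.sym (suc-difference j′<j)) h)

-- The field of p elements.

module IntegersModulo (p : ℕ) where
  open Int using (_+_; _*_; -_; _-_)

  infix 4 _≈_
  record _≈_ (a b : ℤ) : Set where
    constructor congruent
    field p∣a-b : + p ℤ∣.∣ a - b
  open _≈_ public

  ≡⇒≈ : ∀ {a b} → a ≡ b → a ≈ b
  ≡⇒≈ e = congruent (≡.subst (+ p ℤ∣.∣_) (≡.sym (ℤₚ.i≡j⇒i-j≡0 e)) (ℤ∣.divides (+ 0) ≡.refl))

  private
    sym-identity : ∀ a b → - (a - b) ≡ b - a
    sym-identity = ℤ-Solver.solve-∀
    trans-identity : ∀ a b c → (a - b) + (b - c) ≡ a - c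
    trans-identity = ℤ-Solver.solve-∀
    +-identity : ∀ a b c d → (a - b) + (c - d) ≡ (a + c) - (b + d)
    +-identity = ℤ-Solver.solve-∀
    *-identity : ∀ a b c d → (a - b) * c + b * (c - d) ≡ a * c - b * d
    *-identity = ℤ-Solver.solve-∀
    neg-identity : ∀ a b → - (a - b) ≡ - a - - b
    neg-identity = ℤ-Solver.solve-∀

  ≈-sym : ∀ {a b} → a ≈ b → b ≈ a
  ≈-sym {a} {b} (congruent d) = congruent (≡.subst (+ p ℤ∣.∣_) (sym-identity a b) (ℤ∣.∣m⇒∣-m d))

  ≈-trans : ∀ {a b c} → a ≈ b → b ≈ c → a ≈ c
  ≈-trans {a} {b} {c} (congruent d) (congruent d′) =
    congruent (≡.subst (+ p ℤ∣.∣_) (trans-identity a b c) (ℤ∣.∣m∣n⇒∣m+n d d′))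

  +-cong : ∀ {a b c d} → a ≈ b → c ≈ d → a + c ≈ b + d
  +-cong {a} {b} {c} {d} (congruent e) (congruent e′) =
    congruent (≡.subst (+ p ℤ∣.∣_) (+-identity a b c d) (ℤ∣.∣m∣n⇒∣m+n e e′))

  *-cong : ∀ {a b c d} → a ≈ b → c ≈ d → a * c ≈ b * d
  *-cong {a} {b} {c} {d} (congruent e) (congruent e′) =
    congruent (≡.subst (+ p ℤ∣.∣_) (*-identity a b c d) (ℤ∣.∣m∣n⇒∣m+n (ℤ∣.∣m⇒∣m*n c e) (ℤ∣.∣n⇒∣m*n b e′)))

  -‿cong : ∀ {a b} → a ≈ b → - a ≈ - b
  -‿cong {a} {b} (congruent e) = congruent (≡.subst (+ p ℤ∣.∣_) (neg-identity a b) (ℤ∣.∣m⇒∣-m e))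

  -- The carrier remains ℤ and only its equality is coarsened, so that reduction modulo `p` is the
  -- identity map.
  ring/p : CommutativeRing 0ℓ 0ℓ
  ring/p = record
    { Carrier = ℤ ; _≈_ = _≈_ ; _+_ = _+_ ; _*_ = _*_ ; -_ = -_ ; 0# = + 0 ; 1# = + 1
    ; isCommutativeRing = record
      { isRing = record
        { +-isAbelianGroup = record
          { isGroup = record
            { isMonoid = record
              { isSemigroup = record
                { isMagma = record
                  { isEquivalence = record { refl = ≡⇒≈ ≡.refl ; sym = ≈-sym ; trans = ≈-trans }
                  ; ∙-cong = +-cong }
                ; assoc = λ a b c → ≡⇒≈ (ℤₚ.+-assoc a b c) }
              ; identity = (λ a → ≡⇒≈ (ℤₚ.+-identityˡ a)) , (λ a → ≡⇒≈ (ℤₚ.+-identityʳ a)) }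
            ; inverse = (λ a → ≡⇒≈ (ℤₚ.+-inverseˡ a)) , (λ a → ≡⇒≈ (ℤₚ.+-inverseʳ a))
            ; ⁻¹-cong = -‿cong }
          ; comm = λ a b → ≡⇒≈ (ℤₚ.+-comm a b) }
        ; *-cong = *-cong
        ; *-assoc = λ a b c → ≡⇒≈ (ℤₚ.*-assoc a b c)
        ; *-identity = (λ a → ≡⇒≈ (ℤₚ.*-identityˡ a)) , (λ a → ≡⇒≈ (ℤₚ.*-identityʳ a))
        ; distrib = (λ a b c → ≡⇒≈ (ℤₚ.*-distribˡ-+ a b c)) , (λ a b c → ≡⇒≈ (ℤₚ.*-distribʳ-+ a b c)) }
      ; *-comm = λ a b → ≡⇒≈ (ℤₚ.*-comm a b) } }

  open RingExtras ring/p using (ι)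

  ι≡+ : ∀ n → ι n ≡ + n
  ι≡+ zero    = ≡.refl
  ι≡+ (suc n) = ≡.cong Int.suc (ι≡+ n)

  ≈0⇒∣ : ∀ {a} → a ≈ + 0 → p ∣ ∣ a ∣
  ≈0⇒∣ {a} (congruent d) = ℤ∣.∣⇒∣ᵤ (≡.subst (+ p ℤ∣.∣_) (ℤₚ.+-identityʳ a) d)

  ∣⇒≈0 : ∀ {a} → p ∣ ∣ a ∣ → a ≈ + 0
  ∣⇒≈0 {a} d = congruent (≡.subst (+ p ℤ∣.∣_) (≡.sym (ℤₚ.+-identityʳ a)) (ℤ∣.∣ᵤ⇒∣ d))

  ι≈0⇒∣ : ∀ {n} → ι n ≈ + 0 → p ∣ n
  ι≈0⇒∣ {n} e = ≈0⇒∣ (≡.subst (_≈ + 0) (ι≡+ n) e)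

  ∣⇒ι≈0 : ∀ {n} → p ∣ n → ι n ≈ + 0
  ∣⇒ι≈0 {n} d = ≡.subst (_≈ + 0) (≡.sym (ι≡+ n)) (∣⇒≈0 d)

  module _ (isPrime : Prime p) where

    isDomain : DecidableDomain ring/p
    isDomain = record
      { zero? = zero?
      ; noZeroDivisors = λ {a} {b} → noZeroDivisors {a} {b}
      ; 1≉0 = λ e → ¬prime[1] (≡.subst Prime (∣1⇒≡1 (≈0⇒∣ e)) isPrime) }
      where
      zero? : ∀ a → Dec (a ≈ + 0)
      zero? a with p ∣? ∣ a ∣
      ... | yes d = yes (∣⇒≈0 d)
      ... | no ¬d = no (¬d ∘ ≈0⇒∣)
      noZeroDivisors : ∀ {a b} → a * b ≈ + 0 → a ≈ + 0 ⊎ b ≈ + 0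
      noZeroDivisors {a} {b} e
        with euclidsLemma ∣ a ∣ ∣ b ∣ isPrime (≡.subst (p ∣_) (ℤₚ.abs-* a b) (≈0⇒∣ e))
      ... | inj₁ d = inj₁ (∣⇒≈0 d)
      ... | inj₂ d = inj₂ (∣⇒≈0 d)

    characteristic : Characteristic ring/p p
    characteristic = record
      { ι-p = ∣⇒ι≈0 ∣-refl
      ; ι≉0 = λ 0<k k<p e → >⇒∤ {{ℕ.>-nonZero 0<k}} k<p (ι≈0⇒∣ e) }

-- Arbitrarily large primes congruent to 5 modulo 12.

module NegativeOneNonSquare (R : CommutativeRing 0ℓ 0ℓ) (isDomain : DecidableDomain R)
  (p : ℕ) .{{_ : NonZero p}} (isChar : Characteristic R p) where
  open CommutativeRing R
  open DecidableDomain isDomain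
  open Characteristic isChar
  open RingExtras R
  open DomainExtras R isDomain
  open Polynomials R using (product-zero)
  open PrimeCharacteristic R isDomain p isChar using (fermat)
  open RingProperties ring using (+-cancelʳ)
  open SetoidReasoning setoid
  open Solver

  -- If `x² = -1`, then `x⁴ = 1`, so `x^p = x³` for `p ≡ 3` modulo 4, and Fermat gives `x³ = x`.
  -- Hence `2x = x³ + x = x (x² + 1) = 0`, which contradicts `x² = -1`.
  x²+1≉0 : ∀ k x → 3 ℕ.+ k ℕ.* 4 ≡ p → ¬ (ι (suc (x ℕ.* x)) ≈ 0#)
  x²+1≉0 k x p≡ x²+1≈0 = 1≉0 (begin
    1#                   ≈⟨ +-identityʳ 1# ⟨
    1# + 0#              ≈⟨ +-congˡ (product-zero (inj₁ x≈0)) ⟨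
    1# + y               ≈⟨ +-comm _ _ ⟩
    y + 1#               ≈⟨ y+1≈0 ⟩
    0#                   ∎)
    where
    y : Carrier
    y = ι x * ι x
    y+1≈0 : y + 1# ≈ 0#
    y+1≈0 = trans (+-comm y 1#) (trans (+-congˡ (sym (ι-* x x))) x²+1≈0)
    y²≈1 : y * y ≈ 1#
    y²≈1 = +-cancelʳ y _ _ (begin
      y * y + y          ≈⟨ +-congˡ (*-identityʳ y) ⟨
      y * y + y * 1#     ≈⟨ distribˡ y y 1# ⟨
      y * (y + 1#)       ≈⟨ product-zero (inj₂ y+1≈0) ⟩
      0#                 ≈⟨ trans (+-comm 1# y) y+1≈0 ⟨
      1# + y             ∎)
    x⁴≈1 : ι x ^ 4 ≈ 1#
    x⁴≈1 = trans (solve 1 (λ a → a :^ 4 := (a :* a) :* (a :* a)) refl (ι x)) y²≈1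
    x^4k≈1 : ∀ k → ι x ^ (k ℕ.* 4) ≈ 1#
    x^4k≈1 zero    = refl
    x^4k≈1 (suc k) = trans (^-homo-* (ι x) 4 (k ℕ.* 4)) (trans (*-cong x⁴≈1 (x^4k≈1 k)) (*-identityˡ 1#))
    x³≈x : ι x ^ 3 ≈ ι x
    x³≈x = begin
      ι x ^ 3                          ≈⟨ *-identityʳ _ ⟨
      ι x ^ 3 * 1#                     ≈⟨ *-congˡ (x^4k≈1 k) ⟨
      ι x ^ 3 * ι x ^ (k ℕ.* 4)        ≈⟨ ^-homo-* (ι x) 3 (k ℕ.* 4) ⟨
      ι x ^ (3 ℕ.+ k ℕ.* 4)            ≡⟨ ≡.cong (ι x ^_) p≡ ⟩
      ι x ^ p                          ≈⟨ fermat x ⟩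
      ι x                              ∎
    x≈0 : ι x ≈ 0#
    x≈0 = *-zeroʳ⁻¹ (ι≉0 {2} (s≤s z≤n) (≡.subst (2 <_) p≡ (s≤s (s≤s (s≤s z≤n))))) (begin
      ι 2 * ι x                        ≈⟨ trans (*-congʳ (+-congˡ ι-1)) (solve 1 (λ a → (con 1 :+ con 1) :* a := a :+ a) refl (ι x)) ⟩
      ι x + ι x                        ≈⟨ +-congʳ x³≈x ⟨
      ι x ^ 3 + ι x                    ≈⟨ solve 1 (λ a → a :^ 3 :+ a := a :* (a :* a :+ con 1)) refl (ι x) ⟩
      ι x * (y + 1#)                   ≈⟨ *-congˡ y+1≈0 ⟩
      ι x * 0#                         ≈⟨ zeroʳ (ι x) ⟩
      0#                               ∎)

-- The residue 1 is closed under products and a factor of residue 0 would make the whole product 0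
-- modulo 3, so some prime factor has residue 2.
prime-divisor-2-mod-3 : ∀ n .{{_ : NonZero n}} → n % 3 ≡ 2 → ∃ λ q → Prime q × q ∣ n × q % 3 ≡ 2
prime-divisor-2-mod-3 n n%3≡2 with search factors factorsPrime (≡.trans (≡.cong (_% 3) (≡.sym isFactorisation)) n%3≡2)
  where
  open PrimeFactorisation (factorise n)
  search : ∀ qs → All Prime qs → product qs % 3 ≡ 2 → ∃ λ q → Prime q × q ∣ product qs × q % 3 ≡ 2
  search (q ∷ qs) (isPrime ∷ arePrime) e with q % 3 in eq | ≡.trans (≡.sym (%-distribˡ-* q (product qs) 3)) e | m%n<n q 3
  ... | 2 | _ | _ = q , isPrime , m∣m*n (product qs) , eq
  ... | 1 | e′ | _ with search qs arePrime (≡.trans (≡.sym (≡.trans (≡.cong (_% 3) (ℕₚ.+-identityʳ (product qs % 3)))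
                          (m<n⇒m%n≡m (m%n<n (product qs) 3)))) e′)
  ...   | q′ , isPrime′ , d , e″ = q′ , isPrime′ , ∣n⇒∣m*n q d , e″
  search (q ∷ qs) (isPrime ∷ arePrime) e | suc (suc (suc _)) | _ | s≤s (s≤s (s≤s ()))
... | q , isPrime , d , e = q , isPrime , ≡.subst (q ∣_) (≡.sym isFactorisation) d , e
  where open PrimeFactorisation (factorise n)

-- The factors are squared to make the product 1 mod 3.
squares-2-mod-3 : ℕ → ℕ
squares-2-mod-3 zero    = 1
squares-2-mod-3 (suc n) = (2 ℕ.+ 3 ℕ.* n) ℕ.* (2 ℕ.+ 3 ℕ.* n) ℕ.* squares-2-mod-3 n

squares-divisible : ∀ {i} n → i < n → 2 ℕ.+ 3 ℕ.* i ∣ squares-2-mod-3 n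
squares-divisible {i} (suc n) i≤n with i ℕ.≟ n
... | yes ≡.refl = ∣m⇒∣m*n (squares-2-mod-3 n) (m∣m*n (2 ℕ.+ 3 ℕ.* n))
... | no  i≢n    = ∣n⇒∣m*n ((2 ℕ.+ 3 ℕ.* n) ℕ.* (2 ℕ.+ 3 ℕ.* n)) (squares-divisible n (ℕₚ.≤∧≢⇒< (ℕₚ.≤-pred i≤n) i≢n))

squares-1-mod-3 : ∀ n → ∃ λ m → squares-2-mod-3 n ≡ 1 ℕ.+ m ℕ.* 3
squares-1-mod-3 zero = 0 , ≡.refl
squares-1-mod-3 (suc n) with squares-1-mod-3 n
... | m , e = 1 ℕ.+ 4 ℕ.* n ℕ.+ 3 ℕ.* n ℕ.* n ℕ.+ (2 ℕ.+ 3 ℕ.* n) ℕ.* (2 ℕ.+ 3 ℕ.* n) ℕ.* m , ≡.trans (≡.cong ((2 ℕ.+ 3 ℕ.* n) ℕ.* (2 ℕ.+ 3 ℕ.* n) ℕ.*_) e) (expand n m)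
  where
  expand : ∀ n m → (2 ℕ.+ 3 ℕ.* n) ℕ.* (2 ℕ.+ 3 ℕ.* n) ℕ.* (1 ℕ.+ m ℕ.* 3)
    ≡ 1 ℕ.+ (1 ℕ.+ 4 ℕ.* n ℕ.+ 3 ℕ.* n ℕ.* n ℕ.+ (2 ℕ.+ 3 ℕ.* n) ℕ.* (2 ℕ.+ 3 ℕ.* n) ℕ.* m) ℕ.* 3
  expand = solve-∀

-- From `x ≡ 1` follows `x² + 1 ≡ 2` modulo 3, which supplies a prime divisor `2 + 3i`. If `i < b`,
-- it would divide `x` as well, hence 1.
large-prime-divisor : ∀ b x m → (∀ {i} → i < b → 2 ℕ.+ 3 ℕ.* i ∣ x) → x ≡ 1 ℕ.+ m ℕ.* 3 →
  ∃ λ i → b ≤ i × Prime (2 ℕ.+ 3 ℕ.* i) × 2 ℕ.+ 3 ℕ.* i ∣ suc (x ℕ.* x)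
large-prime-divisor b x m divisible x≡1+3m = conclude (prime-divisor-2-mod-3 (suc (x ℕ.* x)) N%3≡2)
  where
  expand : ∀ m → suc ((1 ℕ.+ m ℕ.* 3) ℕ.* (1 ℕ.+ m ℕ.* 3)) ≡ 2 ℕ.+ (2 ℕ.* m ℕ.+ 3 ℕ.* m ℕ.* m) ℕ.* 3
  expand = solve-∀
  N%3≡2 : suc (x ℕ.* x) % 3 ≡ 2
  N%3≡2 = ≡.trans (≡.cong (λ x → suc (x ℕ.* x) % 3) x≡1+3m)
    (≡.trans (≡.cong (_% 3) (expand m)) ([m+kn]%n≡m%n 2 (2 ℕ.* m ℕ.+ 3 ℕ.* m ℕ.* m) 3))

  not-dividing : ∀ {d} → Prime d → d ∣ suc (x ℕ.* x) → ¬ (d ∣ x)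
  not-dividing {d} isPrime d∣N d∣x = ¬prime[1] (≡.subst Prime (∣1⇒≡1
    (∣m+n∣m⇒∣n (≡.subst (d ∣_) (ℕₚ.+-comm 1 (x ℕ.* x)) d∣N) (∣m⇒∣m*n x d∣x))) isPrime)

  conclude : (∃ λ q → Prime q × q ∣ suc (x ℕ.* x) × q % 3 ≡ 2) →
    ∃ λ i → b ≤ i × Prime (2 ℕ.+ 3 ℕ.* i) × 2 ℕ.+ 3 ℕ.* i ∣ suc (x ℕ.* x)
  conclude (q , isPrime , q∣N , q%3≡2) = i , ℕₚ.≮⇒≥ (λ i<b → not-dividing isPrime′ q∣N′ (divisible i<b)) , isPrime′ , q∣N′
    where
    i : ℕ
    i = q / 3
    q≡2+3i : q ≡ 2 ℕ.+ 3 ℕ.* i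
    q≡2+3i = ≡.trans (m≡m%n+[m/n]*n q 3) (≡.cong₂ ℕ._+_ q%3≡2 (ℕₚ.*-comm i 3))
    isPrime′ : Prime (2 ℕ.+ 3 ℕ.* i)
    isPrime′ = ≡.subst Prime q≡2+3i isPrime
    q∣N′ : 2 ℕ.+ 3 ℕ.* i ∣ suc (x ℕ.* x)
    q∣N′ = ≡.subst (_∣ suc (x ℕ.* x)) q≡2+3i q∣N

-- Cases on `i` modulo 4: residues 0 and 2 make `q` even, which `0 < i` excludes, and residue 3
-- gives `q ≡ 3` modulo 4, where -1 is not a square.
residue-5-mod-12 : ∀ {q x} i → q ≡ 2 ℕ.+ 3 ℕ.* i → 0 < i → Prime q → q ∣ suc (x ℕ.* x) → ∃ λ t → q ≡ suc (t ℕ.* 12 ℕ.+ 4)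
residue-5-mod-12 {q} {x} i q≡2+3i 0<i isPrime q∣x²+1 = by-residue (i % 4) ≡.refl
  where
  open IntegersModulo q using (ring/p; isDomain; characteristic; ∣⇒ι≈0)
  s : ℕ
  s = i / 4
  q≡ : ∀ {r} → i % 4 ≡ r → q ≡ 2 ℕ.+ 3 ℕ.* (r ℕ.+ s ℕ.* 4)
  q≡ e = ≡.trans q≡2+3i (≡.cong (λ i → 2 ℕ.+ 3 ℕ.* i) (≡.trans (m≡m%n+[m/n]*n i 4) (≡.cong (ℕ._+ s ℕ.* 4) e)))
  odd : ∀ k → q ≢ k ℕ.* 2
  odd k q≡2k with prime⇒irreducible isPrime (divides k q≡2k)
  ... | inj₂ 2≡q = ℕₚ.<⇒≢ (ℕₚ.m<m+n 2 {3 ℕ.* i} (ℕₚ.≤-trans 0<i (ℕₚ.m≤n*m i 3))) (≡.trans 2≡q q≡2+3i)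
  even₀ : ∀ s → 2 ℕ.+ 3 ℕ.* (0 ℕ.+ s ℕ.* 4) ≡ (1 ℕ.+ 6 ℕ.* s) ℕ.* 2
  even₀ = solve-∀
  even₂ : ∀ s → 2 ℕ.+ 3 ℕ.* (2 ℕ.+ s ℕ.* 4) ≡ (4 ℕ.+ 6 ℕ.* s) ℕ.* 2
  even₂ = solve-∀
  residue₁ : ∀ s → 2 ℕ.+ 3 ℕ.* (1 ℕ.+ s ℕ.* 4) ≡ suc (s ℕ.* 12 ℕ.+ 4)
  residue₁ = solve-∀
  residue₃ : ∀ s → 2 ℕ.+ 3 ℕ.* (3 ℕ.+ s ℕ.* 4) ≡ 3 ℕ.+ (2 ℕ.+ 3 ℕ.* s) ℕ.* 4
  residue₃ = solve-∀

  by-residue : ∀ r → i % 4 ≡ r → ∃ λ t → q ≡ suc (t ℕ.* 12 ℕ.+ 4)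
  by-residue 0 e = ⊥-elim (odd (1 ℕ.+ 6 ℕ.* s) (≡.trans (q≡ e) (even₀ s)))
  by-residue 1 e = s , ≡.trans (q≡ e) (residue₁ s)
  by-residue 2 e = ⊥-elim (odd (4 ℕ.+ 6 ℕ.* s) (≡.trans (q≡ e) (even₂ s)))
  by-residue 3 e = ⊥-elim (NegativeOneNonSquare.x²+1≉0 ring/p (isDomain isPrime) q {{prime⇒nonZero isPrime}} (characteristic isPrime)
    (2 ℕ.+ 3 ℕ.* s) x (≡.sym (≡.trans (q≡ e) (residue₃ s))) (∣⇒ι≈0 q∣x²+1))
  by-residue (suc (suc (suc (suc r)))) e with ≡.subst (_< 4) e (m%n<n i 4)
  ... | s≤s (s≤s (s≤s (s≤s ())))

primes-5-mod-12 : ∀ n → ∃ λ t → n ≤ t × Prime (suc (t ℕ.* 12 ℕ.+ 4))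
primes-5-mod-12 n = search (squares-2-mod-3 b) (proj₁ (squares-1-mod-3 b)) (squares-divisible b) (proj₂ (squares-1-mod-3 b))
  where
  b : ℕ
  -- Chosen so that `2 + 3b` is `12n + 5`; then `i ≥ b` translates into `t ≥ n`.
  b = suc (n ℕ.* 4)
  expand : ∀ n → 2 ℕ.+ 3 ℕ.* suc (n ℕ.* 4) ≡ suc (n ℕ.* 12 ℕ.+ 4)
  expand = solve-∀
  search : ∀ x m → (∀ {i} → i < b → 2 ℕ.+ 3 ℕ.* i ∣ x) → x ≡ 1 ℕ.+ m ℕ.* 3 → ∃ λ t → n ≤ t × Prime (suc (t ℕ.* 12 ℕ.+ 4))
  search x m divisible x≡1+3m =
    let i , b≤i , isPrime , q∣x²+1 = large-prime-divisor b x m divisible x≡1+3m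
        t , q≡ = residue-5-mod-12 {x = x} i ≡.refl (ℕₚ.≤-trans (s≤s z≤n) b≤i) isPrime q∣x²+1
    in t , ℕₚ.*-cancelʳ-≤ n t 12 (ℕₚ.+-cancelʳ-≤ 4 (n ℕ.* 12) (t ℕ.* 12) (ℕₚ.≤-pred
             (≡.subst₂ _≤_ (expand n) q≡ (ℕₚ.+-monoʳ-≤ 2 (ℕₚ.*-monoʳ-≤ 3 b≤i)))))
         , ≡.subst Prime q≡ isPrime

-- Evaluation of polynomial relations and its transport along ring homomorphisms.

module Evaluation (R : CommutativeRing 0ℓ 0ℓ) where
  open CommutativeRing R
  open Sums R
  open PowerSeriesRing R
  open Polynomials R

  monomial : ℕ → Series
  monomial i n with n ℕ.≟ i
  ... | yes _ = 1#
  ... | no  _ = 0#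

  -- `evalPoly` over an arbitrary ring, so that one relation can be read over ℚ, over ℤ and modulo
  -- `p`.
  evaluate : ℕ → (ℕ → ℕ → ℕ → Carrier) → Series → Series → Series
  evaluate D c f g n =
    ∑ D λ i → ∑ D λ j → ∑ D λ k → c i j k * (monomial i ⊗ ((f ^ˢ j) ⊗ (g ^ˢ k))) n

module Homomorphism (R R′ : CommutativeRing 0ℓ 0ℓ) where
  private
    module R = CommutativeRing R
    module R′ = CommutativeRing R′
    module S = Sums R
    module S′ = Sums R′
    module P = PowerSeriesRing R
    module P′ = PowerSeriesRing R′
    module X = RingExtras R
    module X′ = RingExtras R′
    module E = Evaluation R
    module E′ = Evaluation R′
    module Q = Sequences R
    module Q′ = Sequences R′
  open Polynomials R using () renaming (_^ˢ_ to _^₁_)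
  open Polynomials R′ using () renaming (_^ˢ_ to _^₂_)
  open R′

  -- Instantiated with the embedding `φ` of ℤ into ℚ and with the identity from ℤ to `ring/p`.
  module _ (h : R.Carrier → Carrier) (h-cong : ∀ {a b} → a R.≈ b → h a ≈ h b)
    (h-+ : ∀ a b → h (a R.+ b) ≈ h a + h b) (h-* : ∀ a b → h (a R.* b) ≈ h a * h b)
    (h-0 : h R.0# ≈ 0#) (h-1 : h R.1# ≈ 1#) where

    h-∑ : ∀ n f → h (S.∑ n f) ≈ S′.∑ n (h ∘ f)
    h-∑ zero    f = h-0
    h-∑ (suc n) f = trans (h-+ (S.∑ n f) (f n)) (+-congʳ (h-∑ n f))

    h-⊗ : ∀ {x y x′ y′} → (∀ n → h (x n) ≈ x′ n) → (∀ n → h (y n) ≈ y′ n) →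
      ∀ n → h ((x P.⊗ y) n) ≈ (x′ P′.⊗ y′) n
    h-⊗ {x} {y} e e′ n = trans (h-∑ (suc n) (λ k → x k R.* y (n ∸ k))) (S′.∑-cong (suc n)
      (λ k _ → trans (h-* (x k) (y (n ∸ k))) (*-cong (e k) (e′ (n ∸ k)))))

    h-^ˢ : ∀ {x x′} → (∀ n → h (x n) ≈ x′ n) → ∀ j n → h ((x ^₁ j) n) ≈ (x′ ^₂ j) n
    h-^ˢ e zero    zero    = h-1
    h-^ˢ e zero    (suc n) = h-0
    h-^ˢ {x} {x′} e (suc j) n = h-⊗ {x} {x ^₁ j} {x′} {x′ ^₂ j} e (h-^ˢ e j) n

    h-monomial : ∀ i n → h (E.monomial i n) ≈ E′.monomial i n
    h-monomial i n with n ℕ.≟ i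
    ... | yes _ = h-1
    ... | no  _ = h-0

    h-evaluate : ∀ D {c c′ f f′ g g′} →
      (∀ i j k → i < D → j < D → k < D → h (c i j k) ≈ c′ i j k) →
      (∀ n → h (f n) ≈ f′ n) → (∀ n → h (g n) ≈ g′ n) →
      ∀ n → h (E.evaluate D c f g n) ≈ E′.evaluate D c′ f′ g′ n
    h-evaluate D {c} {c′} {f} {f′} {g} {g′} ec ef eg n =
      trans (h-∑ D _) (S′.∑-cong D λ i i<D → trans (h-∑ D _) (S′.∑-cong D λ j j<D →
        trans (h-∑ D _) (S′.∑-cong D λ k k<D → trans (h-* (c i j k) _) (*-cong (ec i j k i<D j<D k<D)
          (h-⊗ {E.monomial i} {(f ^₁ j) P.⊗ (g ^₁ k)} {E′.monomial i} {(f′ ^₂ j) P′.⊗ (g′ ^₂ k)} (h-monomial i)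
            (h-⊗ {f ^₁ j} {g ^₁ k} {f′ ^₂ j} {g′ ^₂ k} (h-^ˢ ef j) (h-^ˢ eg k)) n)))))

    h-ι : ∀ n → h (X.ι n) ≈ X′.ι n
    h-ι zero    = h-0
    h-ι (suc n) = trans (h-+ R.1# (X.ι n)) (+-cong h-1 (h-ι n))

    h-^ : ∀ {a a′} → h a ≈ a′ → ∀ k → h (a X.^ k) ≈ a′ X′.^ k
    h-^     e zero    = h-1
    h-^ {a} e (suc k) = trans (h-* a (a X.^ k)) (*-cong e (h-^ e k))

    h-seqA : ∀ n → h (Q.seqA n) ≈ Q′.seqA n
    h-seqA n = trans (h-* (X.ι ((4 ℕ.* n) C (2 ℕ.* n))) (X.ι ((2 ℕ.* n) C n)))
      (*-cong (h-ι ((4 ℕ.* n) C (2 ℕ.* n))) (h-ι ((2 ℕ.* n) C n)))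

    h-seqB : ∀ n → h (Q.seqB n) ≈ Q′.seqB n
    h-seqB n = trans (h-∑ (suc n) (λ k → X.ι (n C k) X.^ 6)) (S′.∑-cong (suc n) (λ k _ → h-^ (h-ι (n C k)) 6))

-- The coefficients start with degree at most 2D, which doubles in each of the D² steps of the descent.
degreeBound : ℕ → ℕ
degreeBound D = suc (D ℕ.+ D) ℕ.* 2 ℕ.^ (D ℕ.* D)

-- Independence modulo a single large prime.

module ModularIndependence (R : CommutativeRing 0ℓ 0ℓ) (isDomain : DecidableDomain R)
  (p : ℕ) .{{_ : NonZero p}} (isChar : Characteristic R p)
  (t : ℕ) (p≡ : suc (t ℕ.* 12 ℕ.+ 4) ≡ p)
  (D : ℕ) .{{_ : NonZero D}} (large : degreeBound D ℕ.+ degreeBound D ≤ t) where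
  open CommutativeRing R
  open Sums R
  open PowerSeriesRing R
  open Polynomials R
  open Evaluation R
  open Sequences R
  open Frobenius R p
  open Lucas R isDomain p isChar

  private
    K N S : ℕ
    K = degreeBound D
    N = suc (D ℕ.+ D)
    S = D ℕ.* D

  N≤K : N ≤ K
  N≤K = ℕₚ.m≤m*n N (2 ℕ.^ S) {{ℕₚ.m^n≢0 2 S}}

  K≤t : K ≤ t
  K≤t = ℕₚ.≤-trans (ℕₚ.m≤m+n K K) large

  t≢0 : t ≢ 0
  t≢0 t≡0 with ≡.subst (N ≤_) t≡0 (ℕₚ.≤-trans N≤K K≤t)
  ... | ()

  open Inequivalence R isDomain p isChar t t≢0 p≡

  t<α : t < α
  t<α = s≤s (ℕₚ.m≤n*m t 3)

  D<α : D < α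
  D<α = ℕₚ.≤-<-trans (ℕₚ.≤-trans (ℕₚ.≤-trans (ℕₚ.m≤m+n D D) (ℕₚ.n≤1+n _)) (ℕₚ.≤-trans N≤K K≤t)) t<α

  -- The differential equation has products of two polynomials below `K` as coefficients, hence the
  -- bound `K + K`, and `no-small-ode` asks for three times its bound.
  6K≤α : 3 ℕ.* (K ℕ.+ K) ≤ α
  6K≤α = ℕₚ.≤-trans (ℕₚ.*-monoʳ-≤ 3 large) (ℕₚ.n≤1+n _)

  K<p : K < p
  K<p = ℕₚ.≤-<-trans K≤t (ℕₚ.<-trans t<α α<p)

  β≤p : β ≤ p
  β≤p = ≡.subst (β ≤_) (≡.trans (expand t) p≡) (ℕₚ.m≤m+n β (2 ℕ.+ 2 ℕ.* t))
    where
    expand : ∀ t → 3 ℕ.+ 10 ℕ.* t ℕ.+ (2 ℕ.+ 2 ℕ.* t) ≡ suc (t ℕ.* 12 ℕ.+ 4)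
    expand = solve-∀

  Eigen : Series → Series → Set
  Eigen a f = f ≋ a ⊗ σ f

  eigen-⊗ : ∀ {a b f g} → Eigen a f → Eigen b g → Eigen (a ⊗ b) (f ⊗ g)
  eigen-⊗ {a} {b} {f} {g} e e′ = ≋-trans (⊗-cong e e′) (≋-trans (⊗-interchange a (σ f) b (σ g))
    (⊗-cong (≋-refl {a ⊗ b}) (≋-sym (σ-⊗ f g))))

  eigen-^ : ∀ {a f} → Eigen a f → ∀ j → Eigen (a ^ˢ j) (f ^ˢ j)
  eigen-^ e zero    = ≋-sym (≋-trans (⊗-identityˡ (σ 1ˢ)) σ-1)
  eigen-^ e (suc j) = eigen-⊗ e (eigen-^ e j)

  unit-⊗ : ∀ {x y} → x 0 ≈ 1# → y 0 ≈ 1# → (x ⊗ y) 0 ≈ 1#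
  unit-⊗ e e′ = trans (+-identityˡ _) (trans (*-cong e e′) (*-identityˡ 1#))

  unit-^ : ∀ {x} → x 0 ≈ 1# → ∀ j → (x ^ˢ j) 0 ≈ 1#
  unit-^ e zero    = refl
  unit-^ {x} e (suc j) = unit-⊗ {x} {x ^ˢ j} e (unit-^ e j)

  product-series : ℕ → ℕ → Series
  product-series j k = (seqA ^ˢ j) ⊗ (seqB ^ˢ k)

  -- The Kummer argument wants a linearly ordered family, so the pair `(j, k)` is numbered
  -- `m = k + j D`.
  u a : ℕ → Series
  u m = product-series (m / D) (m % D)
  a m = multiplier (m / D) (m % D)

  -- Both `α` and `β` are at most `p` and both exponents are below `D`; this is the origin of
  -- `D + D` in `degreeBound`.
  a-below : ∀ m → m < S → Below ((D ℕ.+ D) ℕ.* p ℕ.+ 1) (a m)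
  a-below m m<S = below-mono {x = a m} bound (proj₂ (hasDegree-multiplier (m / D) (m % D)))
    where
    bound : suc (m / D ℕ.* α ℕ.+ m % D ℕ.* β) ≤ (D ℕ.+ D) ℕ.* p ℕ.+ 1
    bound = ℕₚ.≤-trans (s≤s (ℕₚ.≤-trans (ℕₚ.+-mono-≤ (ℕₚ.*-mono-≤ (ℕₚ.<⇒≤ (m<n*o⇒m/o<n {m} {D} {D} m<S)) (ℕₚ.<⇒≤ α<p))
                                                    (ℕₚ.*-mono-≤ (ℕₚ.<⇒≤ (m%n<n m D)) β≤p))
      (ℕₚ.≤-reflexive (≡.sym (ℕₚ.*-distribʳ-+ p D D))))) (ℕₚ.≤-reflexive (ℕₚ.+-comm 1 _))

  inequivalent : ∀ {m n x y d e} → m < S → n < S → m ≢ n → d < K → e < K →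
    HasDegree x d → HasDegree y e → ¬ ((y ⊗ a n) ⊗ σ x ≋ (x ⊗ a m) ⊗ σ y)
  inequivalent {m} {n} {x} {y} m<S n<S m≢n = multipliers-inequivalent {K} {n / D} {n % D} {m / D} {m % D} {x} {y} 6K≤α
    (index<α n<S) (ℕₚ.<-trans (m%n<n n D) D<α) (index<α m<S) (ℕₚ.<-trans (m%n<n m D) D<α)
    (λ (e , e′) → m≢n (≡.trans (m≡m%n+[m/n]*n m D) (≡.trans (≡.sym (≡.cong₂ (λ q r → r ℕ.+ q ℕ.* D) e e′)) (≡.sym (m≡m%n+[m/n]*n n D)))))
    where
    index<α : ∀ {m} → m < S → m / D < α
    index<α {m} m<S = ℕₚ.<-trans (m<n*o⇒m/o<n {m} {D} {D} m<S) D<α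

  open Kummer.Independence R isDomain p u a
    (λ m → eigen-⊗ (eigen-^ (lucas⇒frobenius seqA seqA-lucas) (m / D)) (eigen-^ (lucas⇒frobenius seqB seqB-lucas) (m % D)))
    (λ m → unit-⊗ {seqA ^ˢ (m / D)} {seqB ^ˢ (m % D)} (unit-^ seqA-0 (m / D)) (unit-^ seqB-0 (m % D)))
    S (D ℕ.+ D) K K<p a-below inequivalent using (independent)

  module _ (c : ℕ → ℕ → ℕ → Carrier) (vanishes : ∀ n → evaluate D c seqA seqB n ≈ 0#) where
    open SetoidReasoning setoid

    -- The coefficient of `X^j Y^k` as a polynomial in `z`. The values of `c` outside the range are
    -- arbitrary and must be replaced by zero.
    coefficients : ℕ → ℕ → Series
    coefficients j k i with i ℕ.<? D
    ... | yes _ = c i j k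
    ... | no  _ = 0#

    coefficients-< : ∀ {i} j k → i < D → coefficients j k i ≈ c i j k
    coefficients-< {i} j k i<D with i ℕ.<? D
    ... | yes _   = refl
    ... | no  i≮D = ⊥-elim (i≮D i<D)

    coefficients-below : ∀ j k → Below D (coefficients j k)
    coefficients-below j k i D≤i with i ℕ.<? D
    ... | yes i<D = ⊥-elim (ℕₚ.≤⇒≯ D≤i i<D)
    ... | no  _   = refl

    monomial-≡ : ∀ i → monomial i i ≈ 1#
    monomial-≡ i with i ℕ.≟ i
    ... | yes _   = refl
    ... | no  i≢i = ⊥-elim (i≢i ≡.refl)

    monomial-≢ : ∀ {i l} → l ≢ i → monomial i l ≈ 0#
    monomial-≢ {i} {l} l≢i with l ℕ.≟ i
    ... | yes l≡i = ⊥-elim (l≢i l≡i)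
    ... | no  _   = refl

    ∑-monomials : ∀ j k l → ∑ D (λ i → c i j k * monomial i l) ≈ coefficients j k l
    ∑-monomials j k l with l ℕ.<? D
    ... | yes l<D = trans (∑-single D l l<D (λ i _ i≢l → product-zero (inj₂ (monomial-≢ (i≢l ∘ ≡.sym)))))
                      (trans (*-congˡ (monomial-≡ l)) (*-identityʳ (c l j k)))
    ... | no  l≮D = ∑-zero D (λ i i<D → product-zero (inj₂ (monomial-≢ {i} {l} (λ { ≡.refl → l≮D i<D }))))

    collect : ∀ j k x n → ∑ D (λ i → c i j k * (monomial i ⊗ x) n) ≈ (coefficients j k ⊗ x) n
    collect j k x n = begin
      ∑ D (λ i → c i j k * (monomial i ⊗ x) n)
        ≈⟨ ∑-cong D (λ i _ → trans (sym (∑-*ˡ (suc n) (c i j k) _)) (∑-cong (suc n) (λ l _ → sym (*-assoc _ _ _)))) ⟩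
      ∑ D (λ i → ∑ (suc n) (λ l → (c i j k * monomial i l) * x (n ∸ l)))
        ≈⟨ ∑-swap D (suc n) _ ⟩
      ∑ (suc n) (λ l → ∑ D (λ i → (c i j k * monomial i l) * x (n ∸ l)))
        ≈⟨ ∑-cong (suc n) (λ l _ → trans (∑-*ʳ D (x (n ∸ l)) _) (*-congʳ (∑-monomials j k l))) ⟩
      (coefficients j k ⊗ x) n ∎

    at-∑ : ∀ s f n → Sums.∑ seriesRing s f n ≈ ∑ s (λ m → f m n)
    at-∑ zero    f n = refl
    at-∑ (suc s) f n = +-congʳ (at-∑ s f n)

    b : ℕ → Series
    b m = coefficients (m / D) (m % D)

    quotient : ∀ q r → r < D → (r ℕ.+ q ℕ.* D) / D ≡ q
    quotient q r r<D = ≡.trans (+-distrib-/-∣ʳ r (divides q ≡.refl)) (≡.cong₂ ℕ._+_ (m<n⇒m/n≡0 r<D) (m*n/n≡m q D))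

    remainder : ∀ q r → r < D → (r ℕ.+ q ℕ.* D) % D ≡ r
    remainder q r r<D = ≡.trans ([m+kn]%n≡m%n r q D) (m<n⇒m%n≡m r<D)

    relation : Sums.∑ seriesRing S (λ m → b m ⊗ u m) ≋ 0ˢ
    relation .at n = begin
      Sums.∑ seriesRing S (λ m → b m ⊗ u m) n
        ≈⟨ at-∑ S _ n ⟩
      ∑ S (λ m → (b m ⊗ u m) n)
        ≈⟨ ∑-blocks D D _ ⟩
      ∑ D (λ j → ∑ D (λ k → (b (k ℕ.+ j ℕ.* D) ⊗ u (k ℕ.+ j ℕ.* D)) n))
        ≈⟨ ∑-cong D (λ j _ → ∑-cong D (λ k k<D → reflexive (≡.cong₂ (λ j k → (coefficients j k ⊗ product-series j k) n)
             (quotient j k k<D) (remainder j k k<D)))) ⟩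
      ∑ D (λ j → ∑ D (λ k → (coefficients j k ⊗ product-series j k) n))
        ≈⟨ ∑-cong D (λ j _ → ∑-cong D (λ k _ → collect j k (product-series j k) n)) ⟨
      ∑ D (λ j → ∑ D (λ k → ∑ D (λ i → c i j k * (monomial i ⊗ product-series j k) n)))
        ≈⟨ ∑-cong D (λ j _ → ∑-swap D D _) ⟩
      ∑ D (λ j → ∑ D (λ i → ∑ D (λ k → c i j k * (monomial i ⊗ product-series j k) n)))
        ≈⟨ ∑-swap D D _ ⟩
      evaluate D c seqA seqB n
        ≈⟨ vanishes n ⟩
      0# ∎

    all-zero : ∀ i j k → i < D → j < D → k < D → c i j k ≈ 0#
    all-zero i j k i<D j<D k<D = begin
      c i j k                    ≈⟨ coefficients-< j k i<D ⟨
      coefficients j k i         ≡⟨ ≡.cong₂ (λ j k → coefficients j k i) (quotient j k k<D) (remainder j k k<D) ⟨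
      b (k ℕ.+ j ℕ.* D) i        ≈⟨ at (independent S N ℕₚ.≤-refl ℕₚ.≤-refl ℕₚ.≤-refl b
                                      (λ m _ → below-mono {x = b m} (ℕₚ.≤-trans (ℕₚ.m≤m+n D D) (ℕₚ.n≤1+n _)) (coefficients-below (m / D) (m % D)))
                                      relation (k ℕ.+ j ℕ.* D) (ℕₚ.≤-trans (ℕₚ.+-monoˡ-< (j ℕ.* D) k<D) (ℕₚ.*-monoˡ-≤ D j<D))) i ⟩
      0#                         ∎

-- Clearing denominators.

φ : ℤ → ℚ
φ i = i Rat./ 1

module _ where
  open Rat using (_+_; _*_)
  open ≡.≡-Reasoning

  φ-+ : ∀ i j → φ (i Int.+ j) ≡ φ i + φ j
  φ-+ i j = ℚₚ.toℚᵘ-injective (ℚᵘₚ.≃-trans (ℚₚ.toℚᵘ-fromℚᵘ (mkℚᵘ (i Int.+ j) 0)) (ℚᵘₚ.≃-trans (*≡* (identity i j))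
    (ℚᵘₚ.≃-sym (ℚᵘₚ.≃-trans (ℚₚ.toℚᵘ-homo-+ (φ i) (φ j))
      (ℚᵘₚ.+-cong (ℚₚ.toℚᵘ-fromℚᵘ (mkℚᵘ i 0)) (ℚₚ.toℚᵘ-fromℚᵘ (mkℚᵘ j 0)))))))
    where
    identity : ∀ i j → (i Int.+ j) Int.* + 1 ≡ (i Int.* + 1 Int.+ j Int.* + 1) Int.* + 1
    identity = ℤ-Solver.solve-∀

  φ-injective : ∀ {i} → φ i ≡ 0ℚ → i ≡ + 0
  φ-injective {i} e with ℚₚ./-injective-≃ (mkℚᵘ i 0) (mkℚᵘ (+ 0) 0) e
  ... | *≡* eq = ≡.trans (≡.sym (ℤₚ.*-identityʳ i)) eq

  φ-* : ∀ i j → φ (i Int.* j) ≡ φ i * φ j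
  φ-* i j = ℚₚ.toℚᵘ-injective (ℚᵘₚ.≃-trans (ℚₚ.toℚᵘ-fromℚᵘ (mkℚᵘ (i Int.* j) 0))
    (ℚᵘₚ.≃-sym (ℚᵘₚ.≃-trans (ℚₚ.toℚᵘ-homo-* (φ i) (φ j))
      (ℚᵘₚ.*-cong (ℚₚ.toℚᵘ-fromℚᵘ (mkℚᵘ i 0)) (ℚₚ.toℚᵘ-fromℚᵘ (mkℚᵘ j 0))))))

  n/d*d≡n : ∀ n d .{{_ : NonZero d}} → (n Rat./ d) * φ (+ d) ≡ φ n
  n/d*d≡n n (suc d) = ℚₚ.toℚᵘ-injective (ℚᵘₚ.≃-trans
    (ℚᵘₚ.≃-trans (ℚₚ.toℚᵘ-homo-* (n Rat./ suc d) (φ (+ suc d)))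
      (ℚᵘₚ.*-cong (ℚₚ.toℚᵘ-fromℚᵘ (mkℚᵘ n d)) (ℚₚ.toℚᵘ-fromℚᵘ (mkℚᵘ (+ suc d) 0))))
    (ℚᵘₚ.≃-trans (*≡* (≡.trans (ℤₚ.*-identityʳ (n Int.* + suc d)) (≡.cong (λ m → n Int.* + suc m) (≡.sym (ℕₚ.*-identityʳ d)))))
      (ℚᵘₚ.≃-sym (ℚₚ.toℚᵘ-fromℚᵘ (mkℚᵘ n 0)))))

  *φ-cancelʳ : ∀ d .{{_ : NonZero d}} {x y} → x * φ (+ d) ≡ y * φ (+ d) → x ≡ y
  *φ-cancelʳ d {x} {y} e = ≡.trans (≡.sym (undo x)) (≡.trans (≡.cong (_* (+ 1 Rat./ d)) e) (undo y))
    where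
    undo : ∀ x → (x * φ (+ d)) * (+ 1 Rat./ d) ≡ x
    undo x = ≡.trans (ℚₚ.*-assoc x (φ (+ d)) (+ 1 Rat./ d)) (≡.trans
      (≡.cong (x *_) (≡.trans (ℚₚ.*-comm (φ (+ d)) (+ 1 Rat./ d)) (n/d*d≡n (+ 1) d))) (ℚₚ.*-identityʳ x))

  numerator : ∀ x → x * φ (+ (↧ₙ x)) ≡ φ (↥ x)
  numerator x = ≡.trans (≡.cong (_* φ (+ (↧ₙ x))) (≡.sym (ℚₚ.↥p/↧p≡p x))) (n/d*d≡n (↥ x) (↧ₙ x))

  integral : ∀ x m → (↧ₙ x) ∣ m → φ (↥ x Int.* + (m / ↧ₙ x)) ≡ x * φ (+ m)
  integral x m d∣m = begin
    φ (↥ x Int.* + q)                    ≡⟨ φ-* (↥ x) (+ q) ⟩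
    φ (↥ x) * φ (+ q)                    ≡⟨ ≡.cong (_* φ (+ q)) (numerator x) ⟨
    x * φ (+ (↧ₙ x)) * φ (+ q)           ≡⟨ ℚₚ.*-assoc x (φ (+ (↧ₙ x))) (φ (+ q)) ⟩
    x * (φ (+ (↧ₙ x)) * φ (+ q))         ≡⟨ ≡.cong (x *_) (φ-* (+ (↧ₙ x)) (+ q)) ⟨
    x * φ (+ (↧ₙ x) Int.* + q)           ≡⟨ ≡.cong (λ n → x * φ n) (≡.sym (ℤₚ.pos-* (↧ₙ x) q)) ⟩
    x * φ (+ ((↧ₙ x) ℕ.* q))             ≡⟨ ≡.cong (λ n → x * φ (+ n)) (≡.trans (ℕₚ.*-comm (↧ₙ x) q) (m/n*n≡m d∣m)) ⟩
    x * φ (+ m)                          ∎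
    where
    q : ℕ
    q = m / ↧ₙ x

∏ : ℕ → (ℕ → ℕ) → ℕ
∏ zero    f = 1
∏ (suc n) f = ∏ n f ℕ.* f n

∏-∣ : ∀ {i} n f → i < n → f i ∣ ∏ n f
∏-∣ {i} (suc n) f i≤n with i ℕ.≟ n
... | yes ≡.refl = ∣n⇒∣m*n (∏ n f) ∣-refl
... | no  i≢n    = ∣m⇒∣m*n (f n) (∏-∣ n f (ℕₚ.≤∧≢⇒< (ℕₚ.≤-pred i≤n) i≢n))

∏-≢0 : ∀ n f → (∀ i → NonZero (f i)) → NonZero (∏ n f)
∏-≢0 zero    f nz = _
∏-≢0 (suc n) f nz = ℕₚ.m*n≢0 (∏ n f) (f n) {{∏-≢0 n f nz}} {{nz n}}

-- A crude common multiple of all entries. It serves both as a common denominator and, through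
-- divisibility, as an upper bound for the coefficients.
∏³ : ℕ → (ℕ → ℕ → ℕ → ℕ) → ℕ
∏³ n f = ∏ n λ i → ∏ n λ j → ∏ n (f i j)

∏³-∣ : ∀ {i j k} n f → i < n → j < n → k < n → f i j k ∣ ∏³ n f
∏³-∣ {i} {j} {k} n f i<n j<n k<n = ∣-trans (∏-∣ {k} n (f i j) k<n)
  (∣-trans (∏-∣ {j} n (λ j → ∏ n (f i j)) j<n) (∏-∣ {i} n (λ i → ∏ n λ j → ∏ n (f i j)) i<n))

∏³-≢0 : ∀ n f → (∀ i j k → NonZero (f i j k)) → NonZero (∏³ n f)
∏³-≢0 n f nz = ∏-≢0 n _ λ i → ∏-≢0 n _ λ j → ∏-≢0 n _ λ k → nz i j k

module ℤ-Evaluation = Evaluation ℤₚ.+-*-commutativeRing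
module ℤ-Sequences = Sequences ℤₚ.+-*-commutativeRing
module ℚ-Evaluation = Evaluation ℚₚ.+-*-commutativeRing
module ℚ-Sums = Sums ℚₚ.+-*-commutativeRing

module ℚ-Bridge where
  open PowerSeriesRing ℚₚ.+-*-commutativeRing using (_⊗_)
  open Polynomials ℚₚ.+-*-commutativeRing using (_^ˢ_)
  open ℚ-Sums using (∑)
  open Rat using (_*_)

  sumBelow≡∑ : ∀ n {f g} → (∀ k → f k ≡ g k) → sumBelow n f ≡ ∑ n g
  sumBelow≡∑ zero    e = ≡.refl
  sumBelow≡∑ (suc n) e = ≡.cong₂ Rat._+_ (sumBelow≡∑ n e) (e n)

  ⊛≡⊗ : ∀ {x y x′ y′} → (∀ n → x n ≡ x′ n) → (∀ n → y n ≡ y′ n) → ∀ n → (x ⊛ y) n ≡ (x′ ⊗ y′) n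
  ⊛≡⊗ e e′ n = sumBelow≡∑ (suc n) (λ k → ≡.cong₂ _*_ (e k) (e′ (n ∸ k)))

  ^S≡^ˢ : ∀ f j n → (f ^S j) n ≡ (f ^ˢ j) n
  ^S≡^ˢ f zero    zero    = ≡.refl
  ^S≡^ˢ f zero    (suc n) = ≡.refl
  ^S≡^ˢ f (suc j) n       = ⊛≡⊗ {f} {f ^S j} {f} {f ^ˢ j} (λ _ → ≡.refl) (^S≡^ˢ f j) n

  zpow≡monomial : ∀ i n → zpow i n ≡ ℚ-Evaluation.monomial i n
  zpow≡monomial i n with n ℕ.≟ i
  ... | yes _ = ≡.refl
  ... | no  _ = ≡.refl

  evalPoly≡evaluate : ∀ D c f g n → evalPoly D c f g n ≡ ℚ-Evaluation.evaluate D c f g n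
  evalPoly≡evaluate D c f g n = sumBelow≡∑ D λ i → sumBelow≡∑ D λ j → sumBelow≡∑ D λ k →
    ≡.cong (c i j k *_) (⊛≡⊗ (zpow≡monomial i) (⊛≡⊗ (^S≡^ˢ f j) (^S≡^ˢ g k)) n)

  evaluate-scale : ∀ D c x f g n →
    ℚ-Evaluation.evaluate D (λ i j k → c i j k * x) f g n ≡ ℚ-Evaluation.evaluate D c f g n * x
  evaluate-scale D c x f g n = scale λ i → scale λ j → scale λ k →
    ≡.trans (ℚₚ.*-assoc (c i j k) x _) (≡.trans (≡.cong (c i j k *_) (ℚₚ.*-comm x _)) (≡.sym (ℚₚ.*-assoc (c i j k) _ x)))
    where
    scale : ∀ {f g} → (∀ k → f k ≡ g k * x) → ∑ D f ≡ ∑ D g * x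
    scale {f} {g} e = ≡.trans (ℚ-Sums.∑-cong D (λ k _ → e k)) (ℚ-Sums.∑-*ʳ D x g)

module Integrality where
  open RingExtras ℤₚ.+-*-commutativeRing using (ι; _^_; ι-^; ι-*)
  open ℤ-Sequences

  ι≡+ : ∀ n → ι n ≡ + n
  ι≡+ zero    = ≡.refl
  ι≡+ (suc n) = ≡.cong Int.suc (ι≡+ n)

  seqA≡central : ∀ n → seqA n ≡ + central n
  seqA≡central n = ≡.trans (≡.sym (ι-* ((4 ℕ.* n) C (2 ℕ.* n)) ((2 ℕ.* n) C n))) (ι≡+ (central n))

  φ-seqA : ∀ n → φ (seqA n) ≡ seriesA n
  φ-seqA n = *φ-cancelʳ D {{D≢0}} (begin
    φ (seqA n) Rat.* φ (+ D)                ≡⟨ φ-* (seqA n) (+ D) ⟨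
    φ (seqA n Int.* + D)                    ≡⟨ ≡.cong (λ i → φ (i Int.* + D)) (seqA≡central n) ⟩
    φ (+ central n Int.* + D)               ≡⟨ ≡.cong φ (≡.sym (ℤₚ.pos-* (central n) D)) ⟩
    φ (+ (central n ℕ.* D))                 ≡⟨ ≡.cong (φ ∘ +_) (central-! n) ⟩
    φ (+ ((4 ℕ.* n) !))                     ≡⟨ n/d*d≡n (+ ((4 ℕ.* n) !)) D {{D≢0}} ⟨
    seriesA n Rat.* φ (+ D)                 ∎)
    where
    open ≡.≡-Reasoning
    D : ℕ
    D = (2 ℕ.* n) ! ℕ.* (n ! ℕ.* n !)
    D≢0 : NonZero D
    D≢0 = ℕₚ.m*n≢0 ((2 ℕ.* n) !) (n ! ℕ.* n !) {{(2 ℕ.* n) ℕₚ.!≢0}} {{n ℕₚ.!* n !≢0}}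

  open Homomorphism ℤₚ.+-*-commutativeRing ℚₚ.+-*-commutativeRing

  φ-seqB : ∀ n → φ (seqB n) ≡ seriesB n
  φ-seqB n = ≡.trans (h-∑ φ (≡.cong φ) φ-+ φ-* ≡.refl ≡.refl (suc n) (λ k → ι (n C k) ^ 6))
    (≡.sym (ℚ-Bridge.sumBelow≡∑ (suc n) (λ k → ≡.cong φ (≡.trans (≡.sym (ι≡+ ((n C k) ℕ.^ 6))) (ι-^ (n C k) 6)))))

  integral-relation : ∀ D (c : ℕ → ℕ → ℕ → ℚ) (c′ : ℕ → ℕ → ℕ → ℤ) m →
    (∀ i j k → i < D → j < D → k < D → φ (c′ i j k) ≡ c i j k Rat.* φ (+ m)) →
    (∀ n → evalPoly D c seriesA seriesB n ≡ 0ℚ) → ∀ n → ℤ-Evaluation.evaluate D c′ seqA seqB n ≡ + 0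
  integral-relation D c c′ m e vanishes n = φ-injective (begin
    φ (ℤ-Evaluation.evaluate D c′ seqA seqB n)
      ≡⟨ h-evaluate φ (≡.cong φ) φ-+ φ-* ≡.refl ≡.refl D {c′} {λ i j k → c i j k Rat.* φ (+ m)} e φ-seqA φ-seqB n ⟩
    ℚ-Evaluation.evaluate D (λ i j k → c i j k Rat.* φ (+ m)) seriesA seriesB n
      ≡⟨ ℚ-Bridge.evaluate-scale D c (φ (+ m)) seriesA seriesB n ⟩
    ℚ-Evaluation.evaluate D c seriesA seriesB n Rat.* φ (+ m)
      ≡⟨ ≡.cong (Rat._* φ (+ m)) (≡.trans (≡.sym (ℚ-Bridge.evalPoly≡evaluate D c seriesA seriesB n)) (vanishes n)) ⟩
    0ℚ Rat.* φ (+ m)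
      ≡⟨ ℚₚ.*-zeroˡ (φ (+ m)) ⟩
    0ℚ ∎)
    where open ≡.≡-Reasoning

-- From residues modulo a large prime back to ℤ and ℚ.

-- The prime is chosen with `t ≥ 2K + M`: the part `2K` is what independence modulo `p` demands, and
-- `M` makes `p` exceed every coefficient in absolute value, so a coefficient divisible by `p` is
-- zero.
integral-independence : ∀ D .{{_ : NonZero D}} (c : ℕ → ℕ → ℕ → ℤ) →
  (∀ n → ℤ-Evaluation.evaluate D c ℤ-Sequences.seqA ℤ-Sequences.seqB n ≡ + 0) →
  ∀ i j k → i < D → j < D → k < D → c i j k ≡ + 0
integral-independence D c vanishes i j k i<D j<D k<D = conclude (primes-5-mod-12 (K ℕ.+ K ℕ.+ M))
  where
  K M : ℕ
  K = degreeBound D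
  M = ∏³ D λ i j k → suc ∣ c i j k ∣
  ∣c∣<M : ∣ c i j k ∣ < M
  ∣c∣<M = ∣⇒≤ {{∏³-≢0 D _ (λ _ _ _ → _)}} (∏³-∣ D (λ i j k → suc ∣ c i j k ∣) i<D j<D k<D)
  conclude : _ → c i j k ≡ + 0
  conclude (t , large , isPrime) = ℤₚ.∣i∣≡0⇒i≡0 (small (≈0⇒∣ (all-zero c vanishes′ i j k i<D j<D k<D)))
    where
    p : ℕ
    p = suc (t ℕ.* 12 ℕ.+ 4)
    open IntegersModulo p using (ring/p; isDomain; characteristic; ≈0⇒∣; ≡⇒≈)
    open CommutativeRing ring/p using (trans; sym; _≈_)
    open ModularIndependence ring/p (isDomain isPrime) p (characteristic isPrime) t ≡.refl D
      (ℕₚ.≤-trans (ℕₚ.m≤m+n (K ℕ.+ K) M) large) using (all-zero)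
    open Homomorphism ℤₚ.+-*-commutativeRing ring/p
    vanishes′ : ∀ n → Evaluation.evaluate ring/p D c (Sequences.seqA ring/p) (Sequences.seqB ring/p) n ≈ + 0
    vanishes′ n = trans (sym (h-evaluate (λ a → a) ≡⇒≈ (λ _ _ → ≡⇒≈ ≡.refl) (λ _ _ → ≡⇒≈ ≡.refl) (≡⇒≈ ≡.refl) (≡⇒≈ ≡.refl)
      D {c} {c} {ℤ-Sequences.seqA} {Sequences.seqA ring/p} {ℤ-Sequences.seqB} {Sequences.seqB ring/p} (λ _ _ _ _ _ _ → ≡⇒≈ ≡.refl)
      (h-seqA (λ a → a) ≡⇒≈ (λ _ _ → ≡⇒≈ ≡.refl) (λ _ _ → ≡⇒≈ ≡.refl) (≡⇒≈ ≡.refl) (≡⇒≈ ≡.refl))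
      (h-seqB (λ a → a) ≡⇒≈ (λ _ _ → ≡⇒≈ ≡.refl) (λ _ _ → ≡⇒≈ ≡.refl) (≡⇒≈ ≡.refl) (≡⇒≈ ≡.refl)) n)) (≡⇒≈ (vanishes n))
    M≤p : M ≤ p
    M≤p = ℕₚ.≤-trans (ℕₚ.m≤n+m M (K ℕ.+ K)) (ℕₚ.≤-trans large
      (ℕₚ.≤-trans (ℕₚ.m≤m*n t 12) (ℕₚ.≤-trans (ℕₚ.m≤m+n _ 4) (ℕₚ.n≤1+n _))))
    small : p ∣ ∣ c i j k ∣ → ∣ c i j k ∣ ≡ 0
    small p∣c with ∣ c i j k ∣ | ∣c∣<M
    ... | zero  | _   = ≡.refl
    ... | suc a | a<M = ⊥-elim (>⇒∤ (ℕₚ.<-≤-trans a<M M≤p) p∣c)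

theorem6p8 : AlgIndep seriesA seriesB
theorem6p8 d c vanishes i j k i<d j<d k<d = *φ-cancelʳ m {{m≢0}} (begin
  c i j k Rat.* φ (+ m)     ≡⟨ clear i j k i<d j<d k<d ⟨
  φ (c′ i j k)              ≡⟨ ≡.cong φ (integral-independence d {{ℕ.>-nonZero (ℕₚ.≤-trans (s≤s z≤n) i<d)}} c′
                                 (Integrality.integral-relation d c c′ m clear vanishes) i j k i<d j<d k<d) ⟩
  0ℚ                        ≡⟨ ℚₚ.*-zeroˡ (φ (+ m)) ⟨
  0ℚ Rat.* φ (+ m)          ∎)
  where
  open ≡.≡-Reasoning
  m : ℕ
  -- A common denominator of the coefficients in range. It is nonzero, so the scaling by `m` can be
  -- undone at the end.
  m = ∏³ d λ i j k → ↧ₙ (c i j k)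
  m≢0 : NonZero m
  m≢0 = ∏³-≢0 d _ (λ _ _ _ → _)
  c′ : ℕ → ℕ → ℕ → ℤ
  c′ i j k = ↥ (c i j k) Int.* + (m / ↧ₙ (c i j k))
  clear : ∀ i j k → i < d → j < d → k < d → φ (c′ i j k) ≡ c i j k Rat.* φ (+ m)
  clear i j k i<d j<d k<d = integral (c i j k) m (∏³-∣ d (λ i j k → ↧ₙ (c i j k)) i<d j<d k<d)
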